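{- Let $q$ be a prime power and let $n,k,\delta$ be integers with $n\geq2k>2\delta>0$. Put $m=n-k$. Then $$\bar{A}_q(n,2\delta,k)\geq q^{(n-k)(k-\delta+1)}+\begin{cases}\displaystyle\sum_{i=\delta}^{k-\delta}A_i(\delta)+1, & k\geq 2\delta;\\[2ex] \displaystyle\max_{1\leq a <\delta}\left\lceil\frac{\sum_{i=1}^{k-\delta}A_i(a)}{q^{m(\delta-a)}-1}\right\rceil, & k<2\delta,\end{cases}$$ where $A_i(x)$ denotes the number of codewords of rank $i$ in an MRD$[(n-k)\times k,x]_q$ code.
   Context: $\mathcal G_q(n,k)$ is the set of $k$-dimensional subspaces of $\mathbb F_q^n$, with subspace distance $d_S(\mathcal U,\mathcal V)=\dim\mathcal U+\dim\mathcal V-2\dim(\mathcal U\cap\mathcal V)$. An $(n,d,k)_q$-CDC is a subset of $\mathcal G_q(n,k)$ with pairwise subspace distance at least $d$. An MRD$[a\times b,\delta]_q$ code is an $\mathbb F_q$-linear subspace of $\mathbb F_q^{a\times b}$ of dimension $\max\{a,b\}(\min\{a,b\}-\delta+1)$ whose nonzero elements all have rank at least $\delta$; the number of codewords of each rank depends only on $a,b,\delta,q$. A lifted MRD code is $\{\mathrm{rowspace}(\boldsymbol I_k\mid\boldsymbol A):\boldsymbol A\in\mathcal D\}$ for an MRD$[k\times(n-k),\delta]_q$ code $\mathcal D$. $\bar A_q(n,2\delta,k)$ denotes the maximum number of codewords of an $(n,2\delta,k)_q$-CDC containing a lifted MRD code as a subset. -}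

module Defs where

open import Data.Nat as ℕ using (ℕ; zero; suc; _≤_; _<_; _∸_; _^_; _⊔_; _⊓_)
open import Data.Nat.Primality using (Prime)
open import Data.Nat.DivMod using (_/_)
open import Data.Fin using (Fin; toℕ; fromℕ<; _≟_)
open import Data.Nat.Properties using (∸-monoˡ-<; ≮⇒≥)
open import Data.Fin.Properties using (toℕ<n)
open import Data.List.Membership.Propositional using (_∈_)
open import Data.Fin.Properties using (all?)
open import Data.Bool using (Bool; true; false; _∧_; _∨_; not; if_then_else_)
open import Data.List using (List; []; _∷_; map; concatMap; foldr; length; filter; upTo; allFin)
open import Data.Nat.ListAction using (sum)
open import Data.Bool.ListAction using (all; any)
open import Data.Product using (Σ; ∃; _×_; _,_)
open import Relation.Nullary using (¬_; Dec; yes; no)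
open import Relation.Nullary.Decidable using (⌊_⌋)
open import Relation.Binary.PropositionalEquality using (_≡_)
open import Algebra.Structures using (IsCommutativeRing)

IsPrimePower : ℕ → Set
IsPrimePower q = Σ ℕ λ p → Σ ℕ λ e → Prime p × (q ≡ p ^ suc e)

record FiniteField (q : ℕ) : Set where
  field
    _+F_ _*F_ : Fin q → Fin q → Fin q
    -F_        : Fin q → Fin q
    0F 1F      : Fin q
    isCommRing : IsCommutativeRing _≡_ _+F_ _*F_ -F_ 0F 1F
    0≢1        : ¬ (0F ≡ 1F)
    inv        : ∀ x → ¬ (x ≡ 0F) → Σ (Fin q) λ y → (x *F y) ≡ 1F

allFuns : {A : Set} → (n : ℕ) → List A → List (Fin n → A)
allFuns zero    xs = (λ ()) ∷ []
allFuns (suc n) xs =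
  concatMap (λ x → map (λ f → λ { Fin.zero → x ; (Fin.suc i) → f i }) (allFuns n xs)) xs

sumFin : (n : ℕ) → (Fin n → ℕ) → ℕ
sumFin n f = sum (map f (allFin n))

-- Σ_{i = lo}^{hi} f i  (empty if hi < lo)
sumRange : ℕ → ℕ → (ℕ → ℕ) → ℕ
sumRange lo hi f = sum (map (λ j → f (lo ℕ.+ j)) (upTo (suc hi ∸ lo)))

maxList : List ℕ → ℕ
maxList = foldr _⊔_ 0

-- ⌈ x / y ⌉ for y ≥ 1 (value 0 for y = 0, never used)
ceilDiv : ℕ → ℕ → ℕ
ceilDiv x zero    = 0
ceilDiv x (suc y) = (x ℕ.+ y) / suc y

module LinAlg {q : ℕ} (F : FiniteField q) where
  open FiniteField F

  Scalar : Set
  Scalar = Fin q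

  Vector : ℕ → Set
  Vector n = Fin n → Scalar

  Matrix : ℕ → ℕ → Set
  Matrix a b = Fin a → Fin b → Scalar

  scalars : List Scalar
  scalars = allFin q

  allVectors : (n : ℕ) → List (Vector n)
  allVectors n = allFuns n scalars

  sumF : (n : ℕ) → (Fin n → Scalar) → Scalar
  sumF n f = foldr _+F_ 0F (map f (allFin n))

  isZeroV : {n : ℕ} → Vector n → Bool
  isZeroV {n} v = ⌊ all? (λ j → v j ≟ 0F) ⌋

  eqV : {n : ℕ} → Vector n → Vector n → Bool
  eqV {n} u v = ⌊ all? (λ j → u j ≟ v j) ⌋

  lincomb : {a b : ℕ} → Vector a → Matrix a b → Vector b
  lincomb {a} c M j = sumF a (λ i → c i *F M i j)

  rowSpace : {a b : ℕ} → Matrix a b → List (Vector b)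
  rowSpace {a} M = map (λ c → lincomb c M) (allVectors a)

  inSpan : {a b : ℕ} → Vector b → Matrix a b → Bool
  inSpan v M = any (eqV v) (rowSpace M)

  -- the rows of M indexed by S (S i = true) are linearly independent:
  -- every linear relation supported on S is trivial
  independentRows : {a b : ℕ} → (Fin a → Bool) → Matrix a b → Bool
  independentRows {a} S M =
    all (λ c → not (isZeroV (lincomb c M))
               ∨ isZeroV c
               ∨ any (λ i → not (S i) ∧ not ⌊ c i ≟ 0F ⌋) (allFin a))
        (allVectors a)

  countTrue : {a : ℕ} → (Fin a → Bool) → ℕ
  countTrue {a} S = length (filter (λ i → S i Data.Bool.≟ true) (allFin a))

  rank : {a b : ℕ} → Matrix a b → ℕ
  rank {a} M =
    maxList (map (λ S → if independentRows S M then countTrue S else 0)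
                 (allFuns a (true ∷ false ∷ [])))

  listMatrix : {b : ℕ} → (vs : List (Vector b)) → Matrix (length vs) b
  listMatrix vs i = Data.List.lookup vs i

  dimSpace : {a b : ℕ} → Matrix a b → ℕ
  dimSpace = rank

  dimIntersection : {a a' b : ℕ} → Matrix a b → Matrix a' b → ℕ
  dimIntersection U V = rank (listMatrix (filter (λ v → inSpan v V Data.Bool.≟ true) (rowSpace U)))

  subspaceDist : {a a' b : ℕ} → Matrix a b → Matrix a' b → ℕ
  subspaceDist U V = dimSpace U ℕ.+ dimSpace V ∸ 2 ℕ.* dimIntersection U V

  SameSpace : {a a' b : ℕ} → Matrix a b → Matrix a' b → Set
  SameSpace U V = (∀ i → inSpan (U i) V ≡ true) × (∀ i → inSpan (V i) U ≡ true)

  -- MRD codes: an F_q-linear subspace D of F^{a×b} of dimension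
  -- max(a,b)(min(a,b) − δ + 1), given by a basis, all of whose nonzero
  -- elements have rank ≥ δ.

  mrdDim : ℕ → ℕ → ℕ → ℕ
  mrdDim a b δ = (a ⊔ b) ℕ.* (suc (a ⊓ b) ∸ δ)

  matComb : {N a b : ℕ} → Vector N → (Fin N → Matrix a b) → Matrix a b
  matComb {N} c G i j = sumF N (λ t → c t *F G t i j)

  isZeroM : {a b : ℕ} → Matrix a b → Bool
  isZeroM {a} {b} M = ⌊ all? (λ i → all? (λ j → M i j ≟ 0F)) ⌋

  record MRD (a b δ : ℕ) : Set where
    field
      basis       : Fin (mrdDim a b δ) → Matrix a b
      independent : ∀ c → isZeroM (matComb c basis) ≡ true → isZeroV c ≡ true
      minRank     : ∀ c → isZeroM (matComb c basis) ≡ false → δ ≤ rank (matComb c basis)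

    -- the codewords of D (each listed exactly once, by independence)
    codewords : List (Matrix a b)
    codewords = map (λ c → matComb c basis) (allVectors (mrdDim a b δ))

    rankCount : ℕ → ℕ
    rankCount i = length (filter (λ M → rank M ℕ.≟ i) codewords)

  -- Constant dimension codes, given by generator matrices (k × n of rank k)

  record CDC (n d k : ℕ) : Set where
    field
      gens     : List (Matrix k n)
      fullRank : ∀ i → rank (Data.List.lookup gens i) ≡ k
      distance : ∀ i j → ¬ (i ≡ j) →
                 d ≤ subspaceDist (Data.List.lookup gens i) (Data.List.lookup gens j)

    size : ℕ
    size = length gens

  -- generator matrix (I_k | A) of size k × n, for A ∈ F^{k × (n−k)}
  lift : {k n : ℕ} → Matrix k (n ∸ k) → Matrix k n
  lift {k} {n} A i j with toℕ j ℕ.<? k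
  ... | yes _  = if ⌊ toℕ i ℕ.≟ toℕ j ⌋ then 1F else 0F
  ... | no j≮k = A i (fromℕ< (∸-monoˡ-< (toℕ<n j) (≮⇒≥ j≮k)))

  ContainsLifted : {n d k δ : ℕ} → CDC n d k → MRD k (n ∸ k) δ → Set
  ContainsLifted C D =
    ∀ A → A ∈ MRD.codewords D →
      Σ (Fin (length (CDC.gens C))) λ i →
        SameSpace (Data.List.lookup (CDC.gens C) i) (lift A)

  -- Ā_q(n, 2δ, k) ≥ N : some (n,2δ,k)_q-CDC containing a lifted
  -- MRD[k × (n−k), δ]_q code as a subset has at least N codewords.
  AbarGe : (n δ k N : ℕ) → Set
  AbarGe n δ k N =
    Σ (CDC n (2 ℕ.* δ) k) λ C → Σ (MRD k (n ∸ k) δ) λ D →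
      ContainsLifted C D × (N ≤ CDC.size C)

  -- Right-hand side of Theorem 2.7, with m = n − k and A_i(x) the number
  -- of rank-i codewords of the given MRD[m × k, x]_q codes.
  -- Dδ    : an MRD[m × k, δ]_q code,
  -- Dlow a: an MRD[m × k, 1 + a]_q code, for a = 0, …, δ − 2.

  bound2p7 : (n k δ : ℕ) → MRD (n ∸ k) k δ →
             ((a : Fin (δ ∸ 1)) → MRD (n ∸ k) k (suc (toℕ a))) → ℕ
  bound2p7 n k δ Dδ Dlow =
    q ^ (m ℕ.* (k ∸ δ ℕ.+ 1)) ℕ.+
      (if ⌊ 2 ℕ.* δ ℕ.≤? k ⌋
        then sumRange δ (k ∸ δ) (MRD.rankCount Dδ) ℕ.+ 1
        else maxList (map (λ a →
               ceilDiv (sumRange 1 (k ∸ δ) (MRD.rankCount (Dlow a)))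
                       (q ^ (m ℕ.* (δ ∸ suc (toℕ a))) ∸ 1))
             (allFin (δ ∸ 1))))
    where
      m : ℕ
      m = n ∸ k

{-# OPTIONS --safe #-}
-- Besides the lifted code {(I | A)}, put in the spaces (Z | I) with Z in a set of pairwise
-- rank distance ≥ δ and rank Z ≤ k − δ: the first k columns of (Z | I) then have rank ≤ k − δ, so it
-- meets every (I | A) in dimension ≤ k − δ.  For k ≥ 2δ the words of rank ≤ k − δ of the given MRD
-- code serve as the Z.  For k < 2δ, a Gabidulin code of minimum rank δ contains no nonzero word of
-- rank ≤ k − δ; it sits inside a Gabidulin code of minimum rank a with q^(m(δ−a)) cosets, so some
-- nontrivial coset has the required share of the words of rank 1, …, k − δ.  The number of these is
-- that of any MRD code with the same parameters: counting the pairs (X, P) with XP = 0 and P of size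
-- k × t gives the sum of A_i (q^t)^(k−i), whose base-q^t digits are the A_i once t is large.
-- The field of q^m elements that Gabidulin codes need is cut out of F[x]/(xⁿ − 1), n = q^m − 1, by a
-- minimal idempotent on which x keeps m distinct conjugates.
module Submission where

open import Defs
open import Level using (0ℓ)
open import Algebra.Bundles using (CommutativeRing)
open import Data.Nat as ℕ using (ℕ; zero; suc; _≤_; _<_; s≤s; z≤n; _∸_)
import Data.Nat.Properties as ℕ
open import Data.Fin as Fin using (Fin; zero; suc; toℕ)
import Data.Fin.Properties as Fin
open import Data.List using (List; []; _∷_; map; concatMap; filter; length; lookup; allFin; _++_)
open import Data.List.Relation.Unary.All as All using (All; []; _∷_)
import Data.List.Relation.Unary.All.Properties as All
open import Data.List.Relation.Unary.Any as Any using (Any; here; there)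
import Data.List.Relation.Unary.Any.Properties as Any
open import Data.List.Relation.Unary.AllPairs as AllPairs using (AllPairs; []; _∷_)
import Data.List.Relation.Unary.AllPairs.Properties as AllPairs
open import Data.Product using (∃; Σ; _,_; proj₁; proj₂)
open import Data.Sum as Sum using (_⊎_; inj₁; inj₂)
open import Function using (_∘_; id; flip; Equivalence)
open import Relation.Nullary

-- Two k-spaces have distance at least 2δ exactly when they meet in dimension at most k - δ; this is
-- where the bound on rank Z comes from. The given codes of different minimum ranks are unrelated,
-- while cosets need one code inside another. Hence a nested pair of Gabidulin codes is built, and
-- the rank counts of the given code are carried over to the larger of the two. The carrying over
-- rests on one fact. With u = k + 1 - d, evaluating words of minimum rank d on u independent
-- vectors is a bijection onto all tuples of values, because the dimension is m u. So the number of
-- words killing the rows of P depends only on the rank of P. For the field, the product of the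
-- differences x^(q^d) - x with 0 < d < m has degree q + ... + q^(m-1), which is below n. It is
-- therefore nonzero, a power of it is idempotent, and below that idempotent no two of the m
-- conjugates of x can coincide. Vectors and matrices are functions, compared pointwise only.
-- Injections between finite sets therefore appear as relations between lists, and dimensions are
-- compared through powers of q.

-- Counting in lists up to a relation, double counting, digits and pigeonhole.

module Counting where

  open import Data.Bool using (true; false)
  open import Data.Nat hiding (_/_; _%_)
  open import Data.Nat.Properties
  open import Data.Nat.DivMod
  open import Data.Nat.ListAction using (sum)
  open import Data.List.Properties using (length-map; length-++; filter-++; filter-≐; filter-none;
       filter-accept; filter-reject)
  import Data.List.Properties
  open import Data.List.Membership.Propositional.Properties using (∈-lookup)
  open import Data.Product using (_×_)
  open import Relation.Unary using (Decidable)
  open import Relation.Binary using (Symmetric)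
  open import Relation.Binary.PropositionalEquality
  open import Defs

  private variable
    A B B′ : Set

  AllPairs-lookup : {S : A → A → Set} → Symmetric S → ∀ {xs} → AllPairs S xs →
                    ∀ i j → i ≢ j → S (lookup xs i) (lookup xs j)
  AllPairs-lookup sy (p ∷ ps) zero    zero    i≢j = contradiction refl i≢j
  AllPairs-lookup sy (p ∷ ps) zero    (suc j) i≢j = All.lookup p (∈-lookup j)
  AllPairs-lookup sy (p ∷ ps) (suc i) zero    i≢j = sy (All.lookup p (∈-lookup i))
  AllPairs-lookup sy (p ∷ ps) (suc i) (suc j) i≢j = AllPairs-lookup sy ps i j (i≢j ∘ cong suc)

  module _ (R : A → B → Set) where

    -- The form injectivity takes for a relation. A map into a list of functions hits an entry only
    -- up to pointwise equality, so it is given by the entries it is related to.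
    Separated : A → A → Set
    Separated x x′ = ∀ y → R x y → ¬ R x′ y

    -- Each entry of `xs` is sent to the position of a witness in `ys`; separated entries cannot
    -- share a witness.
    length-≤ : ∀ {xs ys} → AllPairs Separated xs → All (λ x → Any (R x) ys) xs →
               length xs ≤ length ys
    length-≤ {xs} {ys} sep hit = Fin.injective⇒≤ inj
      where
      at : ∀ i → Any (R (lookup xs i)) ys
      at i = All.lookup hit (∈-lookup i)

      inj : ∀ {i j} → Any.index (at i) ≡ Any.index (at j) → i ≡ j
      inj {i} {j} eq with i Fin.≟ j
      ... | yes i≡j = i≡j
      ... | no  i≢j = contradiction
        (subst (λ l → R (lookup xs j) (lookup ys l)) (sym eq) (Any.lookup-index (at j)))
        (AllPairs-lookup {S = Separated} (λ s y r r′ → s y r′ r) sep i j i≢j _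
           (Any.lookup-index (at i)))

  module _ {P : A → Set} (P? : Decidable P) where

    count : List A → ℕ
    count xs = length (filter P? xs)

    count-accept : ∀ {x xs} → P x → count (x ∷ xs) ≡ suc (count xs)
    count-accept p = cong length (filter-accept P? p)

    count-reject : ∀ {x xs} → ¬ P x → count (x ∷ xs) ≡ count xs
    count-reject ¬p = cong length (filter-reject P? ¬p)

    count-++ : ∀ xs ys → count (xs ++ ys) ≡ count xs + count ys
    count-++ xs ys = trans (cong length (filter-++ P? xs ys)) (length-++ (filter P? xs))

    count-map : ∀ (f : B → A) xs → count (map f xs) ≡ length (filter (P? ∘ f) xs)
    count-map f [] = refl
    count-map f (x ∷ xs) with P? (f x)
    ... | yes _ = cong suc (count-map f xs)
    ... | no  _ = count-map f xs

  count-≐ : {P Q : A → Set} (P? : Decidable P) (Q? : Decidable Q) →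
            (∀ {x} → P x → Q x) → (∀ {x} → Q x → P x) → ∀ xs → count P? xs ≡ count Q? xs
  count-≐ P? Q? f g xs = cong length (filter-≐ P? Q? (f , g) xs)

  Any-filter⁺ : {P Q : A → Set} (Q? : Decidable Q) → ∀ {xs} →
                Any (λ x → P x × Q x) xs → Any P (filter Q? xs)
  Any-filter⁺ Q? {x ∷ xs} (here (p , q)) rewrite filter-accept Q? {xs = xs} q = here p
  Any-filter⁺ Q? {x ∷ xs} (there a) with Q? x
  ... | yes _ = there (Any-filter⁺ Q? a)
  ... | no  _ = Any-filter⁺ Q? a

  module _ {P Q : A → Set} (P? : Decidable P) (Q? : Decidable Q) where

    count-≤ : (R : A → A → Set) {S : A → A → Set} → (∀ {x x′} → S x x′ → Separated R x x′) →
              ∀ {xs ys} → AllPairs S xs → (∀ {x} → P x → Any (λ y → R x y × Q y) ys) →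
              count P? xs ≤ count Q? ys
    count-≤ R sep {xs} {ys} uniq hit =
      length-≤ R (AllPairs.map sep (AllPairs.filter⁺ P? uniq))
        (All.map keep (All.all-filter P? xs))
      where
      keep : ∀ {x} → P x → Any (R x) (filter Q? ys)
      keep = Any-filter⁺ Q? ∘ hit

  cons : {n : ℕ} → A → (Fin n → A) → Fin (suc n) → A
  cons x f zero    = x
  cons x f (suc i) = f i

  module _ (xs : List A) where

    length-allFuns : ∀ n → length (allFuns n xs) ≡ length xs ^ n
    length-allFuns zero    = refl
    length-allFuns (suc n) = go _ xs
      where
      -- The pattern lambda inside `allFuns` has no name, so the induction is stated for every
      -- joining function `h`, and `go _` picks the actual one.
      go : ∀ (h : A → (Fin n → A) → Fin (suc n) → A) ys →
           length (concatMap (λ x → map (h x) (allFuns n xs)) ys) ≡ length ys * length xs ^ n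
      go h []       = refl
      go h (y ∷ ys) = trans (length-++ (map (h y) (allFuns n xs)))
        (cong₂ _+_ (trans (length-map (h y) (allFuns n xs)) (length-allFuns n)) (go h ys))

    allFuns-complete : (R : A → A → Set) → ∀ {n} (f : Fin n → A) →
      (∀ i → Any (R (f i)) xs) → Any (λ g → ∀ i → R (f i) (g i)) (allFuns n xs)
    allFuns-complete R {zero}  f h = here λ ()
    allFuns-complete R {suc n} f h = go _ (λ r t → λ { zero → r ; (suc i) → t i })
      where
      go : ∀ (c : A → (Fin n → A) → Fin (suc n) → A) →
           (∀ {y g} → R (f zero) y → (∀ i → R (f (suc i)) (g i)) → ∀ i → R (f i) (c y g i)) →
           Any (λ g → ∀ i → R (f i) (g i)) (concatMap (λ x → map (c x) (allFuns n xs)) xs)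
      go c join = Any.concat⁺ (Any.map⁺ (Any.map (λ r → Any.map⁺
        (Any.map (join r) (allFuns-complete R (f ∘ suc) (h ∘ suc)))) (h zero)))

    allFuns-unique : {S : A → A → Set} → AllPairs S xs → ∀ n →
      AllPairs (λ f g → ∃ λ i → S (f i) (g i)) (allFuns n xs)
    allFuns-unique u zero = [] ∷ []
    allFuns-unique {S} u (suc n) = go _ (λ (i , s) → suc i , s) (λ s → zero , s)
      where
      D : ∀ {n} → (Fin n → A) → (Fin n → A) → Set
      D f g = ∃ λ i → S (f i) (g i)

      go : ∀ (c : A → (Fin n → A) → Fin (suc n) → A) →
           (∀ {x f g} → D f g → D (c x f) (c x g)) → (∀ {x y f g} → S x y → D (c x f) (c y g)) →
           AllPairs D (concatMap (λ x → map (c x) (allFuns n xs)) xs)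
      go c tail head = AllPairs.concat⁺
        (All.map⁺ (All.universal (λ x → AllPairs.map⁺ (AllPairs.map tail (allFuns-unique u n))) xs))
        (AllPairs.map⁺ (AllPairs.map (λ s → All.map⁺ (All.universal (λ _ → All.map⁺
          (All.universal (λ _ → head s) (allFuns n xs))) (allFuns n xs))) u))

    module _ {P : A → Set} (P? : Decidable P) where

      count-allFuns : ∀ n {Q : (Fin n → A) → Set} (Q? : Decidable Q) →
        (∀ {f} → Q f → ∀ i → P (f i)) → (∀ {f} → (∀ i → P (f i)) → Q f) →
        count Q? (allFuns n xs) ≡ count P? xs ^ n
      count-allFuns zero    Q? to from = count-accept Q? {xs = []} (from λ ())
      count-allFuns (suc n) {Q} Q? to from =
        go _ (λ q → to q zero , to q ∘ suc) (λ p ps → from λ { zero → p ; (suc i) → ps i }) xs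
        where
        go : ∀ (h : A → (Fin n → A) → Fin (suc n) → A) →
             (∀ {x f} → Q (h x f) → P x × (∀ i → P (f i))) →
             (∀ {x f} → P x → (∀ i → P (f i)) → Q (h x f)) → ∀ ys →
             count Q? (concatMap (λ x → map (h x) (allFuns n xs)) ys)
             ≡ count P? ys * count P? xs ^ n
        go h split join []       = refl
        go h split join (y ∷ ys) with P? y
        ... | yes p = trans (count-++ Q? (map (h y) (allFuns n xs)) _) (cong₂ _+_
          (trans (count-map Q? (h y) (allFuns n xs)) (count-allFuns n (Q? ∘ h y)
            (proj₂ ∘ split) (join p)))
          (go h split join ys))
        ... | no ¬p = trans (count-++ Q? (map (h y) (allFuns n xs)) _) (cong₂ _+_
          (trans (count-map Q? (h y) (allFuns n xs)) (cong length
            (filter-none (Q? ∘ h y) (All.universal (λ _ → ¬p ∘ proj₁ ∘ split) (allFuns n xs)))))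
          (go h split join ys))

  sum-map-cong : {f g : A → ℕ} → (∀ x → f x ≡ g x) → ∀ xs → sum (map f xs) ≡ sum (map g xs)
  sum-map-cong h []       = refl
  sum-map-cong h (x ∷ xs) = cong₂ _+_ (h x) (sum-map-cong h xs)

  sum-map-+ : (f g : A → ℕ) → ∀ xs → sum (map (λ x → f x + g x) xs) ≡ sum (map f xs) + sum (map g xs)
  sum-map-+ f g []       = refl
  sum-map-+ f g (x ∷ xs) = trans (cong (f x + g x +_) (sum-map-+ f g xs)) (+-interchange (f x) (g x) _ _)
    where
    +-interchange : ∀ a b c d → (a + b) + (c + d) ≡ (a + c) + (b + d)
    +-interchange a b c d = trans (+-assoc a b _) (trans (cong (a +_) (trans (sym (+-assoc b c d))
      (trans (cong (_+ d) (+-comm b c)) (+-assoc c b d)))) (sym (+-assoc a c _)))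

  sum-map-0 : {f : A → ℕ} → (∀ x → f x ≡ 0) → ∀ xs → sum (map f xs) ≡ 0
  sum-map-0 h []       = refl
  sum-map-0 h (x ∷ xs) = cong₂ _+_ (h x) (sum-map-0 h xs)

  count-as-sum : {P : A → Set} (P? : Decidable P) → ∀ x xs →
                 count P? (x ∷ xs) ≡ count P? (x ∷ []) + count P? xs
  count-as-sum P? x xs = count-++ P? (x ∷ []) xs

  double-counting : {R : A → B → Set} (R? : ∀ x y → Dec (R x y)) → ∀ xs ys →
    sum (map (λ x → count (R? x) ys) xs) ≡ sum (map (λ y → count (flip R? y) xs) ys)
  double-counting R? []       ys = sym (sum-map-0 (λ _ → refl) ys)
  double-counting R? (x ∷ xs) ys = begin
    count (R? x) ys + sum (map (λ x → count (R? x) ys) xs)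
      ≡⟨ cong₂ _+_ (row ys) (double-counting R? xs ys) ⟩
    sum (map (λ y → count (flip R? y) (x ∷ [])) ys) + sum (map (λ y → count (flip R? y) xs) ys)
      ≡⟨ sum-map-+ _ _ ys ⟨
    sum (map (λ y → count (flip R? y) (x ∷ []) + count (flip R? y) xs) ys)
      ≡⟨ sum-map-cong (λ y → count-as-sum (flip R? y) x xs) ys ⟨
    sum (map (λ y → count (flip R? y) (x ∷ xs)) ys) ∎
    where
    open ≡-Reasoning
    row : ∀ zs → count (R? x) zs ≡ sum (map (λ y → count (flip R? y) (x ∷ [])) zs)
    row []       = refl
    row (z ∷ zs) with R? x z
    ... | yes _ = cong suc (row zs)
    ... | no  _ = row zs

  -- Base-B expansions, least significant digit first.
  expansion : ℕ → ℕ → (ℕ → ℕ) → ℕ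
  expansion B zero    a = 0
  expansion B (suc K) a = a 0 + expansion B K (a ∘ suc) * B

  expansion-injective : ∀ B .{{_ : NonZero B}} K {a b} → (∀ j → a j < B) → (∀ j → b j < B) →
    expansion B K a ≡ expansion B K b → ∀ {j} → j < K → a j ≡ b j
  expansion-injective B (suc K) {a} {b} a< b< eq {j} = digit j
    where
    low : a 0 ≡ b 0
    low = begin
      a 0                                      ≡⟨ m<n⇒m%n≡m (a< 0) ⟨
      a 0 % B                                  ≡⟨ [m+kn]%n≡m%n (a 0) (expansion B K (a ∘ suc)) B ⟨
      (a 0 + expansion B K (a ∘ suc) * B) % B  ≡⟨ cong (_% B) eq ⟩
      (b 0 + expansion B K (b ∘ suc) * B) % B  ≡⟨ [m+kn]%n≡m%n (b 0) (expansion B K (b ∘ suc)) B ⟩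
      b 0 % B                                  ≡⟨ m<n⇒m%n≡m (b< 0) ⟩
      b 0                                      ∎
      where open ≡-Reasoning

    high : expansion B K (a ∘ suc) ≡ expansion B K (b ∘ suc)
    high = *-cancelʳ-≡ _ _ B (+-cancelˡ-≡ (a 0) _ _ (trans eq (cong (_+ _) (sym low))))

    digit : ∀ j → j < suc K → a j ≡ b j
    digit zero    _         = low
    digit (suc j) (s≤s j<K) = expansion-injective B K (a< ∘ suc) (b< ∘ suc) high j<K

  expansion-0 : ∀ B K → expansion B K (λ _ → 0) ≡ 0
  expansion-0 B zero    = refl
  expansion-0 B (suc K) = cong (_* B) (expansion-0 B K)

  expansion-cong : ∀ B K {a b} → (∀ j → a j ≡ b j) → expansion B K a ≡ expansion B K b
  expansion-cong B zero    h = refl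
  expansion-cong B (suc K) h = cong₂ (λ x y → x + y * B) (h 0) (expansion-cong B K (h ∘ suc))

  expansion-+ : ∀ B K a b → expansion B K (λ j → a j + b j) ≡ expansion B K a + expansion B K b
  expansion-+ B zero    a b = refl
  expansion-+ B (suc K) a b = begin
    a 0 + b 0 + expansion B K (λ j → a (suc j) + b (suc j)) * B
      ≡⟨ cong (λ z → a 0 + b 0 + z * B) (expansion-+ B K (a ∘ suc) (b ∘ suc)) ⟩
    a 0 + b 0 + (expansion B K (a ∘ suc) + expansion B K (b ∘ suc)) * B
      ≡⟨ regroup (a 0) (b 0) (expansion B K (a ∘ suc)) (expansion B K (b ∘ suc)) B ⟩
    a 0 + expansion B K (a ∘ suc) * B + (b 0 + expansion B K (b ∘ suc) * B) ∎
    where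
    open ≡-Reasoning
    open import Data.Nat.Tactic.RingSolver
    regroup : ∀ u v x y B → u + v + (x + y) * B ≡ u + x * B + (v + y * B)
    regroup = solve-∀

  module _ (e : A → ℕ) where

    private
      digits : List A → ℕ → ℕ
      digits xs j = count (λ x → e x ≟ j) xs

    -- The digits are the indicator of `d`, written as counts over a one-element list so that they
    -- can be added to other counts.
    expansion-single : ∀ B K d → d < K → expansion B K (λ j → length (filter (_≟ j) (d ∷ []))) ≡ B ^ d
    expansion-single B (suc K) zero    _         = cong suc (trans (cong (_* B)
      (trans (expansion-cong B K λ j → refl) (expansion-0 B K))) refl)
    expansion-single B (suc K) (suc d) (s≤s d<K) = trans (cong (_* B)
      (trans (expansion-cong B K shift) (expansion-single B K d d<K))) (*-comm (B ^ d) B)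
      where
      shift : ∀ j → length (filter (_≟ suc j) (suc d ∷ [])) ≡ length (filter (_≟ j) (d ∷ []))
      shift j with d ≡ᵇ j
      ... | true  = refl
      ... | false = refl

    -- Grouping equal exponents, the coefficient of `B ^ j` is the number of entries with exponent
    -- `j`.
    sum-of-powers : ∀ B K xs → (∀ x → e x < K) →
                    sum (map (λ x → B ^ e x) xs) ≡ expansion B K (digits xs)
    sum-of-powers B K []       e< = sym (expansion-0 B K)
    sum-of-powers B K (x ∷ xs) e< = begin
      B ^ e x + sum (map (λ x → B ^ e x) xs)
        ≡⟨ cong₂ _+_ (sym (expansion-single B K (e x) (e< x))) (sum-of-powers B K xs e<) ⟩
      expansion B K (λ j → length (filter (_≟ j) (e x ∷ []))) + expansion B K (digits xs)
        ≡⟨ expansion-+ B K _ _ ⟨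
      expansion B K (λ j → length (filter (_≟ j) (e x ∷ [])) + digits xs j)
        ≡⟨ expansion-cong B K (λ j → cong (_+ digits xs j) (count-map (_≟ j) e (x ∷ []))) ⟩
      expansion B K (λ j → digits (x ∷ []) j + digits xs j)
        ≡⟨ expansion-cong B K (λ j → count-as-sum (λ x → e x ≟ j) x xs) ⟨
      expansion B K (digits (x ∷ xs)) ∎
      where open ≡-Reasoning

  -- Lists shorter than `B` make every count a genuine base-`B` digit, so the value of the sum
  -- determines all the counts.
  digits-determined : ∀ B .{{_ : NonZero B}} K (e : A → ℕ) (e′ : B′ → ℕ) → ∀ xs ys →
    length xs < B → length ys < B → (∀ x → e x < K) → (∀ y → e′ y < K) →
    sum (map (λ x → B ^ e x) xs) ≡ sum (map (λ y → B ^ e′ y) ys) →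
    ∀ {j} → j < K → count (λ x → e x ≟ j) xs ≡ count (λ y → e′ y ≟ j) ys
  digits-determined B K e e′ xs ys xs< ys< e< e′< eq = expansion-injective B K
    (λ j → ≤-<-trans (Data.List.Properties.length-filter _ xs) xs<)
    (λ j → ≤-<-trans (Data.List.Properties.length-filter _ ys) ys<)
    (trans (sym (sum-of-powers e B K xs e<)) (trans eq (sum-of-powers e′ B K ys e′<)))

  -- Used to pass from injective to surjective: an entry satisfying `P` that no image needs leaves
  -- one place of `ys` spare.
  length-< : (R : A → B → Set) {P : B → Set} (P? : Decidable P) → ∀ {xs ys} →
    AllPairs (Separated R) xs → Any P ys → All (λ x → Any (λ y → R x y × ¬ P y) ys) xs →
    length xs < length ys
  length-< R P? {ys = ys} sep some avoid = ≤-<-trans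
    (length-≤ R sep (All.map (Any-filter⁺ (¬? ∘ P?)) avoid))
    (Data.List.Properties.filter-notAll (¬? ∘ P?) ys (Any.map (λ p ¬p → ¬p p) some))

  module _ {P Q S : A → Set} (P? : Decidable P) (Q? : Decidable Q) (S? : Decidable S) where

    count-disjoint : (∀ {x} → P x → S x) → (∀ {x} → Q x → S x) → (∀ {x} → P x → ¬ Q x) →
      ∀ xs → count P? xs + count Q? xs ≤ count S? xs
    count-disjoint f g d []       = z≤n
    count-disjoint f g d (x ∷ xs) with P? x | Q? x | S? x | count-disjoint f g d xs
    ... | yes p | yes q | _     | _  = contradiction q (d p)
    ... | yes p | no _  | yes _ | ih = s≤s ih
    ... | yes p | no _  | no ¬s | _  = contradiction (f p) ¬s
    ... | no _  | yes q | yes _ | ih = ≤-trans (≤-reflexive (+-suc _ _)) (s≤s ih)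
    ... | no _  | yes q | no ¬s | _  = contradiction (g q) ¬s
    ... | no _  | no _  | yes _ | ih = m≤n⇒m≤1+n ih
    ... | no _  | no _  | no _  | ih = ih

  sum-of-counts : {P : B → A → Set} (P? : ∀ j x → Dec (P j x)) {S : A → Set} (S? : Decidable S) → ∀ {js} →
    AllPairs (λ i j → ∀ {x} → P i x → ¬ P j x) js → All (λ j → ∀ {x} → P j x → S x) js →
    ∀ xs → sum (map (λ j → count (P? j) xs) js) ≤ count S? xs
  sum-of-counts P? S? []       []       xs = z≤n
  sum-of-counts P? S? {j ∷ js} (d ∷ ds) (s ∷ ss) xs = ≤-trans
    (+-monoʳ-≤ (count (P? j) xs) (sum-of-counts P? some? ds
      (All.tabulate (λ j∈ p → Any.map (λ { refl → p }) j∈)) xs))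
    (count-disjoint (P? j) some? S? s (λ a → let (s′ , p) = All.lookupAny ss a in s′ p)
      (λ p a → let (d′ , p′) = All.lookupAny d a in d′ p p′) xs)
    where
    some? = λ x → Any.any? (λ j → P? j x) js

  <∸⇒+< : ∀ j o n → j < n ∸ o → o + j < n
  <∸⇒+< j zero    n       h = h
  <∸⇒+< j (suc o) (suc n) h = s≤s (<∸⇒+< j o n h)

  count-range : (e : A → ℕ) {S : A → Set} (S? : Decidable S) → ∀ lo hi →
    (∀ {x} → lo ≤ e x → e x ≤ hi → S x) → ∀ xs →
    sumRange lo hi (λ i → count (λ x → e x ≟ i) xs) ≤ count S? xs
  count-range e {S} S? lo hi inS xs = sum-of-counts (λ j x → e x ≟ lo + j) S?
    (AllPairs.applyUpTo⁺₁ id (suc hi ∸ lo) distinct) (All.map included (All.all-upTo (suc hi ∸ lo))) xs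
    where
    distinct : ∀ {i j} → i < j → j < suc hi ∸ lo → ∀ {x} → e x ≡ lo + i → e x ≢ lo + j
    distinct i<j _ p p′ = <⇒≢ i<j (+-cancelˡ-≡ lo _ _ (trans (sym p) p′))
    included : ∀ {j} → j < suc hi ∸ lo → ∀ {x} → e x ≡ lo + j → S x
    included {j} j< p = inS (subst (lo ≤_) (sym p) (m≤m+n lo j))
      (subst (_≤ hi) (sym p) (s≤s⁻¹ (<∸⇒+< j lo (suc hi) j<)))

  sumRange-cong : ∀ lo hi {f g : ℕ → ℕ} → (∀ i → i ≤ hi → f i ≡ g i) → sumRange lo hi f ≡ sumRange lo hi g
  sumRange-cong lo hi h = cong sum (Data.List.Properties.map-cong-local
    (All.map (λ {j} j< → h (lo + j) (s≤s⁻¹ (<∸⇒+< j lo (suc hi) j<))) (All.all-upTo (suc hi ∸ lo))))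

  maxList-elim : (P : ℕ → Set) → P 0 → ∀ {xs} → All P xs → P (maxList xs)
  maxList-elim P p₀ []       = p₀
  maxList-elim P p₀ {x ∷ xs} (p ∷ ps) with ⊔-sel x (maxList xs)
  ... | inj₁ e = subst P (sym e) p
  ... | inj₂ e = subst P (sym e) (maxList-elim P p₀ ps)

  sum-≤ : ∀ {f : A → ℕ} {M xs} → All (λ x → f x ≤ M) xs → sum (map f xs) ≤ length xs * M
  sum-≤ []       = z≤n
  sum-≤ (h ∷ hs) = +-mono-≤ h (sum-≤ hs)

  sum-≤-but-one : ∀ {f : A → ℕ} {M xs} → All (λ x → f x ≤ M) xs → Any (λ x → f x ≡ 0) xs →
    sum (map f xs) ≤ (length xs ∸ 1) * M
  sum-≤-but-one {f = f} {M} {x ∷ xs} (h ∷ hs) (here e) =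
    subst (_≤ length xs * M) (cong (_+ sum (map f xs)) (sym e)) (sum-≤ hs)
  sum-≤-but-one {xs = x ∷ y ∷ ys} (h ∷ hs) (there a) = +-mono-≤ h (sum-≤-but-one hs a)

  ceilDiv-≤ : ∀ s y M → s ≤ y * M → ceilDiv s y ≤ M
  ceilDiv-≤ s zero    M h = z≤n
  ceilDiv-≤ s (suc y) M h = s≤s⁻¹ (m<n*o⇒m/o<n {s + y} {suc M} {suc y} (begin-strict
    s + y                 ≤⟨ +-monoˡ-≤ y h ⟩
    suc y * M + y         ≡⟨ cong (_+ y) (*-comm (suc y) M) ⟩
    M * suc y + y         <⟨ +-monoʳ-< (M * suc y) (n<1+n y) ⟩
    M * suc y + suc y     ≡⟨ +-comm (M * suc y) (suc y) ⟩
    suc M * suc y         ∎))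
    where open ≤-Reasoning

  -- Pigeonhole: a hole is known to be empty, so the others share everything.
  pigeonhole : (f : A → ℕ) → ∀ xs s → s ≤ sum (map f xs) → Any (λ x → f x ≡ 0) xs →
    ∃ λ x → ceilDiv s (length xs ∸ 1) ≤ f x
  pigeonhole f xs s s≤ empty with Any.any? (λ x → ceilDiv s (length xs ∸ 1) ≤? f x) xs
  ... | yes a = Any.satisfied a
  ... | no none = contradiction (Any.satisfied empty) λ (x , e) → absurd
    where
    T = ceilDiv s (length xs ∸ 1)
    small : All (λ x → f x < T) xs
    small = All.map ≰⇒> (All.¬Any⇒All¬ xs none)
    -- If all shares were at most `pred T`, the ceiling `T` itself would be at most `pred T`. `T` is
    -- positive because even the empty hole lies strictly below it.
    T≤T-1 : T ≤ pred T
    T≤T-1 = ceilDiv-≤ s (length xs ∸ 1) (pred T) (≤-trans s≤ (sum-≤-but-one (All.map (λ {_} h → pred-mono-≤ h) small) empty))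
    0<T : 0 < T
    0<T = ≤-<-trans z≤n (proj₁ (All.lookupAny small empty))
    absurd = <⇒≱ (pred<self T 0<T) T≤T-1
      where
      pred<self : ∀ t → 0 < t → pred t < t
      pred<self (suc t) _ = n<1+n t

  length-concatMap : (f : A → List B) → ∀ xs → length (concatMap f xs) ≡ sum (map (length ∘ f) xs)
  length-concatMap f []       = refl
  length-concatMap f (x ∷ xs) = trans (length-++ (f x)) (cong (length (f x) +_) (length-concatMap f xs))

-- Linear algebra over F by counting: spans, bases, rank, kernels.

module Rank {q} (F : FiniteField q) where

  open Counting
  open import Data.Bool as Bool using (Bool; true; false; T; not; _∧_; _∨_; if_then_else_)
  open import Data.Bool.ListAction using (any)
  open import Data.Bool.Properties using (T-≡)
  open import Data.Nat using (_^_)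
  open import Data.List using (foldr; tabulate)
  open import Data.List.Properties using (map-tabulate; length-tabulate)
  open import Data.List.Membership.Propositional.Properties using (∈-lookup; ∈-allFin)
  open import Data.Empty using (⊥-elim)
  open import Data.Product using (_×_)
  open import Relation.Nullary.Decidable using (map′; ⌊_⌋)
  open import Relation.Binary.PropositionalEquality

  open FiniteField F
  open LinAlg F

  ring : CommutativeRing _ _
  ring = record { isCommutativeRing = isCommRing }

  open CommutativeRing ring public using (_+_; _*_; -_; _-_; 0#; 1#; +-comm; +-assoc; *-comm; *-assoc;
       +-identityˡ; +-identityʳ; *-identityˡ; *-identityʳ; zeroˡ; zeroʳ; distribˡ; distribʳ; -‿inverseˡ;
       -‿inverseʳ)
  open import Algebra.Properties.Ring (CommutativeRing.ring ring) public using (-‿distribˡ-*; -‿distribʳ-*;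
       x∙y⁻¹≈ε⇒x≈y; +-inverseʳ-unique; -‿involutive; -1*x≈-x; //-rightDividesˡ; +-cancelʳ; -0#≈0#; -‿+-comm)
  open import Algebra.Properties.Semiring.Sum (CommutativeRing.semiring ring) public using (sum;
       sum-cong-≗; sum-replicate-zero; ∑-distrib-+; ∑-comm; *-distribˡ-sum; *-distribʳ-sum; sum-permute)

  open import Algebra.Properties.CommutativeSemigroup (CommutativeRing.*-commutativeSemigroup ring)
    using (x∙yz≈y∙xz; x∙yz≈yx∙z)

  foldr-tabulate : ∀ {n} (f : Vector n) → foldr _+F_ 0F (tabulate f) ≡ sum f
  foldr-tabulate {zero}  f = refl
  foldr-tabulate {suc n} f = cong (f zero +_) (foldr-tabulate (f ∘ suc))

  sumF≡sum : ∀ {n} (f : Vector n) → sumF n f ≡ sum f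
  sumF≡sum f = trans (cong (foldr _+F_ 0F) (map-tabulate id f)) (foldr-tabulate f)

  infixl 7 _⊙_ _⊗_

  _⊙_ : ∀ {a b} → Vector a → Matrix a b → Vector b
  _⊙_ = lincomb

  _⊗_ : ∀ {a b c} → Matrix a b → Matrix b c → Matrix a c
  (M ⊗ N) i = M i ⊙ N

  _ᵀ : ∀ {a b} → Matrix a b → Matrix b a
  (M ᵀ) i j = M j i

  𝟎 : ∀ {a} → Vector a
  𝟎 _ = 0F

  unit : ∀ {n} → Fin n → Vector n
  unit i j = if ⌊ i Fin.≟ j ⌋ then 1F else 0F

  ⊙-sum : ∀ {a b} (c : Vector a) (M : Matrix a b) j → (c ⊙ M) j ≡ sum (λ i → c i * M i j)
  ⊙-sum c M j = sumF≡sum (λ i → c i * M i j)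

  ⊙-step : ∀ {a b} (c : Vector (suc a)) (M : Matrix (suc a) b) j →
           (c ⊙ M) j ≡ c zero * M zero j + (c ∘ suc ⊙ M ∘ suc) j
  ⊙-step c M j = trans (⊙-sum c M j) (cong (c zero * M zero j +_) (sym (⊙-sum (c ∘ suc) (M ∘ suc) j)))

  ⊙-cong : ∀ {a b} {c c′ : Vector a} {M M′ : Matrix a b} → c ≗ c′ → (∀ i → M i ≗ M′ i) →
           c ⊙ M ≗ c′ ⊙ M′
  ⊙-cong {c = c} {c′} {M} {M′} h k j = trans (⊙-sum c M j)
    (trans (sum-cong-≗ (λ i → cong₂ _*_ (h i) (k i j))) (sym (⊙-sum c′ M′ j)))

  ⊙-congˡ : ∀ {a b} {c c′ : Vector a} (M : Matrix a b) → c ≗ c′ → c ⊙ M ≗ c′ ⊙ M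
  ⊙-congˡ M h = ⊙-cong h (λ _ _ → refl)

  ⊙-congʳ : ∀ {a b} (c : Vector a) {M M′ : Matrix a b} → (∀ i → M i ≗ M′ i) → c ⊙ M ≗ c ⊙ M′
  ⊙-congʳ c = ⊙-cong (λ _ → refl)

  sum-0 : ∀ {n} {f : Vector n} → f ≗ 𝟎 → sum f ≡ 0F
  sum-0 {n} h = trans (sum-cong-≗ h) (sum-replicate-zero n)

  ⊙-zeroˡ : ∀ {a b} {c : Vector a} (M : Matrix a b) → c ≗ 𝟎 → c ⊙ M ≗ 𝟎
  ⊙-zeroˡ {c = c} M h j = trans (⊙-sum c M j) (sum-0 λ i → trans (cong (_* M i j) (h i)) (zeroˡ _))

  ⊙-+ : ∀ {a b} (c d : Vector a) (M : Matrix a b) j →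
        ((λ i → c i + d i) ⊙ M) j ≡ (c ⊙ M) j + (d ⊙ M) j
  ⊙-+ c d M j = trans (⊙-sum (λ i → c i + d i) M j) (trans (sum-cong-≗ (λ i → distribʳ (M i j) (c i) (d i)))
    (trans (∑-distrib-+ (λ i → c i * M i j) _) (sym (cong₂ _+_ (⊙-sum c M j) (⊙-sum d M j)))))

  ⊙-scale : ∀ {a b} x (c : Vector a) (M : Matrix a b) j →
            ((λ i → x * c i) ⊙ M) j ≡ x * (c ⊙ M) j
  ⊙-scale x c M j = trans (⊙-sum (λ i → x * c i) M j) (trans (sum-cong-≗ (λ i → *-assoc x (c i) (M i j)))
    (trans (sym (*-distribˡ-sum x (λ i → c i * M i j))) (cong (x *_) (sym (⊙-sum c M j)))))

  ⊙-+ᴹ : ∀ {a b} (c : Vector a) (M N : Matrix a b) j →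
         (c ⊙ (λ i j → M i j + N i j)) j ≡ (c ⊙ M) j + (c ⊙ N) j
  ⊙-+ᴹ c M N j = trans (⊙-sum c (λ i j → M i j + N i j) j)
    (trans (sum-cong-≗ (λ i → distribˡ (c i) (M i j) (N i j)))
    (trans (∑-distrib-+ (λ i → c i * M i j) _) (sym (cong₂ _+_ (⊙-sum c M j) (⊙-sum c N j)))))

  ⊙-scaleᴹ : ∀ {a b} x (c : Vector a) (M : Matrix a b) j →
             (c ⊙ (λ i j → x * M i j)) j ≡ x * (c ⊙ M) j
  ⊙-scaleᴹ x c M j = trans (⊙-sum c (λ i j → x * M i j) j)
    (trans (sum-cong-≗ (λ i → x∙yz≈y∙xz (c i) x (M i j)))
    (trans (sym (*-distribˡ-sum x (λ i → c i * M i j))) (cong (x *_) (sym (⊙-sum c M j)))))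

  ⊙-- : ∀ {a b} (c d : Vector a) (M : Matrix a b) j →
        ((λ i → c i - d i) ⊙ M) j ≡ (c ⊙ M) j - (d ⊙ M) j
  ⊙-- c d M j = trans (⊙-+ c (λ i → - d i) M j) (cong ((c ⊙ M) j +_)
    (trans (⊙-congˡ M (λ i → sym (-1*x≈-x (d i))) j) (trans (⊙-scale (- 1F) d M j) (-1*x≈-x _))))

  ⊙--ᴹ : ∀ {a b} (c : Vector a) (M N : Matrix a b) j →
         (c ⊙ (λ i j → M i j - N i j)) j ≡ (c ⊙ M) j - (c ⊙ N) j
  ⊙--ᴹ c M N j = trans (⊙-+ᴹ c M (λ i j → - N i j) j) (cong ((c ⊙ M) j +_)
    (trans (⊙-congʳ c {λ i j → - N i j} (λ i j → sym (-1*x≈-x (N i j))) j)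
      (trans (⊙-scaleᴹ (- 1F) c N j) (-1*x≈-x _))))

  ⊙-⊗ : ∀ {a b d} (c : Vector a) (M : Matrix a b) (N : Matrix b d) → c ⊙ M ⊙ N ≗ c ⊙ (M ⊗ N)
  ⊙-⊗ c M N j = begin
    (c ⊙ M ⊙ N) j                                 ≡⟨ ⊙-sum (c ⊙ M) N j ⟩
    sum (λ l → (c ⊙ M) l * N l j)                  ≡⟨ sum-cong-≗ (λ l → trans (cong (_* N l j) (⊙-sum c M l))
                                                        (*-distribʳ-sum (N l j) (λ i → c i * M i l))) ⟩
    sum (λ l → sum (λ i → c i * M i l * N l j))    ≡⟨ ∑-comm (λ l i → c i * M i l * N l j) ⟩
    sum (λ i → sum (λ l → c i * M i l * N l j))    ≡⟨ sum-cong-≗ (λ i → trans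
                                                        (sum-cong-≗ (λ l → *-assoc (c i) (M i l) (N l j)))
                                                        (sym (*-distribˡ-sum (c i) (λ l → M i l * N l j)))) ⟩
    sum (λ i → c i * sum (λ l → M i l * N l j))    ≡⟨ sum-cong-≗ (λ i → cong (c i *_) (⊙-sum (M i) N j)) ⟨
    sum (λ i → c i * (M i ⊙ N) j)                  ≡⟨ ⊙-sum c (M ⊗ N) j ⟨
    (c ⊙ (M ⊗ N)) j                                ∎
    where open ≡-Reasoning

  unit-diag : ∀ {n} (i : Fin n) → unit i i ≡ 1F
  unit-diag i with i Fin.≟ i
  ... | yes _  = refl
  ... | no i≢i = contradiction refl i≢i

  unit-off : ∀ {n} {i j : Fin n} → i ≢ j → unit i j ≡ 0F
  unit-off {i = i} {j} i≢j with i Fin.≟ j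
  ... | yes i≡j = contradiction i≡j i≢j
  ... | no _    = refl

  sum-unit : ∀ {n} (i : Fin n) (f : Vector n) → sum (λ l → unit i l * f l) ≡ f i
  sum-unit {suc n} zero f = trans (cong₂ _+_ (*-identityˡ _) (sum-0 {f = λ l → 0F * f (suc l)} (λ l → zeroˡ _))) (+-identityʳ _)
  sum-unit {suc n} (suc i) f = trans (cong₂ _+_ (zeroˡ _)
    (trans (sum-cong-≗ (λ l → cong (_* f (suc l)) (shift l))) (sum-unit i (f ∘ suc)))) (+-identityˡ _)
    where
    shift : ∀ l → unit (suc i) (suc l) ≡ unit i l
    shift l with i Fin.≟ l
    ... | yes _ = refl
    ... | no  _ = refl

  unit-⊙ : ∀ {a b} (i : Fin a) (M : Matrix a b) → unit i ⊙ M ≗ M i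
  unit-⊙ i M j = trans (⊙-sum (unit i) M j) (sum-unit i (λ l → M l j))

  ⊙-unit : ∀ {a} (c : Vector a) → c ⊙ unit ≗ c
  ⊙-unit c j = trans (⊙-sum c unit j) (trans (sum-cong-≗ (λ l → trans (*-comm _ _)
    (cong (_* c l) (unit-sym l j)))) (sum-unit j c))
    where
    unit-sym : ∀ {n} (i j : Fin n) → unit i j ≡ unit j i
    unit-sym i j with i Fin.≟ j
    ... | yes refl = sym (unit-diag i)
    ... | no i≢j   = sym (unit-off (i≢j ∘ sym))

  2≤q : 2 ≤ q
  2≤q = two q 0F 1F 0≢1
    where
    two : ∀ q (x y : Fin q) → ¬ (x ≡ y) → 2 ≤ q
    two (suc zero)    zero zero x≢y = contradiction refl x≢y
    two (suc (suc q)) _    _    _   = s≤s (s≤s z≤n)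

  instance
    q-nonZero : ℕ.NonZero q
    q-nonZero = ℕ.>-nonZero (ℕ.<⇒≤ 2≤q)

  allVectors-complete : ∀ {n} (v : Vector n) → Any (v ≗_) (allVectors n)
  allVectors-complete v = allFuns-complete scalars _≡_ v (λ i → ∈-allFin (v i))

  allVectors-unique : ∀ n → AllPairs (λ u v → ∃ λ i → u i ≢ v i) (allVectors n)
  allVectors-unique = allFuns-unique scalars (AllPairs.tabulate⁺ id)

  length-allVectors : ∀ n → length (allVectors n) ≡ q ^ n
  length-allVectors n = trans (length-allFuns scalars n) (cong (_^ n) (length-tabulate id))

  ^-cancel-≤ : ∀ {a b} → q ^ a ≤ q ^ b → a ≤ b
  ^-cancel-≤ {a} {b} le with a ℕ.≤? b
  ... | yes a≤b = a≤b
  ... | no  a≰b = contradiction le (ℕ.<⇒≱ (ℕ.^-monoʳ-< q 2≤q (ℕ.≰⇒> a≰b)))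

  -- An injection of q^a vectors into q^b vectors gives a ≤ b. Totality is asked for every pointwise
  -- copy `e` of the image `d`, since the list of all vectors contains only some copy of it.
  dim-≤ : ∀ {a b} (R : Vector a → Vector b → Set) →
          (∀ {c c′ d} → R c d → R c′ d → c ≗ c′) → (∀ c → ∃ λ d → ∀ {e} → d ≗ e → R c e) → a ≤ b
  dim-≤ {a} {b} R inj tot = ^-cancel-≤ (subst₂ _≤_ (length-allVectors a) (length-allVectors b)
    (length-≤ R (AllPairs.map (λ (i , u≢v) d r r′ → u≢v (inj r r′ i)) (allVectors-unique a))
      (All.universal (λ c → Any.map (proj₂ (tot c)) (allVectors-complete (proj₁ (tot c)))) _)))

  LI : ∀ {a b} → Matrix a b → Set
  LI M = ∀ c → c ⊙ M ≗ 𝟎 → c ≗ 𝟎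

  InSpan : ∀ {a b} → Vector b → Matrix a b → Set
  InSpan v M = ∃ λ c → v ≗ c ⊙ M

  _≗?_ : ∀ {n} (u v : Vector n) → Dec (u ≗ v)
  u ≗? v = Fin.all? (λ i → u i Fin.≟ v i)

  InSpan? : ∀ {a b} (v : Vector b) (M : Matrix a b) → Dec (InSpan v M)
  InSpan? {a} v M = map′ Any.satisfied
    (λ (c , h) → Any.map (λ e j → trans (h j) (⊙-congˡ M e j)) (allVectors-complete c))
    (Any.any? (λ c → v ≗? (c ⊙ M)) (allVectors a))

  LI-injective : ∀ {a b} {M : Matrix a b} → LI M → ∀ {c d} → c ⊙ M ≗ d ⊙ M → c ≗ d
  LI-injective {M = M} li {c} {d} h i = x∙y⁻¹≈ε⇒x≈y _ _ (li (λ i → c i - d i) (λ j →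
    trans (⊙-- c d M j) (trans (cong (_- (d ⊙ M) j) (h j)) (-‿inverseʳ _))) i)

  LI-cons : ∀ {a b} {M : Matrix a b} {v} → LI M → ¬ InSpan v M → LI (cons v M)
  LI-cons {M = M} {v} li v∉ c h = λ { zero → c₀≡0 ; (suc i) → li (c ∘ suc) rest i }
    where
    eq : ∀ j → c zero * v j + (c ∘ suc ⊙ M) j ≡ 0F
    eq j = trans (sym (⊙-step c (cons v M) j)) (h j)

    solved : ∀ {y} → c zero * y ≡ 1F → ∀ j → v j ≡ ((λ i → - y * c (suc i)) ⊙ M) j
    solved {y} c₀y j = sym (begin
      ((λ i → - y * c (suc i)) ⊙ M) j                      ≡⟨ ⊙-scale (- y) (c ∘ suc) M j ⟩
      - y * (c ∘ suc ⊙ M) j            ≡⟨ cong (- y *_) (+-inverseʳ-unique _ _ (eq j)) ⟩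
      - y * - (c zero * v j)           ≡⟨ trans (sym (-‿distribˡ-* y _)) (trans (cong -_ (sym (-‿distribʳ-* y _))) (-‿involutive _)) ⟩
      y * (c zero * v j)               ≡⟨ x∙yz≈yx∙z y (c zero) (v j) ⟩
      c zero * y * v j                 ≡⟨ cong (_* v j) c₀y ⟩
      1F * v j                         ≡⟨ *-identityˡ (v j) ⟩
      v j                              ∎)
      where open ≡-Reasoning

    c₀≡0 : c zero ≡ 0F
    c₀≡0 with c zero Fin.≟ 0F
    ... | yes e = e
    ... | no ne = contradiction (_ , solved (proj₂ (inv (c zero) ne))) v∉

    rest : c ∘ suc ⊙ M ≗ 𝟎
    rest j = trans (sym (trans (cong (_+ (c ∘ suc ⊙ M) j) (trans (cong (_* v j) c₀≡0) (zeroˡ _))) (+-identityˡ _))) (eq j)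

  -- Bases of row spaces and the rank

  cnt : ∀ {a} → (Fin a → Bool) → ℕ
  cnt {zero}  S = 0
  cnt {suc a} S = (if S zero then suc else id) (cnt (S ∘ suc))

  Independent : ∀ {a b} → (Fin a → Bool) → Matrix a b → Set
  Independent S M = ∀ c → (∀ i → S i ≡ false → c i ≡ 0F) → c ⊙ M ≗ 𝟎 → c ≗ 𝟎

  -- A rank factorisation M = C · rows with independent rows; `D` writes these rows back in terms of
  -- M, so that D · C is the identity.
  record Basis {a b} (M : Matrix a b) (r : ℕ) : Set where
    field
      rows : Matrix r b
      li   : LI rows
      C    : Matrix a r
      D    : Matrix r a
      M≗CR : ∀ i → M i ≗ C i ⊙ rows
      R≗DM : ∀ i → rows i ≗ D i ⊙ M

    C-faithful : ∀ c → c ⊙ M ≗ c ⊙ C ⊙ rows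
    C-faithful c j = trans (⊙-congʳ c M≗CR j) (sym (⊙-⊗ c C rows j))

    DC≗I : ∀ i → D i ⊙ C ≗ unit i
    DC≗I i = LI-injective li λ j → trans (sym (C-faithful (D i) j))
      (trans (sym (R≗DM i j)) (sym (unit-⊙ i rows j)))

  0∷-⊙ : ∀ {a b} (c : Vector a) (M : Matrix (suc a) b) → cons 0F c ⊙ M ≗ c ⊙ M ∘ suc
  0∷-⊙ c M j = trans (⊙-step (cons 0F c) M j) (trans (cong (_+ (c ⊙ M ∘ suc) j) (zeroˡ _)) (+-identityˡ _))

  -- Greedy choice from the last row upwards: a row is kept when the rows kept so far do not span
  -- it. `S` records the kept rows because `rank` is a maximum over sets of rows.
  basis-of : ∀ {a b} (M : Matrix a b) → ∃ λ S → Independent S M × Basis M (cnt S)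
  basis-of {zero} M = (λ ()) , (λ _ _ _ ()) , record
    { rows = λ () ; li = λ _ _ () ; C = λ () ; D = λ () ; M≗CR = λ () ; R≗DM = λ () }
  basis-of {suc a} M with basis-of (M ∘ suc)
  ... | S , ind , B with InSpan? (M zero) (Basis.rows B)
  ...   | yes (d , M₀∈) = cons false S , ind′ , record
    { rows = rows ; li = li ; C = cons d C ; D = λ i → cons 0F (D i)
    ; M≗CR = λ { zero → M₀∈ ; (suc i) → M≗CR i }
    ; R≗DM = λ i j → trans (R≗DM i j) (sym (0∷-⊙ (D i) M j)) }
    where
    open Basis B
    ind′ : Independent (cons false S) M
    ind′ c supp h = λ { zero → c₀≡0 ; (suc i) → ind (c ∘ suc) (supp ∘ suc) rest i }
      where
      c₀≡0 : c zero ≡ 0F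
      c₀≡0 = supp zero refl
      rest : c ∘ suc ⊙ M ∘ suc ≗ 𝟎
      rest j = trans (sym (0∷-⊙ (c ∘ suc) M j))
        (trans (⊙-congˡ M (λ { zero → sym c₀≡0 ; (suc i) → refl }) j) (h j))
  ...   | no M₀∉ = cons true S , ind′ , record
    { rows = cons (M zero) rows ; li = li′ ; C = cons (unit zero) (λ i → cons 0F (C i))
    ; D = cons (unit zero) (λ i → cons 0F (D i))
    ; M≗CR = λ { zero j → sym (unit-⊙ zero (cons (M zero) rows) j)
               ; (suc i) j → trans (M≗CR i j) (sym (0∷-⊙ (C i) (cons (M zero) rows) j)) }
    ; R≗DM = λ { zero j → sym (unit-⊙ zero M j)
               ; (suc i) j → trans (R≗DM i j) (sym (0∷-⊙ (D i) M j)) } }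
    where
    open Basis B
    li′ : LI (cons (M zero) rows)
    li′ = LI-cons li M₀∉
    ind′ : Independent (cons true S) M
    ind′ c supp h = λ { zero → c₀≡0 ; (suc i) → ind (c ∘ suc) (supp ∘ suc) rest i }
      where
      c₀≡0 : c zero ≡ 0F
      c₀≡0 = li′ (cons (c zero) (c ∘ suc ⊙ C)) (λ j →
        trans (⊙-step (cons (c zero) (c ∘ suc ⊙ C)) (cons (M zero) rows) j)
        (trans (cong (c zero * M zero j +_) (sym (C-faithful (c ∘ suc) j)))
        (trans (sym (⊙-step c M j)) (h j)))) zero
      rest : c ∘ suc ⊙ M ∘ suc ≗ 𝟎
      rest j = trans (sym (0∷-⊙ (c ∘ suc) M j))
        (trans (⊙-congˡ M (λ { zero → sym c₀≡0 ; (suc i) → refl }) j) (h j))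

  expand : ∀ {a} (S : Fin a → Bool) → Vector (cnt S) → Vector a
  expand {suc a} S u with S zero
  ... | true  = cons (u zero) (expand (S ∘ suc) (u ∘ suc))
  ... | false = cons 0F (expand (S ∘ suc) u)

  expand-support : ∀ {a} (S : Fin a → Bool) u i → S i ≡ false → expand S u i ≡ 0F
  expand-support {suc a} S u i Si with S zero in S₀
  expand-support {suc a} S u zero    Si | true  = contradiction (trans (sym S₀) Si) λ ()
  expand-support {suc a} S u (suc i) Si | true  = expand-support (S ∘ suc) (u ∘ suc) i Si
  expand-support {suc a} S u zero    Si | false = refl
  expand-support {suc a} S u (suc i) Si | false = expand-support (S ∘ suc) u i Si

  expand-injective : ∀ {a} (S : Fin a → Bool) {u v} → expand S u ≗ expand S v → u ≗ v
  expand-injective {suc a} S h i with S zero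
  expand-injective {suc a} S h zero    | true  = h zero
  expand-injective {suc a} S h (suc i) | true  = expand-injective (S ∘ suc) (h ∘ suc) i
  expand-injective {suc a} S h i       | false = expand-injective (S ∘ suc) (h ∘ suc) i

  -- The q ^ cnt S coefficient vectors supported on `S` have different images under `M`, hence
  -- different values of `g`, of which there are at most q ^ r.
  independent-≤ : ∀ {a b r} {S : Fin a → Bool} {M : Matrix a b} → Independent S M →
    (g : Vector a → Vector r) → (∀ {c d} → g c ≗ g d → c ⊙ M ≗ d ⊙ M) → cnt S ≤ r
  independent-≤ {S = S} {M} ind g faithful = dim-≤ (λ u d → g (expand S u) ≗ d)
    (λ r r′ → expand-injective S (same (faithful (λ j → trans (r j) (sym (r′ j))))))
    (λ u → g (expand S u) , id)
    where
    same : ∀ {u v} → expand S u ⊙ M ≗ expand S v ⊙ M → expand S u ≗ expand S v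
    same {u} {v} h i = x∙y⁻¹≈ε⇒x≈y _ _ (ind (λ i → expand S u i - expand S v i)
      (λ i Si → trans (cong₂ _-_ (expand-support S u i Si) (expand-support S v i Si)) (-‿inverseʳ 0F))
      (λ j → trans (⊙-- (expand S u) (expand S v) M j)
        (trans (cong (_- (expand S v ⊙ M) j) (h j)) (-‿inverseʳ _))) i)

  countTrue≡cnt : ∀ {a} (S : Fin a → Bool) → countTrue S ≡ cnt S
  countTrue≡cnt {zero}  S = refl
  countTrue≡cnt {suc a} S = step (S zero) refl
    where
    tail : count (λ i → S i Bool.≟ true) (tabulate suc) ≡ cnt (S ∘ suc)
    tail = trans (cong (count (λ i → S i Bool.≟ true)) (sym (map-tabulate {n = a} id suc)))
      (trans (count-map (λ i → S i Bool.≟ true) suc (allFin a)) (countTrue≡cnt (S ∘ suc)))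

    step : ∀ b → S zero ≡ b → countTrue S ≡ (if b then suc else id) (cnt (S ∘ suc))
    step true  S₀ = trans (count-accept (λ i → S i Bool.≟ true) S₀) (cong suc tail)
    step false S₀ = trans (count-reject (λ i → S i Bool.≟ true) (λ e → contradiction (trans (sym S₀) e) λ ())) tail

  isZeroV⁺ : ∀ {n} {v : Vector n} → v ≗ 𝟎 → isZeroV v ≡ true
  isZeroV⁺ {v = v} h with Fin.all? (λ j → v j Fin.≟ 0F)
  ... | yes _ = refl
  ... | no ¬h = contradiction h ¬h

  isZeroV⁻ : ∀ {n} {v : Vector n} → T (isZeroV v) → v ≗ 𝟎
  isZeroV⁻ {v = v} t with Fin.all? (λ j → v j Fin.≟ 0F)
  ... | yes h = h

  module _ {a b} (S : Fin a → Bool) (M : Matrix a b) where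

    private
      trivial : Vector a → Bool
      trivial c = not (isZeroV (c ⊙ M)) ∨ isZeroV c ∨
                  any (λ i → not (S i) ∧ not ⌊ c i Fin.≟ 0F ⌋) (allFin a)

      Trivial : Vector a → Set
      Trivial c = (∀ i → S i ≡ false → c i ≡ 0F) → c ⊙ M ≗ 𝟎 → c ≗ 𝟎

      escape : ∀ (c : Vector a) i → T (not (S i) ∧ not ⌊ c i Fin.≟ 0F ⌋) → S i ≡ false × c i ≢ 0F
      escape c i t with S i
      ... | true = ⊥-elim t
      ... | false with c i Fin.≟ 0F
      ...   | yes _ = ⊥-elim t
      ...   | no ne = refl , ne

      escape⁻ : ∀ (c : Vector a) i → S i ≡ false → c i ≢ 0F → T (not (S i) ∧ not ⌊ c i Fin.≟ 0F ⌋)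
      escape⁻ c i Si ne rewrite Si with c i Fin.≟ 0F
      ... | yes e = contradiction e ne
      ... | no _  = _

      trivial⇒ : ∀ c → T (trivial c) → Trivial c
      trivial⇒ c t supp h rewrite isZeroV⁺ h with Fin.all? (λ j → c j Fin.≟ 0F)
      ... | yes z = z
      ... | no _ = let (i , ti) = Any.satisfied (Any.any⁻ _ (allFin a) t)
                       (Si , ne) = escape c i ti in contradiction (supp i Si) ne

      trivial⇐ : ∀ c → Trivial c → T (trivial c)
      trivial⇐ c tr with Fin.all? (λ j → (c ⊙ M) j Fin.≟ 0F)
      ... | no _  = _
      ... | yes h with Fin.all? (λ j → c j Fin.≟ 0F)
      ...   | yes _ = _
      ...   | no ¬z with Fin.any? (λ i → (S i Bool.≟ false) ×-dec ¬? (c i Fin.≟ 0F))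
      ...     | yes (i , Si , ne) = Any.any⁺ _ (Any.tabulate⁺ i (escape⁻ c i Si ne))
      ...     | no none = contradiction (tr (λ i Si → decidable-stable (c i Fin.≟ 0F)
                            (λ ne → none (i , Si , ne))) h) ¬z

    independentRows⇒ : independentRows S M ≡ true → Independent S M
    independentRows⇒ e c supp h i = trans (c≗d i) (trivial⇒ (Any.lookup found) t
        (λ j Sj → trans (sym (c≗d j)) (supp j Sj))
        (λ j → trans (⊙-congˡ M (λ l → sym (c≗d l)) j) (h j)) i)
      where
      found = allVectors-complete c
      both = All.lookupAny (All.all⁺ trivial (allVectors a) (Equivalence.from T-≡ e)) found
      t = proj₁ both
      c≗d = proj₂ both

    independentRows⇐ : Independent S M → independentRows S M ≡ true
    independentRows⇐ ind = Equivalence.to T-≡ (All.all⁻ trivial (All.universal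
      (λ c → trivial⇐ c (λ supp h → ind c supp h)) (allVectors a)))

  maxList-≤ : ∀ {r xs} → All (_≤ r) xs → maxList xs ≤ r
  maxList-≤ []       = z≤n
  maxList-≤ (h ∷ hs) = ℕ.⊔-lub h (maxList-≤ hs)

  ≤-maxList : ∀ {r xs} → Any (r ≤_) xs → r ≤ maxList xs
  ≤-maxList {xs = x ∷ xs} (here h)  = ℕ.≤-trans h (ℕ.m≤m⊔n x (maxList xs))
  ≤-maxList {xs = x ∷ xs} (there h) = ℕ.≤-trans (≤-maxList h) (ℕ.m≤n⊔m x (maxList xs))

  cnt-cong : ∀ {a} {S S′ : Fin a → Bool} → S ≗ S′ → cnt S ≡ cnt S′
  cnt-cong {zero}  h = refl
  cnt-cong {suc a} h = cong₂ (λ b → if b then suc else id) (h zero) (cnt-cong (h ∘ suc))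

  -- The standard tool below for bounding a rank from above: exhibit r coordinates of the
  -- coefficients that already determine the row combination.
  rank-≤ : ∀ {a b r} (M : Matrix a b) (g : Vector a → Vector r) →
           (∀ {c d} → g c ≗ g d → c ⊙ M ≗ d ⊙ M) → rank M ≤ r
  rank-≤ {r = r} M g faithful = maxList-≤ (All.map⁺ (All.universal bound (allFuns _ (true ∷ false ∷ []))))
    where
    bound : ∀ S → (if independentRows S M then countTrue S else 0) ≤ r
    bound S with independentRows S M in e
    ... | true  = subst (_≤ r) (sym (countTrue≡cnt S)) (independent-≤ (independentRows⇒ S M e) g faithful)
    ... | false = z≤n

  independent-≤-rank : ∀ {a b} {S : Fin a → Bool} {M : Matrix a b} → Independent S M → cnt S ≤ rank M
  independent-≤-rank {a} {S = S} {M} ind = ≤-maxList (Any.map⁺ (Any.map hit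
    (allFuns-complete (true ∷ false ∷ []) _≡_ S (λ i → bool (S i)))))
    where
    bool : ∀ b → Any (b ≡_) (true ∷ false ∷ [])
    bool true  = here refl
    bool false = there (here refl)

    hit : ∀ {S′} → S ≗ S′ → cnt S ≤ (if independentRows S′ M then countTrue S′ else 0)
    hit {S′} h rewrite independentRows⇐ S′ M (λ c supp → ind c (λ i Si → supp i (trans (sym (h i)) Si))) =
      ℕ.≤-reflexive (trans (cnt-cong h) (sym (countTrue≡cnt S′)))

  -- The greedy set attains the maximum: it is independent, and the coordinates `c ⊙ C` determine
  -- `c ⊙ M`, which bounds every other independent set by the same number.
  rank-basis : ∀ {a b} (M : Matrix a b) → Basis M (rank M)
  rank-basis M with basis-of M
  ... | S , ind , B = subst (Basis M) (ℕ.≤-antisym (independent-≤-rank ind)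
          (rank-≤ M (_⊙ C) (λ {c} {d} h j → trans (C-faithful c j)
            (trans (⊙-congˡ rows h j) (sym (C-faithful d j)))))) B
    where open Basis B

  infixr 5 _⧺_

  _⧺_ : ∀ {m n} {A : Set} → (Fin m → A) → (Fin n → A) → Fin (m ℕ.+ n) → A
  _⧺_ {m} u w = Sum.[ u , w ]′ ∘ Fin.splitAt m

  ⧺-↑ˡ : ∀ {m n} {A : Set} (u : Fin m → A) (w : Fin n → A) i → (u ⧺ w) (i Fin.↑ˡ n) ≡ u i
  ⧺-↑ˡ {m} {n} u w i = cong Sum.[ u , w ]′ (Fin.splitAt-↑ˡ m i n)

  ⧺-↑ʳ : ∀ {m n} {A : Set} (u : Fin m → A) (w : Fin n → A) i → (u ⧺ w) (m Fin.↑ʳ i) ≡ w i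
  ⧺-↑ʳ {m} {n} u w i = cong Sum.[ u , w ]′ (Fin.splitAt-↑ʳ m n i)

  ⧺-ext : ∀ {m n} {A : Set} {f g : Fin (m ℕ.+ n) → A} →
          f ∘ (Fin._↑ˡ n) ≗ g ∘ (Fin._↑ˡ n) → f ∘ (m Fin.↑ʳ_) ≗ g ∘ (m Fin.↑ʳ_) → f ≗ g
  ⧺-ext {m} {n} l r i with Fin.splitAt m i | Fin.join-splitAt m n i
  ... | inj₁ j | refl = l j
  ... | inj₂ j | refl = r j

  -- Coefficients with the same image under `N` differ by a relation among the rows of `N`, so they
  -- have the same image under `M`; hence rank N coordinates determine `c ⊙ M`.
  rank-mono-kernel : ∀ {a b b′} (M : Matrix a b) (N : Matrix a b′) →
                     (∀ c → c ⊙ N ≗ 𝟎 → c ⊙ M ≗ 𝟎) → rank M ≤ rank N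
  rank-mono-kernel M N ker = rank-≤ M (_⊙ C) λ {c} {d} h j → x∙y⁻¹≈ε⇒x≈y _ _ (trans (sym (⊙-- c d M j))
    (ker (λ i → c i - d i) (λ l → trans (⊙-- c d N l) (trans (cong₂ _-_ (trans (C-faithful c l)
       (trans (⊙-congˡ rows h l) (sym (C-faithful d l)))) refl) (-‿inverseʳ _))) j))
    where open Basis (rank-basis N)

  rank-cong : ∀ {a b} {M N : Matrix a b} → (∀ i → M i ≗ N i) → rank M ≡ rank N
  rank-cong {M = M} {N} h = ℕ.≤-antisym
    (rank-mono-kernel M N (λ c k j → trans (⊙-congʳ c h j) (k j)))
    (rank-mono-kernel N M (λ c k j → trans (sym (⊙-congʳ c h j)) (k j)))

  LI-≤-rank : ∀ {a b r} {R : Matrix r b} (M : Matrix a b) → LI R → (∀ i → InSpan (R i) M) → r ≤ rank M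
  LI-≤-rank {R = R} M liR span = dim-≤ (λ c d → c ⊙ X ≗ d)
    (λ r r′ → LI-injective liR (same (λ j → trans (r j) (sym (r′ j))))) (λ c → c ⊙ X , id)
    where
    open Basis (rank-basis M)
    X : Matrix _ (rank M)
    X i = proj₁ (span i) ⊙ C
    R≗XR : ∀ i → R i ≗ X i ⊙ rows
    R≗XR i j = trans (proj₂ (span i) j) (C-faithful (proj₁ (span i)) j)
    same : ∀ {c d} → c ⊙ X ≗ d ⊙ X → c ⊙ R ≗ d ⊙ R
    same {c} {d} h j = trans (expandR c) (trans (⊙-congˡ rows h j) (sym (expandR d)))
      where
      expandR : ∀ c → (c ⊙ R) j ≡ (c ⊙ X ⊙ rows) j
      expandR c = trans (⊙-congʳ c R≗XR j) (sym (⊙-⊗ c X rows j))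

  LI-rank : ∀ {a b} {M : Matrix a b} → LI M → rank M ≡ a
  LI-rank {M = M} li = ℕ.≤-antisym (rank-≤ M id (⊙-congˡ M))
    (LI-≤-rank M li (λ i → unit i , λ j → sym (unit-⊙ i M j)))

  rank-≤-cols : ∀ {a b} (M : Matrix a b) → rank M ≤ b
  rank-≤-cols M = rank-≤ M (_⊙ M) id

  -- Transposing M = C · rows gives a factorisation of the transpose through equally many
  -- coordinates.
  rank-ᵀ-≤ : ∀ {a b} (M : Matrix a b) → rank (M ᵀ) ≤ rank M
  rank-ᵀ-≤ M = rank-≤ (M ᵀ) (_⊙ (rows ᵀ)) λ {c} {d} h j →
    trans (factor c j) (trans (⊙-congˡ (C ᵀ) h j) (sym (factor d j)))
    where
    open Basis (rank-basis M)
    factor : ∀ c → c ⊙ (M ᵀ) ≗ c ⊙ (rows ᵀ) ⊙ (C ᵀ)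
    factor c j = trans (⊙-congʳ c {M ᵀ} {(rows ᵀ) ⊗ (C ᵀ)} entry j) (sym (⊙-⊗ c (rows ᵀ) (C ᵀ) j))
      where
      entry : ∀ i → (M ᵀ) i ≗ (rows ᵀ) i ⊙ (C ᵀ)
      entry i l = trans (M≗CR l i) (trans (⊙-sum (C l) rows i)
        (trans (sum-cong-≗ (λ t → *-comm (C l t) (rows t i))) (sym (⊙-sum ((rows ᵀ) i) (C ᵀ) l))))

  rank-ᵀ : ∀ {a b} (M : Matrix a b) → rank (M ᵀ) ≡ rank M
  rank-ᵀ M = ℕ.≤-antisym (rank-ᵀ-≤ M) (rank-ᵀ-≤ (M ᵀ))

  count-span : ∀ {s a} {K : Matrix s a} {P : Vector a → Set} (P? : ∀ v → Dec (P v)) → LI K →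
    (∀ {v} → P v → InSpan v K) → (∀ {v} → InSpan v K → P v) → count P? (allVectors a) ≡ q ^ s
  count-span {s} {a} {K} {P} P? li to from = ℕ.≤-antisym
    (subst (count P? (allVectors a) ≤_) (length-allVectors s) (length-≤ (λ v u → v ≗ u ⊙ K)
      (AllPairs.map (λ (i , v≢v′) u r r′ → v≢v′ (trans (r i) (sym (r′ i))))
        (AllPairs.filter⁺ P? (allVectors-unique a)))
      (All.map (λ p → let u , h = to p in
          Any.map (λ e j → trans (h j) (⊙-congˡ K e j)) (allVectors-complete u))
        (All.all-filter P? (allVectors a)))))
    (subst (_≤ count P? (allVectors a)) (length-allVectors s) (length-≤ (λ u v → v ≗ u ⊙ K)
      (AllPairs.map (λ (i , u≢u′) v r r′ → u≢u′ (LI-injective li (λ j → trans (sym (r j)) (r′ j)) i))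
        (allVectors-unique s))
      (All.universal (λ u → Any-filter⁺ P? (Any.map
          (λ e → (λ j → sym (e j)) , from (u , λ j → sym (e j)))
          (allVectors-complete (u ⊙ K)))) (allVectors s))))

  record Closed {a} (P : Vector a → Set) : Set where
    field
      respects : ∀ {u v} → u ≗ v → P u → P v
      combines : ∀ {s} {M : Matrix s a} → (∀ i → P (M i)) → ∀ c → P (c ⊙ M)

  -- All vectors satisfying `P`, written as the rows of one matrix, have `P` as their row space, so
  -- a basis of that row space serves.
  subspace-basis : ∀ {a} {P : Vector a → Set} (P? : ∀ v → Dec (P v)) → Closed P →
    ∃ λ s → Σ (Matrix s a) λ K → LI K × (∀ i → P (K i)) × (∀ {v} → P v → InSpan v K)
  subspace-basis {a} {P} P? closed = rank M , rows , li ,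
    (λ i → respects (λ j → sym (R≗DM i j)) (combines inP (D i))) , spans
    where
    open Closed closed
    vs : List (Vector a)
    vs = filter P? (allVectors a)
    M : Matrix (length vs) a
    M = listMatrix vs
    open Basis (rank-basis M)
    inP : ∀ i → P (M i)
    inP i = All.lookup (All.all-filter P? (allVectors a)) (∈-lookup i)
    spans : ∀ {v} → P v → InSpan v rows
    spans {v} p = C i , λ j → trans (Any.lookup-index found j) (M≗CR i j)
      where
      found : Any (v ≗_) vs
      found = Any-filter⁺ P? (Any.map (λ e → e , respects e p) (allVectors-complete v))
      i = Any.index found

  combines-𝟎 : ∀ {s a b} (M : Matrix s a) (N : Matrix a b) → (∀ i → M i ⊙ N ≗ 𝟎) → ∀ c → c ⊙ M ⊙ N ≗ 𝟎
  combines-𝟎 M N h c j = trans (⊙-⊗ c M N j) (trans (⊙-sum c (M ⊗ N) j)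
    (sum-0 {f = λ i → c i * (M i ⊙ N) j} λ i → trans (cong (c i *_) (h i j)) (zeroʳ _)))

  kernel-closed : ∀ {a b} (M : Matrix a b) → Closed (λ c → c ⊙ M ≗ 𝟎)
  kernel-closed M = record
    { respects = λ e h j → trans (sym (⊙-congˡ M e j)) (h j)
    ; combines = λ {_} {K} h c → combines-𝟎 K M h c }

  kernel-basis : ∀ {a b} (M : Matrix a b) → ∃ λ s → Σ (Matrix s a) λ K → s ℕ.+ rank M ≡ a ×
    LI K × (∀ i → K i ⊙ M ≗ 𝟎) × (∀ {c} → c ⊙ M ≗ 𝟎 → InSpan c K)
  kernel-basis {a} M = s , K , ℕ.≤-antisym s+r≤a a≤s+r , liK , kills , spans
    where
    kernel = subspace-basis (λ c → (c ⊙ M) ≗? 𝟎) (kernel-closed M)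
    s = proj₁ kernel
    K = proj₁ (proj₂ kernel)
    liK = proj₁ (proj₂ (proj₂ kernel))
    kills = proj₁ (proj₂ (proj₂ (proj₂ kernel)))
    spans = proj₂ (proj₂ (proj₂ (proj₂ kernel)))
    open Basis (rank-basis M)
    r = rank M
    -- Every c splits uniquely as u K + w D, with w = c C.
    recombine : Vector s → Vector r → Vector a
    recombine u w j = (u ⊙ K) j + (w ⊙ D) j

    _splits-as_ : Vector a → Vector (s ℕ.+ r) → Set
    c splits-as d = c ≗ recombine (d ∘ (Fin._↑ˡ r)) (d ∘ (s Fin.↑ʳ_))

    KC≗0 : ∀ i → K i ⊙ C ≗ 𝟎
    KC≗0 i = li (K i ⊙ C) (λ j → trans (sym (C-faithful (K i) j)) (kills i j))

    recover : ∀ u w {c : Vector a} → c ≗ recombine u w → c ⊙ C ≗ w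
    recover u w h t = trans (⊙-congˡ C h t) (trans (⊙-+ (u ⊙ K) (w ⊙ D) C t)
      (trans (cong₂ _+_ (combines-𝟎 K C KC≗0 u t) (trans (⊙-⊗ w D C t)
        (trans (⊙-congʳ w DC≗I t) (⊙-unit w t)))) (+-identityˡ _)))

    a≤s+r : a ≤ s ℕ.+ r
    a≤s+r = dim-≤ _splits-as_ (λ h h′ j → trans (h j) (sym (h′ j))) split
      where
      split : ∀ c → ∃ λ d → ∀ {e} → d ≗ e → c splits-as e
      split c = u ⧺ w , λ {e} h j → trans (c≡ j) (cong₂ _+_
        (⊙-congˡ K (λ i → trans (sym (⧺-↑ˡ u w i)) (h (i Fin.↑ˡ r))) j)
        (⊙-congˡ D (λ i → trans (sym (⧺-↑ʳ u w i)) (h (s Fin.↑ʳ i))) j))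
        where
        w = c ⊙ C
        wD≡ : w ⊙ D ⊙ M ≗ c ⊙ M
        wD≡ j = trans (⊙-⊗ w D M j) (trans (sym (⊙-congʳ w R≗DM j)) (sym (C-faithful c j)))
        -- D · M gives back the basis rows, so `w ⊙ D` and `c` have the same image under `M`.
        in-kernel : InSpan (λ j → c j - (w ⊙ D) j) K
        in-kernel = spans λ j → trans (⊙-- c (w ⊙ D) M j)
          (trans (cong (λ x → (c ⊙ M) j - x) (wD≡ j)) (-‿inverseʳ _))
        u = proj₁ in-kernel
        c≡ : c ≗ recombine u w
        c≡ j = trans (sym (//-rightDividesˡ ((w ⊙ D) j) (c j))) (cong (_+ (w ⊙ D) j) (proj₂ in-kernel j))

    s+r≤a : s ℕ.+ r ≤ a
    s+r≤a = dim-≤ (flip _splits-as_) same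
      (λ d → recombine (d ∘ (Fin._↑ˡ r)) (d ∘ (s Fin.↑ʳ_)) , λ e j → sym (e j))
      where
      same : ∀ {d d′ c} → c splits-as d → c splits-as d′ → d ≗ d′
      same {d} {d′} {c} h h′ = ⧺-ext (LI-injective liK λ j → +-cancelʳ ((d ∘ (s Fin.↑ʳ_) ⊙ D) j) _ _
          (trans (sym (h j)) (trans (h′ j) (cong ((d′ ∘ (Fin._↑ˡ r) ⊙ K) j +_) (sym (⊙-congˡ D w≗ j)))))) w≗
        where
        w≗ : d ∘ (s Fin.↑ʳ_) ≗ d′ ∘ (s Fin.↑ʳ_)
        w≗ t = trans (sym (recover _ _ h t)) (recover _ _ h′ t)

  kernel-count : ∀ {a b} (M : Matrix a b) → count (λ c → (c ⊙ M) ≗? 𝟎) (allVectors a) ≡ q ^ (a ∸ rank M)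
  kernel-count {a} M = trans (count-span (λ c → (c ⊙ M) ≗? 𝟎) li spans from)
      (cong (q ^_) (trans (sym (ℕ.m+n∸n≡m s (rank M))) (cong (_∸ rank M) s+r≡a)))
    where
    kernel = kernel-basis M
    s = proj₁ kernel
    K = proj₁ (proj₂ kernel)
    s+r≡a = proj₁ (proj₂ (proj₂ kernel))
    li = proj₁ (proj₂ (proj₂ (proj₂ kernel)))
    kills = proj₁ (proj₂ (proj₂ (proj₂ (proj₂ kernel))))
    spans = proj₂ (proj₂ (proj₂ (proj₂ (proj₂ kernel))))

    from : ∀ {v} → InSpan v K → v ⊙ M ≗ 𝟎
    from (u , h) j = trans (⊙-congˡ M h j) (combines-𝟎 K M kills u j)

  outside-span : ∀ {r k} (R : Matrix r k) → r < k → ∃ λ v → ¬ InSpan v R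
  outside-span {r} {k} R r<k with Any.any? (λ v → ¬? (InSpan? v R)) (allVectors k)
  ... | yes a = Any.satisfied a
  ... | no none = contradiction (dim-≤ (λ v u → v ≗ u ⊙ R) (λ h h′ j → trans (h j) (sym (h′ j))) spanned)
                    (ℕ.<⇒≱ r<k)
    where
    spanned : ∀ v → ∃ λ u → ∀ {e} → u ≗ e → v ≗ e ⊙ R
    spanned v with InSpan? v R
    ... | yes (u , h) = u , λ e j → trans (h j) (⊙-congˡ R e j)
    ... | no v∉ = contradiction (Any.map (λ e (u , h) → v∉ (u , λ j → trans (e j) (h j)))
                    (allVectors-complete v)) none

  -- The new vectors go in front, so that `R` stays recognisable as the last r rows.
  extend-LI : ∀ n {r k} (R : Matrix r k) → LI R → n ℕ.+ r ≤ k →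
              Σ (Matrix (n ℕ.+ r) k) λ Q → LI Q × (∀ i → Q (n Fin.↑ʳ i) ≡ R i)
  extend-LI zero    R li le = R , li , λ _ → refl
  extend-LI (suc n) R li le with extend-LI n R li (ℕ.<⇒≤ le)
  ... | Q , liQ , tail = let v , v∉ = outside-span Q le in cons v Q , LI-cons liQ v∉ , tail

-- The rank distribution of MRD codes.

module Weight {q} (F : FiniteField q) where

  open Counting
  open import Data.Bool as Bool using (true; false)
  open import Data.Bool.Properties using (T-≡)
  open import Data.Nat using (_^_)
  open import Data.Nat.ListAction using () renaming (sum to sumᴺ)
  open import Data.Product using (_×_)
  open import Relation.Binary.PropositionalEquality

  open FiniteField F
  open LinAlg F
  open Rank F

  -- For d > 0 this contains two conditions: the matrices of `G` are independent, since the zero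
  -- matrix has rank 0 < d, and every nonzero word has rank at least d.
  MinRank : ∀ {N a b} → ℕ → (Fin N → Matrix a b) → Set
  MinRank d G = ∀ c → rank (matComb c G) < d → c ≗ 𝟎

  mrd-minRank : ∀ {a b δ} (D : MRD a b δ) → MinRank δ (MRD.basis D)
  mrd-minRank D c low = by-zero (isZeroM X) refl
    where
    X = matComb c (MRD.basis D)
    by-zero : ∀ z → isZeroM X ≡ z → c ≗ 𝟎
    by-zero true  e = isZeroV⁻ (Equivalence.from T-≡ (MRD.independent D c e))
    by-zero false e = contradiction (MRD.minRank D c e) (ℕ.<⇒≱ low)

  -- The i-th entry of  action G c v  is the i-th entry of X v, where X = matComb c G.
  action : ∀ {N m k} → (Fin N → Matrix m k) → Vector N → Vector k → Vector m
  action G c v = v ⊙ (matComb c G) ᵀ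

  action-- : ∀ {N m k} (G : Fin N → Matrix m k) c d v →
             action G (λ t → c t - d t) v ≗ λ i → action G c v i - action G d v i
  action-- G c d v i = trans (⊙-congʳ v {(matComb (λ t → c t - d t) G) ᵀ}
      {λ l i → (matComb c G) i l - (matComb d G) i l} (λ l i → ⊙-- c d (λ t → G t i) l) i)
    (⊙--ᴹ v ((matComb c G) ᵀ) ((matComb d G) ᵀ) i)

  Kills : ∀ {N m k t} → (Fin N → Matrix m k) → Matrix t k → Vector N → Set
  Kills G P c = ∀ j → action G c (P j) ≗ 𝟎

  Kills? : ∀ {N m k t} (G : Fin N → Matrix m k) (P : Matrix t k) c → Dec (Kills G P c)
  Kills? G P c = Fin.all? (λ j → action G c (P j) ≗? 𝟎)

  killed-rank : ∀ {m k r} (X : Matrix m k) {R : Matrix r k} → LI R → (∀ j → R j ⊙ X ᵀ ≗ 𝟎) →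
                r ℕ.+ rank X ≤ k
  killed-rank {k = k} {r} X {R} liR kill = begin
    r ℕ.+ rank X       ≡⟨ cong (r ℕ.+_) (rank-ᵀ X) ⟨
    r ℕ.+ rank (X ᵀ)   ≤⟨ ℕ.+-monoˡ-≤ (rank (X ᵀ)) r≤s ⟩
    s ℕ.+ rank (X ᵀ)   ≡⟨ proj₁ (proj₂ (proj₂ kernel)) ⟩
    k                  ∎
    where
    open ℕ.≤-Reasoning
    kernel = kernel-basis (X ᵀ)
    s = proj₁ kernel
    K = proj₁ (proj₂ kernel)
    liK = proj₁ (proj₂ (proj₂ (proj₂ kernel)))
    spans = proj₂ (proj₂ (proj₂ (proj₂ (proj₂ kernel))))
    r≤s : r ≤ s
    r≤s = subst (r ≤_) (LI-rank liK) (LI-≤-rank K liR (λ i → spans (kill i)))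

  module _ {m k : ℕ} where

    -- Killing u = k + 1 - d or more independent vectors leaves rank at most d - 1.
    killed-by-many : ∀ {N d u r} {G : Fin N → Matrix m k} → MinRank d G → u ℕ.+ d ≡ suc k → u ≤ r →
      {R : Matrix r k} → LI R → ∀ c → Kills G R c → c ≗ 𝟎
    killed-by-many {d = d} {u} {r} {G} mr u+d u≤r li c kill = mr c (ℕ.+-cancelˡ-≤ u _ _ (begin
      u ℕ.+ suc (rank X)   ≡⟨ ℕ.+-suc u (rank X) ⟩
      suc (u ℕ.+ rank X)   ≤⟨ s≤s (ℕ.+-monoˡ-≤ (rank X) u≤r) ⟩
      suc (r ℕ.+ rank X)   ≤⟨ s≤s (killed-rank X li kill) ⟩
      suc k                ≡⟨ u+d ⟨
      u ℕ.+ d              ∎))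
      where
      open ℕ.≤-Reasoning
      X = matComb c G

    action-injective : ∀ {N d u} {G : Fin N → Matrix m k} → MinRank d G → u ℕ.+ d ≡ suc k →
      {Q : Matrix u k} → LI Q → ∀ {c c′} → (∀ j → action G c (Q j) ≗ action G c′ (Q j)) → c ≗ c′
    action-injective {G = G} mr u+d {Q} li {c} {c′} h i = x∙y⁻¹≈ε⇒x≈y _ _
      (killed-by-many {G = G} mr u+d ℕ.≤-refl li (λ t → c t - c′ t) (λ j l →
        trans (action-- G c c′ (Q j) l) (trans (cong (_- action G c′ (Q j) l) (h j l)) (-‿inverseʳ _))) i)

    -- Injectivity of c ↦ X_c Q forces surjectivity, because dim = m u.
    action-surjective : ∀ {d u} {G : Fin (m ℕ.* u) → Matrix m k} → MinRank d G → u ℕ.+ d ≡ suc k →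
      {Q : Matrix u k} → LI Q → (w : Fin u → Vector m) → ∃ λ c → ∀ j → action G c (Q j) ≗ w j
    action-surjective {u = u} {G} mr u+d {Q} li w
      with Any.any? (λ c → Fin.all? (λ j → action G c (Q j) ≗? w j)) (allVectors (m ℕ.* u))
    ... | yes a = Any.satisfied a
    ... | no none = contradiction
      (length-< (λ c y → ∀ j → action G c (Q j) ≗ y j) {P = λ y → ∀ j → y j ≗ w j}
        (λ y → Fin.all? (λ j → y j ≗? w j))
        (AllPairs.map (λ (i , c≢c′) y r r′ → c≢c′ (action-injective {G = G} mr u+d li
          (λ j l → trans (r j l) (sym (r′ j l))) i)) (allVectors-unique (m ℕ.* u)))
        (Any.map (λ h j l → sym (h j l)) (complete w))
        (All.map (λ {c} c∉ → Any.map (λ r → r , λ y≗w → c∉ (λ j l → trans (r j l) (y≗w j l)))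
          (complete (λ j → action G c (Q j)))) (All.¬Any⇒All¬ _ none)))
      (ℕ.≤⇒≯ (ℕ.≤-reflexive (begin
        length (allFuns u (allVectors m))   ≡⟨ length-allFuns (allVectors m) u ⟩
        length (allVectors m) ^ u           ≡⟨ cong (_^ u) (length-allVectors m) ⟩
        (q ^ m) ^ u                         ≡⟨ ℕ.^-*-assoc q m u ⟩
        q ^ (m ℕ.* u)                       ≡⟨ length-allVectors (m ℕ.* u) ⟨
        length (allVectors (m ℕ.* u))       ∎)))
      where
      open ≡-Reasoning
      complete : (y : Fin u → Vector m) → Any (λ y′ → ∀ j → y j ≗ y′ j) (allFuns u (allVectors m))
      complete y = allFuns-complete (allVectors m) _≗_ y (λ j → allVectors-complete (y j))

    kills-rows : ∀ {N t} (G : Fin N → Matrix m k) (P : Matrix t k) c →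
      Kills G P c → Kills G (Basis.rows (rank-basis P)) c
    kills-rows G P c kill j i = trans (⊙-congˡ (matComb c G ᵀ) (R≗DM j) i)
      (combines-𝟎 P (matComb c G ᵀ) kill (D j) i)
      where open Basis (rank-basis P)

    kills-all : ∀ {N t} (G : Fin N → Matrix m k) (P : Matrix t k) c →
      Kills G (Basis.rows (rank-basis P)) c → Kills G P c
    kills-all G P c kill j i = trans (⊙-congˡ (matComb c G ᵀ) (M≗CR j) i)
      (combines-𝟎 rows (matComb c G ᵀ) kill (C j) i)
      where open Basis (rank-basis P)

    private
      -- The case rank P ≤ u. `R` is extended to u independent rows `Q`. Different words of `G` have
      -- different values on `Q`, and each of these value tuples is attained by a word of `G′`. As
      -- `R` is part of `Q`, the matching word kills `R` too, so words killing P are matched with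
      -- words killing P.
      few : ∀ {d u r t} n → n ℕ.+ r ≡ u → (G G′ : Fin (m ℕ.* u) → Matrix m k) → MinRank d G → MinRank d G′ →
        u ℕ.+ d ≡ suc k → 0 < d → (P : Matrix t k) (R : Matrix r k) → LI R →
        (∀ c → Kills G P c → Kills G R c) → (∀ c → Kills G′ R c → Kills G′ P c) →
        count (Kills? G P) (allVectors (m ℕ.* u)) ≤ count (Kills? G′ P) (allVectors (m ℕ.* u))
      few {d} {_} {r} n refl G G′ mr mr′ u+d 0<d P R liR to from =
        count-≤ (Kills? G P) (Kills? G′ P) (λ c c′ → ∀ j → action G c (Q j) ≗ action G′ c′ (Q j))
          (λ {c} {c₁} (i , c≢c₁) c′ h h₁ → c≢c₁ (action-injective {G = G} mr u+d liQ {c} {c₁}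
            (λ j l → trans (h j l) (sym (h₁ j l))) i))
          (allVectors-unique (m ℕ.* (n ℕ.+ r))) hit
        where
        u≤k : n ℕ.+ r ≤ k
        u≤k = ℕ.s≤s⁻¹ (subst (suc (n ℕ.+ r) ≤_) u+d (ℕ.≤-trans (ℕ.≤-reflexive (ℕ.+-comm 1 (n ℕ.+ r)))
                (ℕ.+-monoʳ-≤ (n ℕ.+ r) 0<d)))
        extension = extend-LI n R liR u≤k
        Q = proj₁ extension
        liQ = proj₁ (proj₂ extension)
        Q↑ = proj₂ (proj₂ extension)

        hit : ∀ {c} → Kills G P c →
              Any (λ c′ → (∀ j → action G c (Q j) ≗ action G′ c′ (Q j)) × Kills G′ P c′)
                  (allVectors (m ℕ.* (n ℕ.+ r)))
        hit {c} kill = Any.map (λ {c′} e →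
            let same = λ j i → trans (sym (proj₂ image j i)) (action-cong e (Q j) i) in
            same , from c′ (λ j i → trans (cong (λ v → action G′ c′ v i) (sym (Q↑ j)))
              (trans (sym (same (n Fin.↑ʳ j) i))
              (trans (cong (λ v → action G c v i) (Q↑ j)) (to c kill j i)))))
            (allVectors-complete (proj₁ image))
          where
          image = action-surjective {G = G′} mr′ u+d liQ (λ j → action G c (Q j))
          action-cong : ∀ {c c′} → c ≗ c′ → ∀ v → action G′ c v ≗ action G′ c′ v
          action-cong {c} {c′} e v = ⊙-congʳ v {(matComb c G′) ᵀ} {(matComb c′ G′) ᵀ}
            (λ l i → ⊙-congˡ (λ t → G′ t i) e l)

      -- The case rank P ≥ u. Only the zero word of `G` can kill that many independent vectors, and
      -- the zero word of `G′` also kills P.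
      one : ∀ {d u r t} → u ≤ r → (G G′ : Fin (m ℕ.* u) → Matrix m k) → MinRank d G →
        u ℕ.+ d ≡ suc k → (P : Matrix t k) (R : Matrix r k) → LI R →
        (∀ c → Kills G P c → Kills G R c) →
        count (Kills? G P) (allVectors (m ℕ.* u)) ≤ count (Kills? G′ P) (allVectors (m ℕ.* u))
      one {u = u} u≤r G G′ mr u+d P R liR to = count-≤ (Kills? G P) (Kills? G′ P) (λ c _ → c ≗ 𝟎)
        (λ (i , c≢c₁) _ h h₁ → c≢c₁ (trans (h i) (sym (h₁ i)))) (allVectors-unique (m ℕ.* u))
        (λ {c} kill → Any.map (λ {c′} e → killed-by-many {G = G} mr u+d u≤r liR c (to c kill) , zero-kills (λ t → sym (e t)))
          (allVectors-complete 𝟎))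
        where
        zero-kills : ∀ {c} → c ≗ 𝟎 → Kills G′ P c
        zero-kills {c} z j i = trans (⊙-sum (P j) (matComb c G′ ᵀ) i)
          (sum-0 {f = λ l → P j l * matComb c G′ i l} λ l →
            trans (cong (P j l *_) (⊙-zeroˡ (λ t → G′ t i) z l)) (zeroʳ _))

    module _ {d u : ℕ} (u+d : u ℕ.+ d ≡ suc k) (0<d : 0 < d) where

      private
        N : ℕ
        N = m ℕ.* u

        Code : Set
        Code = Fin N → Matrix m k

      count-kills-≤ : (G G′ : Code) → MinRank d G → MinRank d G′ → ∀ {t} (P : Matrix t k) →
        count (Kills? G P) (allVectors N) ≤ count (Kills? G′ P) (allVectors N)
      count-kills-≤ G G′ mr mr′ P with rank P ℕ.≤? u
      ... | yes r≤u = few (u ∸ rank P) (ℕ.m∸n+n≡m r≤u) G G′ mr mr′ u+d 0<d P _ (Basis.li (rank-basis P))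
                        (kills-rows G P) (kills-all G′ P)
      ... | no r≰u = one (ℕ.≰⇒≥ r≰u) G G′ mr u+d P _ (Basis.li (rank-basis P)) (kills-rows G P)

      private
        -- With t = N + 1 the base B = q^t exceeds the number q^N of words, so that all counts of
        -- words are digits.
        t B : ℕ
        t = suc N
        B = q ^ t

        defect : Code → Vector N → ℕ
        defect G c = k ∸ rank (matComb c G)

      -- A matrix P is killed by a word exactly when its t rows lie in the kernel of the word, which
      -- has q^(k - rank) elements. This gives (q^(k - rank))^t = B^(k - rank) matrices for each
      -- word.
      sum-of-kernels : (G : Code) → sumᴺ (map (λ c → B ^ defect G c) (allVectors N)) ≡
        sumᴺ (map (λ P → count (Kills? G P) (allVectors N)) (allFuns t (allVectors k)))
      sum-of-kernels G = trans (sym (sum-map-cong per-word (allVectors N)))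
        (double-counting (λ c P → Kills? G P c) (allVectors N) (allFuns t (allVectors k)))
        where
        per-word : ∀ c → count (λ P → Kills? G P c) (allFuns t (allVectors k)) ≡ B ^ defect G c
        per-word c = begin
          count (λ P → Kills? G P c) (allFuns t (allVectors k))
            ≡⟨ count-allFuns (allVectors k) (λ v → action G c v ≗? 𝟎) t (λ P → Kills? G P c) id id ⟩
          count (λ v → action G c v ≗? 𝟎) (allVectors k) ^ t
            ≡⟨ cong (_^ t) (kernel-count (X ᵀ)) ⟩
          (q ^ (k ∸ rank (X ᵀ))) ^ t
            ≡⟨ ℕ.^-*-assoc q (k ∸ rank (X ᵀ)) t ⟩
          q ^ ((k ∸ rank (X ᵀ)) ℕ.* t)
            ≡⟨ cong (q ^_) (ℕ.*-comm (k ∸ rank (X ᵀ)) t) ⟩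
          q ^ (t ℕ.* (k ∸ rank (X ᵀ)))
            ≡⟨ ℕ.^-*-assoc q t (k ∸ rank (X ᵀ)) ⟨
          B ^ (k ∸ rank (X ᵀ))
            ≡⟨ cong (λ r → B ^ (k ∸ r)) (rank-ᵀ X) ⟩
          B ^ (k ∸ rank X) ∎
          where
          open ≡-Reasoning
          X = matComb c G

      rank-distribution : (G G′ : Code) → MinRank d G → MinRank d G′ → ∀ {i} → i ≤ k →
        count (λ c → rank (matComb c G) ℕ.≟ i) (allVectors N) ≡
        count (λ c → rank (matComb c G′) ℕ.≟ i) (allVectors N)
      rank-distribution G G′ mr mr′ {i} i≤k = trans (to-defect G) (trans
        (digits-determined B {{ℕ.m^n≢0 q t}} (suc k) (defect G) (defect G′) (allVectors N) (allVectors N)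
          small small (λ c → s≤s (ℕ.m∸n≤m k (rank (matComb c G))))
          (λ c → s≤s (ℕ.m∸n≤m k (rank (matComb c G′)))) sums (s≤s (ℕ.m∸n≤m k i)))
        (sym (to-defect G′)))
        where
        small : length (allVectors N) < B
        small = subst (_< B) (sym (length-allVectors N)) (ℕ.^-monoʳ-< q 2≤q (ℕ.n<1+n N))

        sums : sumᴺ (map (λ c → B ^ defect G c) (allVectors N)) ≡
               sumᴺ (map (λ c → B ^ defect G′ c) (allVectors N))
        sums = trans (sum-of-kernels G) (trans (sum-map-cong (λ P → ℕ.≤-antisym
          (count-kills-≤ G G′ mr mr′ P) (count-kills-≤ G′ G mr′ mr P)) (allFuns t (allVectors k)))
          (sym (sum-of-kernels G′)))

        to-defect : ∀ H → count (λ c → rank (matComb c H) ℕ.≟ i) (allVectors N) ≡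
                    count (λ c → defect H c ℕ.≟ (k ∸ i)) (allVectors N)
        -- The digits are indexed by k - rank; both `i` and the ranks are at most k, so truncated
        -- subtraction from k loses nothing.
        to-defect H = count-≐ (λ c → rank (matComb c H) ℕ.≟ i) (λ c → defect H c ℕ.≟ (k ∸ i))
          (cong (k ∸_)) (λ {c} → ℕ.∸-cancelˡ-≡ (rank-≤-cols (matComb c H)) i≤k) (allVectors N)

-- Distances between lifted matrices, and the augmented code.

module Lifting {q} (F : FiniteField q) where

  open Counting
  open import Data.Bool as Bool using (true; T; if_then_else_)
  open import Data.Bool.Properties using (T-≡)
  open import Data.Nat using (_^_)
  open import Data.List.Properties using (length-map; length-++)
  open import Data.List.Membership.Propositional.Properties using (∈-lookup)
  open import Data.Product using (_×_; swap)
  open import Relation.Nullary.Decidable using (⌊_⌋)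
  open import Relation.Binary.PropositionalEquality

  open FiniteField F
  open LinAlg F
  open Rank F
  open Weight F

  _⊖_ : ∀ {a b} → Matrix a b → Matrix a b → Matrix a b
  (M ⊖ N) i j = M i j - N i j

  inSpan⇒ : ∀ {a b} (v : Vector b) (M : Matrix a b) → inSpan v M ≡ true → InSpan v M
  inSpan⇒ {a} v M e = Any.satisfied (Any.map found (Any.map⁻ (Any.any⁻ (eqV v) (rowSpace M) (Equivalence.from T-≡ e))))
    where
    found : ∀ {c} → T (eqV v (c ⊙ M)) → v ≗ c ⊙ M
    found {c} t with Fin.all? (λ j → v j Fin.≟ (c ⊙ M) j)
    ... | yes h = h

  inSpan⇐ : ∀ {a b} {v : Vector b} {M : Matrix a b} → InSpan v M → inSpan v M ≡ true
  inSpan⇐ {a} {v = v} {M} (c , h) = Equivalence.to T-≡ (Any.any⁺ (eqV v) (Any.map⁺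
    (Any.map (λ e → holds (λ j → trans (h j) (⊙-congˡ M e j))) (allVectors-complete c))))
    where
    holds : ∀ {d} → v ≗ d ⊙ M → T (eqV v (d ⊙ M))
    holds {d} e with Fin.all? (λ j → v j Fin.≟ (d ⊙ M) j)
    ... | yes _ = _
    ... | no ¬e = ¬e e

  span-closed : ∀ {a b s} (M : Matrix a b) (W : Matrix s b) → (∀ i → InSpan (W i) M) → ∀ c → InSpan (c ⊙ W) M
  span-closed M W h c = c ⊙ X , λ j → trans (⊙-congʳ c (λ i → proj₂ (h i)) j) (sym (⊙-⊗ c X M j))
    where
    X : Matrix _ _
    X i = proj₁ (h i)

  -- The intersection enters as the row space of a list of its vectors. Any function into F^r that
  -- separates its points bounds its dimension; `g` may use the proofs of membership in both spaces.
  dimIntersection-≤ : ∀ {a a′ b r} (U : Matrix a b) (V : Matrix a′ b)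
    (g : ∀ w → InSpan w U → InSpan w V → Vector r) →
    (∀ {w w′} (u : InSpan w U) (v : InSpan w V) (u′ : InSpan w′ U) (v′ : InSpan w′ V) →
       g w u v ≗ g w′ u′ v′ → w ≗ w′) →
    dimIntersection U V ≤ r
  dimIntersection-≤ U V g faithful = rank-≤ W (λ c → g (c ⊙ W) (inU c) (inV c))
    (λ {c} {d} → faithful (inU c) (inV c) (inU d) (inV d))
    where
    P? = λ v → inSpan v V Bool.≟ true
    vs : List (Vector _)
    vs = filter P? (rowSpace U)
    W = listMatrix vs

    inU : ∀ c → InSpan (c ⊙ W) U
    inU = span-closed U W λ i → All.lookup (All.filter⁺ P? rows-in-span) (∈-lookup i)
      where
      rows-in-span : All (λ w → InSpan w U) (rowSpace U)
      rows-in-span = All.map⁺ (All.universal (λ c → c , λ _ → refl) (allVectors _))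

    inV : ∀ c → InSpan (c ⊙ W) V
    inV = span-closed V W λ i → inSpan⇒ (W i) V (All.lookup (All.all-filter P? (rowSpace U)) (∈-lookup i))

  -- Both orders are kept because `dimIntersection` filters the vectors of its first argument and so
  -- is not symmetric by definition, while a code asks about every ordered pair.
  Apart : ∀ {k n} → ℕ → Matrix k n → Matrix k n → Set
  Apart δ U V = 2 ℕ.* δ ≤ subspaceDist U V × 2 ℕ.* δ ≤ subspaceDist V U

  apart : ∀ {k n δ} (U V : Matrix k n) → rank U ≡ k → rank V ≡ k → ∀ r → r ℕ.+ δ ≤ k →
          dimIntersection U V ≤ r → dimIntersection V U ≤ r → Apart δ U V
  apart {k} {δ = δ} U V rU rV r r+δ UV VU = far U V rU rV UV , far V U rV rU VU
    where
    far : ∀ U V → rank U ≡ k → rank V ≡ k → dimIntersection U V ≤ r → 2 ℕ.* δ ≤ subspaceDist U V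
    far U V rU rV le = begin
      2 ℕ.* δ                                       ≡⟨ ℕ.m+n∸m≡n (2 ℕ.* r) (2 ℕ.* δ) ⟨
      2 ℕ.* r ℕ.+ 2 ℕ.* δ ∸ 2 ℕ.* r                 ≡⟨ cong (_∸ 2 ℕ.* r) (ℕ.*-distribˡ-+ 2 r δ) ⟨
      2 ℕ.* (r ℕ.+ δ) ∸ 2 ℕ.* r                     ≤⟨ ℕ.∸-mono (ℕ.*-monoʳ-≤ 2 r+δ) (ℕ.*-monoʳ-≤ 2 le) ⟩
      2 ℕ.* k ∸ 2 ℕ.* dimIntersection U V           ≡⟨ cong (_∸ 2 ℕ.* dimIntersection U V)
                                                         (cong₂ ℕ._+_ (sym rU) (trans (ℕ.+-identityʳ k) (sym rV))) ⟩
      subspaceDist U V                              ∎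
      where open ℕ.≤-Reasoning

  -- U carries an identity matrix in the columns picked by s.
  Systematic : ∀ {k n} → (Fin k → Fin n) → Matrix k n → Set
  Systematic s U = ∀ i j → U i (s j) ≡ unit i j

  module _ {k n} (s : Fin k → Fin n) where

    systematic-⊙ : (U : Matrix k n) → Systematic s U → ∀ u → (u ⊙ U) ∘ s ≗ u
    systematic-⊙ U sys u j = trans (⊙-sum u U (s j)) (trans
      (sum-cong-≗ (λ i → cong (u i *_) (sys i j))) (trans (sym (⊙-sum u unit j)) (⊙-unit u j)))

    systematic-span : (U : Matrix k n) → Systematic s U → ∀ {w} → InSpan w U → w ≗ (w ∘ s) ⊙ U
    systematic-span U sys {w} (u , h) j = trans (h j) (⊙-congˡ U (λ i →
      sym (trans (h (s i)) (systematic-⊙ U sys u i))) j)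

    systematic-rank : (U : Matrix k n) → Systematic s U → rank U ≡ k
    systematic-rank U sys = LI-rank λ c h i → trans (sym (systematic-⊙ U sys c i)) (h (s i))

    -- A common vector w has the same coefficients `w ∘ s` with respect to `U` and to `V`, so these
    -- coefficients lie in the kernel of U - V.
    systematic-intersection : (U V : Matrix k n) → Systematic s U → Systematic s V →
      dimIntersection U V ≤ k ∸ rank (U ⊖ V)
    systematic-intersection U V sysU sysV = subst (dimIntersection U V ≤_) e≡
      (dimIntersection-≤ U V (λ w u v → proj₁ (coords u v)) λ {w} {w′} u v u′ v′ e j →
        trans (systematic-span U sysU u j) (trans
          (⊙-congˡ U (λ i → trans (proj₂ (coords u v) i) (trans (⊙-congˡ K e i) (sym (proj₂ (coords u′ v′) i)))) j)
          (sym (systematic-span U sysU u′ j))))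
      where
      kernel = kernel-basis (U ⊖ V)
      K = proj₁ (proj₂ kernel)
      spans = proj₂ (proj₂ (proj₂ (proj₂ (proj₂ kernel))))
      e≡ : proj₁ kernel ≡ k ∸ rank (U ⊖ V)
      e≡ = trans (sym (ℕ.m+n∸n≡m _ (rank (U ⊖ V)))) (cong (_∸ rank (U ⊖ V)) (proj₁ (proj₂ (proj₂ kernel))))
      coords : ∀ {w} → InSpan w U → InSpan w V → InSpan (w ∘ s) K
      coords {w} u v = spans λ j → trans (⊙--ᴹ (w ∘ s) U V j) (trans (cong₂ _-_
        (sym (systematic-span U sysU u j)) (sym (systematic-span V sysV v j))) (-‿inverseʳ (w j)))

  rank-⊖-sym : ∀ {a b} (M N : Matrix a b) → rank (M ⊖ N) ≤ rank (N ⊖ M)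
  rank-⊖-sym M N = rank-mono-kernel (M ⊖ N) (N ⊖ M) λ c h j → trans (⊙--ᴹ c M N j)
    (trans (cong (λ x → (c ⊙ M) j - x) (x∙y⁻¹≈ε⇒x≈y _ _ (trans (sym (⊙--ᴹ c N M j)) (h j)))) (-‿inverseʳ _))

  systematic-apart : ∀ {k n δ} (s : Fin k → Fin n) (U V : Matrix k n) →
    Systematic s U → Systematic s V → δ ≤ rank (U ⊖ V) → Apart δ U V
  systematic-apart {k} {δ = δ} s U V sysU sysV δ≤ = apart U V (systematic-rank s U sysU) (systematic-rank s V sysV)
    (k ∸ δ) (ℕ.≤-reflexive (ℕ.m∸n+n≡m δ≤k))
    (ℕ.≤-trans (systematic-intersection s U V sysU sysV) (ℕ.∸-monoʳ-≤ k δ≤))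
    (ℕ.≤-trans (systematic-intersection s V U sysV sysU) (ℕ.∸-monoʳ-≤ k (ℕ.≤-trans δ≤ (rank-⊖-sym U V))))
    where
    δ≤k : δ ≤ k
    δ≤k = ℕ.≤-trans δ≤ (rank-≤ (U ⊖ V) id (⊙-congˡ (U ⊖ V)))

  -- A common vector w is determined by its entries at `s`, where `U` is systematic. As a member of
  -- the row space of `V`, those entries are `w ∘ s′` times the block of `V` at `s`, so they pass
  -- through only as many coordinates as that block has rank.
  mixed-apart : ∀ {k n δ} (s s′ : Fin k → Fin n) (U V : Matrix k n) → Systematic s U → Systematic s′ V →
    rank {k} {k} (λ i j → V i (s j)) ℕ.+ δ ≤ k → Apart δ U V
  mixed-apart {k} {δ = δ} s s′ U V sysU sysV low = apart U V (systematic-rank s U sysU) (systematic-rank s′ V sysV)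
    (rank V₁) low
    (dimIntersection-≤ U V (λ w _ _ → g w) (λ u v u′ v′ → faithful u v u′ v′))
    (dimIntersection-≤ V U (λ w _ _ → g w) (λ v u v′ u′ → faithful u v u′ v′))
    where
    V₁ : Matrix k k
    V₁ i j = V i (s j)
    open Basis (rank-basis V₁)
    g : Vector _ → Vector (rank V₁)
    g w = (w ∘ s′) ⊙ C
    project : ∀ {w} → InSpan w V → w ∘ s ≗ g w ⊙ rows
    project {w} v j = trans (systematic-span s′ V sysV v (s j)) (C-faithful (w ∘ s′) j)
    faithful : ∀ {w w′} → InSpan w U → InSpan w V → InSpan w′ U → InSpan w′ V → g w ≗ g w′ → w ≗ w′
    faithful u v u′ v′ e j = trans (systematic-span s U sysU u j) (trans
      (⊙-congˡ U (λ i → trans (project v i) (trans (⊙-congˡ rows e i) (sym (project v′ i)))) j)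
      (sym (systematic-span s U sysU u′ j)))

  minRank-separates : ∀ {N a b δ} {G : Fin N → Matrix a b} → MinRank δ G → ∀ {c c′} →
    (∃ λ i → c i ≢ c′ i) → δ ≤ rank (matComb c G ⊖ matComb c′ G)
  minRank-separates {δ = δ} {G} mr {c} {c′} (i , c≢c′) = ℕ.≮⇒≥ λ low →
    c≢c′ (x∙y⁻¹≈ε⇒x≈y _ _ (mr (λ t → c t - c′ t)
      (subst (_< δ) (rank-cong (λ i j → sym (⊙-- c c′ (λ t → G t i) j))) low) i))

  module _ {k n : ℕ} (2k≤n : 2 ℕ.* k ≤ n) where

    private
      m : ℕ
      m = n ∸ k

      k≤n : k ≤ n
      k≤n = ℕ.≤-trans (ℕ.m≤m+n k _) 2k≤n

      k≤m : k ≤ m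
      k≤m = ℕ.m+n≤o⇒m≤o∸n k (subst (λ x → k ℕ.+ x ≤ n) (ℕ.+-identityʳ k) 2k≤n)

      -- Column positions: `left` and `right` are the two blocks of (I | A), while `start` and `end`
      -- are the two blocks of (Z | I).
      left : Fin k → Fin n
      left j = Fin.inject≤ j k≤n

      right : Fin m → Fin n
      right j = Fin.fromℕ< {k ℕ.+ toℕ j} (subst (k ℕ.+ toℕ j <_) (ℕ.m+[n∸m]≡n k≤n) (ℕ.+-monoʳ-< k (Fin.toℕ<n j)))

      toℕ-left : ∀ j → toℕ (left j) ≡ toℕ j
      toℕ-left j = Fin.toℕ-inject≤ j k≤n

      toℕ-right : ∀ j → toℕ (right j) ≡ k ℕ.+ toℕ j
      toℕ-right j = Fin.toℕ-fromℕ< _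

      end : Fin k → Fin n
      end j = Fin.fromℕ< {m ℕ.+ toℕ j} (subst (m ℕ.+ toℕ j <_) (ℕ.m∸n+n≡m k≤n) (ℕ.+-monoʳ-< m (Fin.toℕ<n j)))

      start : Fin m → Fin n
      start j = Fin.inject≤ j (ℕ.m∸n≤m n k)

    lift-systematic : (A : Matrix k m) → Systematic left (lift A)
    lift-systematic A i j with toℕ (left j) ℕ.<? k
    ... | no ≮k = contradiction (subst (_< k) (sym (toℕ-left j)) (Fin.toℕ<n j)) ≮k
    ... | yes _ with toℕ i ℕ.≟ toℕ (left j) | i Fin.≟ j
    ...   | yes _ | yes _   = refl
    ...   | no _  | no _    = refl
    ...   | yes e | no i≢j  = contradiction (Fin.toℕ-injective (trans e (toℕ-left j))) i≢j
    ...   | no ≢  | yes i≡j = contradiction (trans (cong toℕ i≡j) (sym (toℕ-left j))) ≢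

    lift-right : (A : Matrix k m) → ∀ i j → lift A i (right j) ≡ A i j
    lift-right A i j with toℕ (right j) ℕ.<? k
    ... | yes <k = contradiction <k (ℕ.≤⇒≯ (subst (k ≤_) (sym (toℕ-right j)) (ℕ.m≤m+n k _)))
    ... | no _ = cong (A i) (Fin.toℕ-injective (trans (Fin.toℕ-fromℕ< _)
        (trans (cong (_∸ k) (toℕ-right j)) (ℕ.m+n∸m≡n k (toℕ j)))))

    -- generator matrix (Z | I_k)
    colift : Matrix k m → Matrix k n
    colift Z i j with toℕ j ℕ.<? m
    ... | yes j<m = Z i (Fin.fromℕ< j<m)
    ... | no  _   = if ⌊ m ℕ.+ toℕ i ℕ.≟ toℕ j ⌋ then 1F else 0F

    colift-systematic : (Z : Matrix k m) → Systematic end (colift Z)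
    colift-systematic Z i j with toℕ (end j) ℕ.<? m
    ... | yes <m = contradiction <m (ℕ.≤⇒≯ (subst (m ≤_) (sym (Fin.toℕ-fromℕ< _)) (ℕ.m≤m+n m _)))
    ... | no _ with m ℕ.+ toℕ i ℕ.≟ toℕ (end j) | i Fin.≟ j
    ...   | yes _ | yes _   = refl
    ...   | no _  | no _    = refl
    ...   | yes e | no i≢j  = contradiction (Fin.toℕ-injective (ℕ.+-cancelˡ-≡ m _ _ (trans e (Fin.toℕ-fromℕ< _)))) i≢j
    ...   | no ≢  | yes i≡j = contradiction (trans (cong (λ i → m ℕ.+ toℕ i) i≡j) (sym (Fin.toℕ-fromℕ< _))) ≢

    colift-inject : (Z : Matrix k m) → ∀ i (j : Fin n) (l : Fin m) → toℕ j ≡ toℕ l → colift Z i j ≡ Z i l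
    colift-inject Z i j l e with toℕ j ℕ.<? m
    ... | yes _ = cong (Z i) (Fin.toℕ-injective (trans (Fin.toℕ-fromℕ< _) e))
    ... | no ≮m = contradiction (subst (_< m) (sym e) (Fin.toℕ<n l)) ≮m

    private
      rank-restrict : ∀ {b} (M : Matrix k n) (N : Matrix k b) (f : Fin b → Fin n) →
        (∀ i j → M i (f j) ≡ N i j) → rank N ≤ rank M
      rank-restrict M N f e = rank-mono-kernel N M λ c h j → trans (⊙-sum c N j)
        (trans (sum-cong-≗ (λ i → cong (c i *_) (sym (e i j)))) (trans (sym (⊙-sum c M (f j))) (h (f j))))

    lift-apart : ∀ {δ} (A B : Matrix k m) → δ ≤ rank (A ⊖ B) → Apart δ (lift A) (lift B)
    lift-apart A B δ≤ = systematic-apart left (lift A) (lift B) (lift-systematic A) (lift-systematic B)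
      (ℕ.≤-trans δ≤ (rank-restrict (lift A ⊖ lift B) (A ⊖ B) right
        (λ i j → cong₂ _-_ (lift-right A i j) (lift-right B i j))))

    colift-apart : ∀ {δ} (A B : Matrix k m) → δ ≤ rank (A ⊖ B) → Apart δ (colift A) (colift B)
    colift-apart A B δ≤ = systematic-apart end (colift A) (colift B) (colift-systematic A) (colift-systematic B)
      (ℕ.≤-trans δ≤ (rank-restrict (colift A ⊖ colift B) (A ⊖ B) start
        (λ i j → cong₂ _-_ (colift-inject A i (start j) j (Fin.toℕ-inject≤ j _))
                           (colift-inject B i (start j) j (Fin.toℕ-inject≤ j _)))))

    -- Since k ≤ n - k, the first k columns of (Z | I) all lie inside Z, so their rank is at most
    -- that of Z.
    lift-colift-apart : ∀ {δ} (A Z : Matrix k m) → rank Z ℕ.+ δ ≤ k → Apart δ (lift A) (colift Z)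
    lift-colift-apart {δ} A Z low = mixed-apart left end (lift A) (colift Z) (lift-systematic A) (colift-systematic Z)
      (ℕ.≤-trans (ℕ.+-monoˡ-≤ δ (rank-mono-kernel {k} {k} (λ i j → colift Z i (left j)) Z λ c h j →
        trans (⊙-sum c (λ i j → colift Z i (left j)) j) (trans
          (sum-cong-≗ (λ i → cong (c i *_) (colift-inject Z i (left j) (Fin.inject≤ j k≤m)
            (trans (toℕ-left j) (sym (Fin.toℕ-inject≤ j k≤m))))))
          (trans (sym (⊙-sum c Z (Fin.inject≤ j k≤m))) (h (Fin.inject≤ j k≤m)))))) low)

    augmented-code : ∀ {δ} (D : MRD k m δ) (Zs : List (Matrix k m)) →
      AllPairs (λ Z Z′ → δ ≤ rank (Z ⊖ Z′)) Zs → All (λ Z → rank Z ℕ.+ δ ≤ k) Zs →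
      Σ (CDC n (2 ℕ.* δ) k) λ C → ContainsLifted C D × CDC.size C ≡ q ^ mrdDim k m δ ℕ.+ length Zs
    augmented-code {δ} D Zs separated low = record
      { gens = gens
      ; fullRank = λ i → All.lookup ranks (∈-lookup i)
      ; distance = λ i j i≢j → proj₁ (AllPairs-lookup {S = Apart δ} swap distances i j i≢j) }
      , (λ A A∈ → let U∈ = Any.++⁺ˡ (Any.map⁺ (Any.map (λ { refl → self-span (lift A) }) A∈)) in
          Any.index U∈ , Any.lookup-index {P = λ U → SameSpace U (lift A)} U∈)
      , trans (length-++ (map lift (MRD.codewords D))) (cong₂ ℕ._+_
          (trans (length-map lift (MRD.codewords D)) (trans (length-map _ (allVectors (mrdDim k m δ)))
            (length-allVectors (mrdDim k m δ))))
          (length-map colift Zs))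
      where
      gens : List (Matrix k n)
      gens = map lift (MRD.codewords D) ++ map colift Zs

      self-span : (U : Matrix k n) → SameSpace U U
      self-span U = in-self , in-self
        where
        in-self : ∀ i → inSpan (U i) U ≡ true
        in-self i = inSpan⇐ {M = U} (unit i , λ j → sym (unit-⊙ i U j))

      ranks : All (λ U → rank U ≡ k) gens
      ranks = All.++⁺ (All.map⁺ (All.universal (λ A → systematic-rank left (lift A) (lift-systematic A)) (MRD.codewords D)))
                      (All.map⁺ (All.universal (λ Z → systematic-rank end (colift Z) (colift-systematic Z)) Zs))

      distances : AllPairs (Apart δ) gens
      distances = AllPairs.++⁺
        (AllPairs.map⁺ (AllPairs.map⁺ (AllPairs.map
          (λ {c} {c′} ne → lift-apart (matComb c (MRD.basis D)) (matComb c′ (MRD.basis D)) (minRank-separates {G = MRD.basis D} (mrd-minRank D) {c} {c′} ne))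
          (allVectors-unique (mrdDim k m δ)))))
        (AllPairs.map⁺ (AllPairs.map (λ {Z} {Z′} → colift-apart Z Z′) separated))
        (All.map⁺ (All.universal (λ A → All.map⁺ (All.map (λ {Z} → lift-colift-apart A Z) low)) (MRD.codewords D)))

-- Additivity of the p-power map in characteristic p.

module Frobenius {c ℓ} (R : CommutativeRing c ℓ) where

  import Data.Nat.Primality
  open import Data.Nat.Combinatorics using (_C_; nCn≡1; nC1≡n; nCk+nC[k+1]≡[n+1]C[k+1]; k>n⇒nCk≡0)
  open import Data.Nat.Divisibility using (_∣_; divides; ∣⇒≤; m∣m*n)
  open import Data.Nat.Primality using (Prime; euclidsLemma)
  open import Data.Nat.Tactic.RingSolver using (solve-∀)
  open import Data.Fin using (inject₁; fromℕ)
  open import Relation.Binary.PropositionalEquality as ≡ using (_≡_)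

  open CommutativeRing R hiding (zero)
  open import Algebra.Properties.Semiring.Sum semiring using (sum; sum-cong-≋; sum-init-last;
       sum-replicate-zero)
  open import Algebra.Properties.Semiring.Mult semiring using (_×_; ×-assocˡ; ×-congʳ; ×-assoc-*)
  open import Algebra.Properties.Semiring.Exp semiring using (_^_; ^-congˡ; ^-assocʳ)
  open import Algebra.Properties.CommutativeSemiring.Binomial commutativeSemiring using (theorem)
  open import Relation.Binary.Reasoning.Setoid setoid

  absorption : ∀ n k → suc k ℕ.* (suc n C suc k) ≡ suc n ℕ.* (n C k)
  absorption n zero = ≡.trans (≡.cong (1 ℕ.*_) (nC1≡n (suc n))) (ℕ.*-comm 1 (suc n))
  absorption zero (suc k) = ≡.trans (≡.cong (suc (suc k) ℕ.*_) (k>n⇒nCk≡0 {1} {suc (suc k)} (s≤s (s≤s z≤n))))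
    (ℕ.*-zeroʳ (suc (suc k)))
  absorption (suc n) (suc k) = ≡.trans
    (≡.cong (suc (suc k) ℕ.*_) (≡.sym (nCk+nC[k+1]≡[n+1]C[k+1] (suc n) (suc k))))
    (≡.trans (expand k (suc n C suc k) (suc n C suc (suc k)))
    (≡.trans (≡.cong₂ (λ x y → suc n C suc k ℕ.+ (x ℕ.+ y)) (absorption n k) (absorption n (suc k)))
    (≡.trans (collect n (suc n C suc k) (n C k) (n C suc k))
    (≡.cong (λ x → suc n C suc k ℕ.+ suc n ℕ.* x) (nCk+nC[k+1]≡[n+1]C[k+1] n k)))))
    where
    expand : ∀ k a b → suc (suc k) ℕ.* (a ℕ.+ b) ≡ a ℕ.+ (suc k ℕ.* a ℕ.+ suc (suc k) ℕ.* b)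
    expand = solve-∀
    collect : ∀ n a b d → a ℕ.+ (suc n ℕ.* b ℕ.+ suc n ℕ.* d) ≡ a ℕ.+ suc n ℕ.* (b ℕ.+ d)
    collect = solve-∀

  -- By `absorption` the prime divides the lower index times the binomial coefficient, and it cannot
  -- divide a positive index smaller than itself.
  prime∣binomial : ∀ {p k} → Prime (suc p) → suc k < suc p → suc p ∣ (suc p C suc k)
  prime∣binomial {p} {k} pr k<p
    with euclidsLemma (suc k) (suc p C suc k) pr (≡.subst (suc p ∣_) (≡.sym (absorption p k)) (m∣m*n (p C k)))
  ... | inj₁ p∣k = contradiction (∣⇒≤ p∣k) (ℕ.<⇒≱ k<p)
  ... | inj₂ p∣C = p∣C

  module _ {p} (prime : Prime p) (char : p × 1# ≈ 0#) where

    private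
      p×≈0 : ∀ x → p × x ≈ 0#
      p×≈0 x = begin
        p × x         ≈⟨ ×-congʳ p (*-identityˡ x) ⟨
        p × (1# * x)  ≈⟨ ×-assoc-* p 1# x ⟨
        (p × 1#) * x  ≈⟨ *-congʳ char ⟩
        0# * x        ≈⟨ zeroˡ x ⟩
        0#            ∎

      multiple : ∀ {n} x → p ∣ n → n × x ≈ 0#
      multiple x (divides d ≡.refl) = begin
        (d ℕ.* p) × x  ≡⟨ ≡.cong (_× x) (ℕ.*-comm d p) ⟩
        (p ℕ.* d) × x  ≈⟨ ×-assocˡ x p d ⟨
        p × (d × x)    ≈⟨ p×≈0 (d × x) ⟩
        0#             ∎

    freshman : ∀ x y → (x + y) ^ p ≈ x ^ p + y ^ p
    freshman x y = go p prime multiple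
      where
      go : ∀ p → Prime p → (∀ {n} x → p ∣ n → n × x ≈ 0#) → (x + y) ^ p ≈ x ^ p + y ^ p
      go zero pr _ = contradiction pr (λ { (Data.Nat.Primality.prime {{()}} _) })
      go (suc p′) pr mult = begin
        (x + y) ^ suc p′                                    ≈⟨ theorem (suc p′) x y ⟩
        term zero + sum (term ∘ suc)                        ≈⟨ +-cong first (sum-init-last (term ∘ suc)) ⟩
        y ^ suc p′ + (sum (term ∘ suc ∘ inject₁) + term (suc (fromℕ p′)))
                                                            ≈⟨ +-congˡ (+-cong (trans (sum-cong-≋ middle) (sum-replicate-zero p′)) last) ⟩
        y ^ suc p′ + (0# + x ^ suc p′)                      ≈⟨ +-congˡ (+-identityˡ _) ⟩
        y ^ suc p′ + x ^ suc p′                             ≈⟨ +-comm _ _ ⟩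
        x ^ suc p′ + y ^ suc p′                             ∎
        where
        term : Fin (suc (suc p′)) → Carrier
        term k = (suc p′ C toℕ k) × (x ^ toℕ k * y ^ (suc p′ ∸ toℕ k))

        first : term zero ≈ y ^ suc p′
        first = trans (+-identityʳ _) (*-identityˡ _)

        middle : ∀ i → term (suc (inject₁ i)) ≈ 0#
        middle i = mult _ (prime∣binomial pr (s≤s (≡.subst (_< p′) (≡.sym (Fin.toℕ-inject₁ i)) (Fin.toℕ<n i))))

        last : term (suc (fromℕ p′)) ≈ x ^ suc p′
        last = begin
          term (suc (fromℕ p′))
            ≡⟨ ≡.cong (λ k → (suc p′ C k) × (x ^ k * y ^ (suc p′ ∸ k))) (≡.cong suc (Fin.toℕ-fromℕ p′)) ⟩
          (suc p′ C suc p′) × (x ^ suc p′ * y ^ (p′ ∸ p′))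
            ≡⟨ ≡.cong₂ (λ a b → a × (x ^ suc p′ * y ^ b)) (nCn≡1 (suc p′)) (ℕ.n∸n≡0 p′) ⟩
          x ^ suc p′ * 1# + 0#   ≈⟨ +-identityʳ _ ⟩
          x ^ suc p′ * 1#        ≈⟨ *-identityʳ _ ⟩
          x ^ suc p′             ∎

    freshman^ : ∀ e x y → (x + y) ^ (p ℕ.^ e) ≈ x ^ (p ℕ.^ e) + y ^ (p ℕ.^ e)
    freshman^ zero    x y = trans (*-identityʳ _) (sym (+-cong (*-identityʳ _) (*-identityʳ _)))
    freshman^ (suc e) x y = begin
      (x + y) ^ (p ℕ.* p ℕ.^ e)                       ≈⟨ ^-assocʳ (x + y) p (p ℕ.^ e) ⟨
      ((x + y) ^ p) ^ (p ℕ.^ e)                       ≈⟨ ^-congˡ (p ℕ.^ e) (freshman x y) ⟩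
      (x ^ p + y ^ p) ^ (p ℕ.^ e)                     ≈⟨ freshman^ e (x ^ p) (y ^ p) ⟩
      (x ^ p) ^ (p ℕ.^ e) + (y ^ p) ^ (p ℕ.^ e)       ≈⟨ +-cong (^-assocʳ x p (p ℕ.^ e)) (^-assocʳ y p (p ℕ.^ e)) ⟩
      x ^ (p ℕ.* p ℕ.^ e) + y ^ (p ℕ.* p ℕ.^ e)       ∎

-- Characteristic of F and Fermat's little theorem.

module FieldFacts {q} (F : FiniteField q) where

  import Data.Fin.Permutation as Perm
  open import Relation.Binary.PropositionalEquality
  open Rank F
  open FiniteField F using (0F; 1F; 0≢1; inv)

  open CommutativeRing ring using (semiring; *-commutativeMonoid)
  open import Algebra.Properties.Semiring.Mult semiring using (_×_; ×1-homo-*)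
  open import Algebra.Properties.Semiring.Exp semiring using () renaming (_^_ to _^F_;
       ^-assocʳ to ^F-assocʳ) public
  open import Algebra.Properties.Monoid.Sum (CommutativeRing.+-monoid ring) using (sum-replicate)
  open import Algebra.Properties.Ring (CommutativeRing.ring ring) using (+-identityʳ-unique; //-rightDividesʳ)
  import Algebra.Properties.CommutativeMonoid.Sum
  private module Π = Algebra.Properties.CommutativeMonoid.Sum *-commutativeMonoid
  open Π using () renaming (sum to prod)

  no-zero-divisors : ∀ {x y} → x ≢ 0F → x * y ≡ 0F → y ≡ 0F
  no-zero-divisors {x} {y} x≢0 xy≡0 = let x⁻¹ , h = inv x x≢0 in begin
    y               ≡⟨ *-identityˡ y ⟨
    1F * y          ≡⟨ cong (_* y) (trans (sym h) (*-comm x x⁻¹)) ⟩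
    x⁻¹ * x * y     ≡⟨ *-assoc x⁻¹ x y ⟩
    x⁻¹ * (x * y)   ≡⟨ cong (x⁻¹ *_) xy≡0 ⟩
    x⁻¹ * 0F        ≡⟨ zeroʳ x⁻¹ ⟩
    0F              ∎
    where open ≡-Reasoning

  -- Translation by 1 permutes F, so adding 1 to each of the q elements leaves their sum unchanged.
  q×1≡0 : q × 1F ≡ 0F
  q×1≡0 = +-identityʳ-unique (sum id) (q × 1F) (begin
    sum id + q × 1F            ≡⟨ cong (sum {q} id +_) (sum-replicate q) ⟨
    sum id + sum {q} (λ _ → 1F) ≡⟨ ∑-distrib-+ id (λ _ → 1F) ⟨
    sum (λ x → x + 1F)         ≡⟨ sum-permute id translate ⟨
    sum id                     ∎)
    where
    open ≡-Reasoning
    translate : Perm.Permutation q q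
    translate = Perm.permutation (_+ 1F) (_- 1F) (//-rightDividesˡ 1F) (//-rightDividesʳ 1F)

  -- A power of p annihilates 1; without zero divisors, one of its factors p must already do so.
  characteristic : ∀ {p e} → q ≡ p ℕ.^ suc e → p × 1F ≡ 0F
  characteristic {p} {e} q≡ = root (suc e) (trans (cong (_× 1F) (sym q≡)) q×1≡0)
    where
    root : ∀ e → (p ℕ.^ e) × 1F ≡ 0F → p × 1F ≡ 0F
    root zero    h = contradiction (trans (sym h) (+-identityʳ 1F)) 0≢1
    root (suc e) h with (p × 1F) Fin.≟ 0F
    ... | yes z = z
    ... | no nz = root e (no-zero-divisors nz (trans (sym (×1-homo-* p (p ℕ.^ e))) h))

  if-zero : ∀ {n} {A : Set} → Fin n → Fin n → A → A → A
  if-zero i x a b with x Fin.≟ i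
  ... | yes _ = a
  ... | no  _ = b

  private
    prod-single : ∀ {n} (i : Fin n) c → prod (λ x → if-zero i x c 1F) ≡ c
    prod-single {suc n} zero c = trans (cong (c *_) (ones n)) (*-identityʳ c)
      where
      ones : ∀ n → prod {n} (λ _ → 1F) ≡ 1F
      ones n = Π.sum-replicate-zero n
    prod-single {suc n} (suc i) c = trans (*-identityˡ _) (trans (Π.sum-cong-≗ shift) (prod-single i c))
      where
      shift : ∀ x → if-zero (suc i) (suc x) c 1F ≡ if-zero i x c 1F
      shift x with x Fin.≟ i
      ... | yes _ = refl
      ... | no  _ = refl

    prod-nonzero : ∀ {n} (f : Fin n → Fin q) → (∀ i → f i ≢ 0F) → prod f ≢ 0F
    prod-nonzero {zero}  f nz e = 0≢1 (sym e)
    prod-nonzero {suc n} f nz e = prod-nonzero (f ∘ suc) (nz ∘ suc) (no-zero-divisors (nz zero) e)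

  -- For c ≠ 0, multiplication by c permutes the nonzero elements, so c^(q - 1) times their product
  -- equals their product.
  fermat : ∀ c → c ^F q ≡ c
  fermat c with c Fin.≟ 0F
  ... | yes refl = power q 2≤q
    where
    power : ∀ n → 2 ℕ.≤ n → 0F ^F n ≡ 0F
    power (suc n) _ = zeroˡ _
  ... | no c≢0 = begin
    c ^F q                ≡⟨ Π.sum-replicate q ⟨
    prod {q} (λ _ → c)    ≡⟨ Π.sum-cong-≗ (λ x → sym (split x)) ⟩
    prod (λ x → s x * k x) ≡⟨ Π.∑-distrib-+ s k ⟩
    prod s * prod k       ≡⟨ cong₂ _*_ (prod-single 0F c) prod-k≡1 ⟩
    c * 1F                ≡⟨ *-identityʳ c ⟩
    c                     ∎
    where
    open ≡-Reasoning
    -- Products run over all of F, so 0 needs neutral factors: `h` is the identity with 0 replaced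
    -- by 1, the product of `k` is c^(q - 1), and `s` supplies the one factor c that is missing at
    -- 0.
    h k s : Fin q → Fin q
    h x = if-zero 0F x 1F x
    k x = if-zero 0F x 1F c
    s x = if-zero 0F x c 1F

    split : ∀ x → s x * k x ≡ c
    split x with x Fin.≟ 0F
    ... | yes _ = *-identityʳ c
    ... | no  _ = *-identityˡ c

    h-scale : ∀ x → h (c * x) ≡ k x * h x
    h-scale x with x Fin.≟ 0F | (c * x) Fin.≟ 0F
    ... | yes _    | yes _  = sym (*-identityˡ 1F)
    ... | no _     | no _   = refl
    ... | yes refl | no ne  = contradiction (zeroʳ c) ne
    ... | no x≢0   | yes e  = contradiction (no-zero-divisors c≢0 e) x≢0

    c⁻¹ : Fin q
    c⁻¹ = proj₁ (inv c c≢0)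

    cc⁻¹ : c * c⁻¹ ≡ 1F
    cc⁻¹ = proj₂ (inv c c≢0)

    dilate : Perm.Permutation q q
    dilate = Perm.permutation (c *_) (c⁻¹ *_)
      (λ x → trans (sym (*-assoc c c⁻¹ x)) (trans (cong (_* x) cc⁻¹) (*-identityˡ x)))
      (λ x → trans (sym (*-assoc c⁻¹ c x)) (trans (cong (_* x) (trans (*-comm c⁻¹ c) cc⁻¹)) (*-identityˡ x)))

    H : Fin q
    H = prod h

    kH≡H : prod k * H ≡ H
    kH≡H = trans (sym (Π.∑-distrib-+ k h)) (trans (sym (Π.sum-cong-≗ h-scale)) (sym (Π.sum-permute h dilate)))

    H≢0 : H ≢ 0F
    H≢0 = prod-nonzero h nz
      where
      nz : ∀ x → h x ≢ 0F
      nz x e with x Fin.≟ 0F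
      ... | yes _  = 0≢1 (sym e)
      ... | no x≢0 = x≢0 e

    prod-k≡1 : prod k ≡ 1F
    prod-k≡1 = let H⁻¹ , e = inv H H≢0 in begin
      prod k                ≡⟨ *-identityʳ _ ⟨
      prod k * 1F           ≡⟨ cong (prod k *_) e ⟨
      prod k * (H * H⁻¹)    ≡⟨ *-assoc (prod k) H H⁻¹ ⟨
      prod k * H * H⁻¹      ≡⟨ cong (_* H⁻¹) kH≡H ⟩
      H * H⁻¹               ≡⟨ e ⟩
      1F                    ∎

  fermat^ : ∀ c e → c ^F (q ℕ.^ e) ≡ c
  fermat^ c zero    = *-identityʳ c
  fermat^ c (suc e) = trans (sym (^F-assocʳ c q (q ℕ.^ e))) (trans (cong (_^F (q ℕ.^ e)) (fermat c)) (fermat^ c e))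

-- The group algebra F[x]/(xⁿ − 1), n = suc n′, on coefficient vectors.
module CyclicAlgebra {q} (F : FiniteField q) (n′ : ℕ) where

  open import Data.Fin using (inject₁; fromℕ)
  open import Data.Product using (_×_)
  open import Relation.Binary.PropositionalEquality
  open import Algebra.Structures using (IsCommutativeRing)
  open Rank F
  open FieldFacts F
  open FiniteField F using (0F; 1F; 0≢1)
  open CommutativeRing ring using (semiring; +-commutativeSemigroup)
  open import Algebra.Properties.CommutativeSemigroup +-commutativeSemigroup using (interchange)
  open import Algebra.Properties.CommutativeSemigroup (CommutativeRing.*-commutativeSemigroup ring)
    using (x∙yz≈y∙xz)
  open import Algebra.Properties.Semiring.Mult semiring using () renaming (_×_ to _×F_)

  private
    n : ℕ
    n = suc n′

    V : Set
    V = Fin n → Fin q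

  infixl 6 _⊞_
  infixl 7 _·_ _⊛_

  _⊞_ : V → V → V
  (u ⊞ v) i = u i + v i

  _·_ : Fin q → V → V
  (c · v) i = c * v i

  -- Multiplication by x; the shift of coefficients is cyclic because xⁿ = 1.
  T : V → V
  T v zero    = v (fromℕ n′)
  T v (suc i) = v (inject₁ i)

  T-cong : ∀ {u v} → u ≗ v → T u ≗ T v
  T-cong h zero    = h (fromℕ n′)
  T-cong h (suc i) = h (inject₁ i)

  T-⊞ : ∀ u v → T (u ⊞ v) ≗ T u ⊞ T v
  T-⊞ u v zero    = refl
  T-⊞ u v (suc i) = refl

  T-· : ∀ c v → T (c · v) ≗ c · T v
  T-· c v zero    = refl
  T-· c v (suc i) = refl

  -- poly f v = f(T) v
  poly : ∀ {l} → (Fin l → Fin q) → V → V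
  poly {zero}  f v = 𝟎
  poly {suc l} f v = f zero · v ⊞ T (poly (f ∘ suc) v)

  poly-cong : ∀ {l} {f g : Fin l → Fin q} {u v} → f ≗ g → u ≗ v → poly f u ≗ poly g v
  poly-cong {zero}  h k i = refl
  poly-cong {suc l} h k i = cong₂ _+_ (cong₂ _*_ (h zero) (k i)) (T-cong (poly-cong (h ∘ suc) k) i)

  poly-⊞ : ∀ {l} (f : Fin l → Fin q) u v → poly f (u ⊞ v) ≗ poly f u ⊞ poly f v
  poly-⊞ {zero}  f u v i = sym (+-identityˡ 0F)
  poly-⊞ {suc l} f u v i = trans (cong₂ _+_ (distribˡ (f zero) (u i) (v i))
      (trans (T-cong (poly-⊞ (f ∘ suc) u v) i) (T-⊞ (poly (f ∘ suc) u) (poly (f ∘ suc) v) i)))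
    (interchange (f zero * u i) (f zero * v i) _ _)

  poly-· : ∀ {l} (f : Fin l → Fin q) c v → poly f (c · v) ≗ c · poly f v
  poly-· {zero}  f c v i = sym (zeroʳ c)
  poly-· {suc l} f c v i = trans (cong₂ _+_ (x∙yz≈y∙xz (f zero) c (v i))
      (trans (T-cong (poly-· (f ∘ suc) c v) i) (T-· c (poly (f ∘ suc) v) i)))
    (sym (distribˡ c _ _))

  poly-T : ∀ {l} (f : Fin l → Fin q) v → poly f (T v) ≗ T (poly f v)
  poly-T {zero}  f v zero    = refl
  poly-T {zero}  f v (suc i) = refl
  poly-T {suc l} f v i = trans (cong₂ _+_ (sym (T-· (f zero) v i)) (T-cong (poly-T (f ∘ suc) v) i))
    (sym (T-⊞ (f zero · v) (T (poly (f ∘ suc) v)) i))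

  poly-𝟎 : ∀ {l} (f : Fin l → Fin q) → poly f 𝟎 ≗ 𝟎
  poly-𝟎 f i = trans (poly-cong {f = f} (λ _ → refl) (λ j → sym (zeroˡ 0F)) i)
    (trans (poly-· f 0F 𝟎 i) (zeroˡ _))

  -- Polynomials in one operator commute. Together with `poly-e₀`, this gives commutativity and
  -- associativity of the product without handling convolution sums.
  poly-commutes : ∀ {l l′} (f : Fin l → Fin q) (g : Fin l′ → Fin q) v → poly f (poly g v) ≗ poly g (poly f v)
  poly-commutes {zero}  f g v i = sym (poly-𝟎 g i)
  poly-commutes {suc l} f g v i = sym (trans (poly-⊞ g (f zero · v) (T (poly (f ∘ suc) v)) i)
    (cong₂ _+_ (poly-· g (f zero) v i) (trans (poly-T g (poly (f ∘ suc) v) i)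
      (T-cong (λ j → sym (poly-commutes (f ∘ suc) g v j)) i))))

  e₀ : V
  e₀ zero    = 1F
  e₀ (suc i) = 0F

  -- Multiplication by powers of x does not wrap around below degree n.
  poly-e₀-low : ∀ {l} (f : Fin l → Fin q) → l ≤ n → ∀ i j → toℕ i ≡ toℕ j → poly f e₀ i ≡ f j
  poly-e₀-high : ∀ {l} (f : Fin l → Fin q) → l ≤ n → ∀ i → l ≤ toℕ i → poly f e₀ i ≡ 0F

  poly-e₀-low {suc l} f (s≤s l≤) zero zero e = trans (cong₂ _+_ (*-identityʳ (f zero))
    (poly-e₀-high (f ∘ suc) (ℕ.m≤n⇒m≤1+n l≤) (fromℕ n′) (subst (l ≤_) (sym (Fin.toℕ-fromℕ n′)) l≤)))
    (+-identityʳ (f zero))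
  poly-e₀-low {suc l} f (s≤s l≤) (suc i) (suc j) e = trans (cong₂ _+_ (zeroʳ (f zero))
    (poly-e₀-low (f ∘ suc) (ℕ.m≤n⇒m≤1+n l≤) (inject₁ i) j (trans (Fin.toℕ-inject₁ i) (ℕ.suc-injective e))))
    (+-identityˡ _)

  poly-e₀-high {zero}  f l≤ i h = refl
  poly-e₀-high {suc l} f (s≤s l≤) (suc i) (s≤s h) = trans (cong₂ _+_ (zeroʳ (f zero))
    (poly-e₀-high (f ∘ suc) (ℕ.m≤n⇒m≤1+n l≤) (inject₁ i) (subst (l ≤_) (sym (Fin.toℕ-inject₁ i)) h)))
    (+-identityˡ 0F)

  poly-e₀ : (f : V) → poly f e₀ ≗ f
  poly-e₀ f i = poly-e₀-low f ℕ.≤-refl i i refl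

  _⊛_ : V → V → V
  f ⊛ g = poly f g

  ⊛-comm : ∀ f g → f ⊛ g ≗ g ⊛ f
  ⊛-comm f g i = trans (poly-cong {f = f} (λ _ → refl) (λ j → sym (poly-e₀ g j)) i)
    (trans (poly-commutes f g e₀ i) (poly-cong {f = g} (λ _ → refl) (poly-e₀ f) i))

  ⊛-assoc : ∀ f g h → (f ⊛ g) ⊛ h ≗ f ⊛ (g ⊛ h)
  ⊛-assoc f g h i = begin
    poly (poly f g) h i   ≡⟨ ⊛-comm (poly f g) h i ⟩
    poly h (poly f g) i   ≡⟨ poly-commutes h f g i ⟩
    poly f (poly h g) i   ≡⟨ poly-cong {f = f} (λ _ → refl) (⊛-comm h g) i ⟩
    poly f (poly g h) i   ∎
    where open ≡-Reasoning

  isCommutativeRing : IsCommutativeRing (_≗_ {A = Fin n} {B = Fin q}) _⊞_ _⊛_ (λ v i → - v i) 𝟎 e₀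
  isCommutativeRing = record
    { isRing = record
      { +-isAbelianGroup = record
        { isGroup = record
          { isMonoid = record
            { isSemigroup = record
              { isMagma = record
                { isEquivalence = record
                  { refl = λ _ → refl ; sym = λ h i → sym (h i) ; trans = λ h k i → trans (h i) (k i) }
                ; ∙-cong = λ h k i → cong₂ _+_ (h i) (k i) }
              ; assoc = λ u v w i → +-assoc (u i) (v i) (w i) }
            ; identity = (λ v i → +-identityˡ (v i)) , (λ v i → +-identityʳ (v i)) }
          ; inverse = (λ v i → -‿inverseˡ (v i)) , (λ v i → -‿inverseʳ (v i))
          ; ⁻¹-cong = λ h i → cong -_ (h i) }
        ; comm = λ u v i → +-comm (u i) (v i) }
      ; *-cong = poly-cong
      ; *-assoc = ⊛-assoc
      ; *-identity = (λ f i → trans (⊛-comm e₀ f i) (poly-e₀ f i)) , poly-e₀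
      ; distrib = poly-⊞ , λ h f g i → trans (⊛-comm (f ⊞ g) h i)
          (trans (poly-⊞ h f g i) (cong₂ _+_ (⊛-comm h f i) (⊛-comm h g i))) }
    ; *-comm = ⊛-comm }

  algebra : CommutativeRing _ _
  algebra = record { isCommutativeRing = isCommutativeRing }

  module A = CommutativeRing algebra
  open import Algebra.Properties.Semiring.Exp A.semiring using (_^_; ^-congˡ)
  open import Algebra.Properties.CommutativeSemiring.Exp A.commutativeSemiring using (^-distrib-*)
  open import Algebra.Properties.Semiring.Mult A.semiring using () renaming (_×_ to _×ᴬ_)

  x : V
  x = T e₀

  x⊛ : ∀ v → x ⊛ v ≗ T v
  x⊛ v i = trans (⊛-comm x v i) (trans (poly-T v e₀ i) (T-cong (poly-e₀ v) i))

  ι : Fin q → V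
  ι c = c · e₀

  ι-cong : ∀ {c d} → c ≡ d → ι c ≗ ι d
  ι-cong refl _ = refl

  ι-⊛ : ∀ c v → ι c ⊛ v ≗ c · v
  ι-⊛ c v i = trans (⊛-comm (ι c) v i) (trans (poly-· v c e₀ i) (cong (c *_) (poly-e₀ v i)))

  ι-+ : ∀ c d → ι (c + d) ≗ ι c ⊞ ι d
  ι-+ c d i = distribʳ (e₀ i) c d

  ι-* : ∀ c d → ι (c * d) ≗ ι c ⊛ ι d
  ι-* c d i = trans (*-assoc c d (e₀ i)) (sym (ι-⊛ c (ι d) i))

  ι-1 : ι 1F ≗ e₀
  ι-1 i = *-identityˡ (e₀ i)

  ι-0 : ι 0F ≗ 𝟎
  ι-0 i = zeroˡ (e₀ i)

  ι-^ : ∀ c j → ι (c ^F j) ≗ ι c ^ j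
  ι-^ c zero    = ι-1
  ι-^ c (suc j) = A.trans (ι-* c (c ^F j)) (A.*-congˡ {ι c} (ι-^ c j))

  ι-× : ∀ j → j ×ᴬ e₀ ≗ ι (j ×F 1F)
  ι-× zero    i = sym (ι-0 i)
  ι-× (suc j) i = trans (cong₂ _+_ (sym (ι-1 i)) (ι-× j i)) (sym (ι-+ 1F (j ×F 1F) i))

  T^ : ℕ → V → V
  T^ zero    v = v
  T^ (suc a) v = T (T^ a v)

  x^⊛ : ∀ a v → x ^ a ⊛ v ≗ T^ a v
  x^⊛ zero    v = A.*-identityˡ v
  x^⊛ (suc a) v i = trans (A.*-assoc x (x ^ a) v i) (trans (x⊛ (x ^ a ⊛ v) i) (T-cong (x^⊛ a v) i))

  -- v has degree exactly w, with leading coefficient 1.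
  record Monic (w : ℕ) (v : V) : Set where
    field
      top   : ∀ i → toℕ i ≡ w → v i ≡ 1F
      above : ∀ i → w < toℕ i → v i ≡ 0F

  T-monic : ∀ {w v} → suc w < n → Monic w v → Monic (suc w) (T v)
  T-monic {w} {v} w<n mon = record
    { top = λ { (suc i) e → top (inject₁ i) (trans (Fin.toℕ-inject₁ i) (ℕ.suc-injective e)) }
    ; above = λ { (suc i) (s≤s h) → above (inject₁ i) (subst (w <_) (sym (Fin.toℕ-inject₁ i)) h) } }
    where open Monic mon

  T^-monic : ∀ a {w v} → a ℕ.+ w < n → Monic w v → Monic (a ℕ.+ w) (T^ a v)
  T^-monic zero    h mon = mon
  T^-monic (suc a) h mon = T-monic h (T^-monic a (ℕ.<-trans (ℕ.n<1+n _) h) mon)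

  -- The product is `T^ a v` minus `T v`. The first has the larger degree because a > 1, and a + w <
  -- n prevents wrap-around, so the leading coefficient 1 survives.
  x^-monic : ∀ a {w v} → 1 < a → a ℕ.+ w < n → Monic w v → Monic (a ℕ.+ w) ((x ^ a A.- x) ⊛ v)
  x^-monic a {w} {v} 1<a h mon = record
    { top = λ i e → trans (value i) (trans (cong₂ _-_ (Ta.top i e)
        (T1.above i (subst (suc w <_) (sym e) (ℕ.+-monoˡ-< w 1<a)))) 1-0)
    ; above = λ i lt → trans (value i) (trans (cong₂ _-_ (Ta.above i lt)
        (T1.above i (ℕ.<-trans (ℕ.+-monoˡ-< w 1<a) lt))) (-‿inverseʳ 0F)) }
    where
    module Ta = Monic (T^-monic a h mon)
    module T1 = Monic (T-monic (ℕ.<-trans (ℕ.+-monoˡ-< w 1<a) h) mon)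
    open import Algebra.Properties.Ring (CommutativeRing.ring algebra) using ()
      renaming ([y-z]x≈yx-zx to distribʳ--)
    value : ∀ i → ((x ^ a A.- x) ⊛ v) i ≡ T^ a v i - T v i
    value i = trans (distribʳ-- v (x ^ a) x i) (cong₂ _-_ (x^⊛ a v i) (x⊛ v i))
    1-0 : 1F - 0F ≡ 1F
    1-0 = trans (cong (1F +_) -0#≈0#) (+-identityʳ 1F)

  monic-nonzero : ∀ {w v} → w < n → Monic w v → ¬ (v ≗ 𝟎)
  monic-nonzero {w} w<n mon z = 0≢1 (trans (sym (z i)) (Monic.top mon i (Fin.toℕ-fromℕ< w<n)))
    where i = Fin.fromℕ< w<n

  x^n≗1 : x ^ n ≗ e₀
  x^n≗1 i = trans (sym (A.*-identityʳ (x ^ n) i)) (trans (x^⊛ n e₀ i) (wrap i))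
    where
    spread : ∀ a → a < n → ∀ i → (toℕ i ≡ a → T^ a e₀ i ≡ 1F) × (toℕ i ≢ a → T^ a e₀ i ≡ 0F)
    spread zero    _ zero    = (λ _ → refl) , λ ne → contradiction refl ne
    spread zero    _ (suc i) = (λ ()) , λ _ → refl
    spread (suc a) (s≤s a<) zero = (λ ()) , λ _ → proj₂ (spread a (ℕ.m≤n⇒m≤1+n a<) (fromℕ n′))
      (λ e → ℕ.<⇒≢ a< (sym (trans (sym (Fin.toℕ-fromℕ n′)) e)))
    spread (suc a) (s≤s a<) (suc i) =
      (λ e → proj₁ ih (trans (Fin.toℕ-inject₁ i) (ℕ.suc-injective e))) ,
      (λ ne → proj₂ ih (λ e → ne (cong suc (trans (sym (Fin.toℕ-inject₁ i)) e))))
      where ih = spread a (ℕ.m≤n⇒m≤1+n a<) (inject₁ i)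
    wrap : T (T^ n′ e₀) ≗ e₀
    wrap zero    = proj₁ (spread n′ ℕ.≤-refl (fromℕ n′)) (Fin.toℕ-fromℕ n′)
    wrap (suc i) = proj₂ (spread n′ ℕ.≤-refl (inject₁ i))
      (λ e → ℕ.<⇒≢ (subst (_< n′) (sym (Fin.toℕ-inject₁ i)) (Fin.toℕ<n i)) e)

  -- Every `v` is a polynomial in x over F, and the N-th power is additive, multiplicative and fixes
  -- both x and the coefficients.
  power-identity : ∀ N → (∀ u v → (u ⊞ v) ^ N ≗ u ^ N ⊞ v ^ N) → (∀ c → c ^F N ≡ c) → x ^ N ≗ x →
                   0 < N → ∀ v → v ^ N ≗ v
  power-identity N add fix xN (s≤s _) v = A.trans (^-congˡ N (A.sym (poly-e₀ v))) (A.trans (go v) (poly-e₀ v))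
    where
    go : ∀ {l} (f : Fin l → Fin q) → poly f e₀ ^ N ≗ poly f e₀
    go {zero}  f = A.zeroˡ _
    go {suc l} f = A.trans (add (ι (f zero)) (T (poly (f ∘ suc) e₀))) (A.+-cong
      (A.trans (A.sym (ι-^ (f zero) N)) (ι-cong (fix (f zero))))
      (A.trans (^-congˡ N (A.sym (x⊛ (poly (f ∘ suc) e₀))))
        (A.trans (^-distrib-* x (poly (f ∘ suc) e₀) N)
        (A.trans (A.*-cong xN (go (f ∘ suc))) (x⊛ (poly (f ∘ suc) e₀))))))

-- Idempotents of a periodic ring and the factors they cut out.

module Localisation (R : CommutativeRing 0ℓ 0ℓ) where

  open import Data.Product using (_×_)
  open import Relation.Binary using (Decidable)

  open CommutativeRing R
  open import Algebra.Properties.Semiring.Exp semiring using (_^_)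
  open import Algebra.Properties.CommutativeSemigroup *-commutativeSemigroup using (interchange; x∙yz≈y∙xz)
  open import Relation.Binary.Reasoning.Setoid setoid

  record Idempotent (e : Carrier) : Set where
    field
      idem    : e * e ≈ e
      nonzero : ¬ (e ≈ 0#)

  -- f ≤ e in the order of idempotents.
  _⊑_ : Carrier → Carrier → Set
  f ⊑ e = f * e ≈ f

  module _ (_≟_ : Decidable _≈_) (M : ℕ) (periodic : ∀ a → a * a ^ suc M ≈ a) where

    -- As a^(M + 2) = a, the power a^(M + 1) acts as 1 on a and hence on itself; it is the support
    -- idempotent of a.
    power-idem : ∀ a → a ^ suc M * a ^ suc M ≈ a ^ suc M
    power-idem a = begin
      a * a ^ M * a ^ suc M     ≈⟨ *-congʳ (*-comm a (a ^ M)) ⟩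
      a ^ M * a * a ^ suc M     ≈⟨ *-assoc (a ^ M) a (a ^ suc M) ⟩
      a ^ M * (a * a ^ suc M)   ≈⟨ *-congˡ (periodic a) ⟩
      a ^ M * a                 ≈⟨ *-comm (a ^ M) a ⟩
      a ^ suc M                 ∎

    -- One pass over the elements refines e until it cannot be split by any of them.
    refine : ∀ as e → Idempotent e → ∃ λ f → Idempotent f × f ⊑ e ×
             All (λ a → f * a ≈ 0# ⊎ f * a ^ suc M ≈ f) as
    refine [] e ie = e , ie , Idempotent.idem ie , []
    -- Either e misses the support of a, and then a vanishes below e, or e times that support is a
    -- smaller nonzero idempotent, below which a is invertible.
    refine (a ∷ as) e ie with (e * a ^ suc M) ≟ 0#
    ... | yes z with refine as e ie
    ...   | f , if , f⊑e , rest = f , if , f⊑e , inj₁ killed ∷ rest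
      where
      killed : f * a ≈ 0#
      killed = begin
        f * a                     ≈⟨ *-cong (sym f⊑e) (sym (periodic a)) ⟩
        f * e * (a * a ^ suc M)   ≈⟨ *-assoc f e _ ⟩
        f * (e * (a * a ^ suc M)) ≈⟨ *-congˡ (x∙yz≈y∙xz e a (a ^ suc M)) ⟩
        f * (a * (e * a ^ suc M)) ≈⟨ *-congˡ (*-congˡ z) ⟩
        f * (a * 0#)              ≈⟨ *-congˡ (zeroʳ a) ⟩
        f * 0#                    ≈⟨ zeroʳ f ⟩
        0#                        ∎
    refine (a ∷ as) e ie | no nz with refine as (e * a ^ suc M) record
      { idem = trans (interchange e (a ^ suc M) e (a ^ suc M)) (*-cong (Idempotent.idem ie) (power-idem a))
      ; nonzero = nz }
    ...   | f , if , f⊑ , rest = f , if , f⊑e , inj₂ kept ∷ rest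
      where
      u = a ^ suc M
      absorb : ∀ {v} → (e * u) * v ≈ e * u → f * v ≈ f
      absorb {v} h = begin
        f * v             ≈⟨ *-congʳ f⊑ ⟨
        f * (e * u) * v   ≈⟨ *-assoc f (e * u) v ⟩
        f * (e * u * v)   ≈⟨ *-congˡ h ⟩
        f * (e * u)       ≈⟨ f⊑ ⟩
        f                 ∎
      f⊑e : f * e ≈ f
      f⊑e = absorb (begin
        e * u * e    ≈⟨ *-comm (e * u) e ⟩
        e * (e * u)  ≈⟨ *-assoc e e u ⟨
        e * e * u    ≈⟨ *-congʳ (Idempotent.idem ie) ⟩
        e * u        ∎)
      kept : f * u ≈ f
      kept = absorb (trans (*-assoc e u u) (*-congˡ (power-idem a)))

  module _ {e : Carrier} (idem : e * e ≈ e) where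

    infix 4 _~_
    _~_ : Carrier → Carrier → Set
    x ~ y = e * x ≈ e * y

    ≈⇒~ : ∀ {x y} → x ≈ y → x ~ y
    ≈⇒~ = *-congˡ

    ~-*-cong : ∀ {x y u v} → x ~ y → u ~ v → x * u ~ y * v
    ~-*-cong {x} {y} {u} {v} h k = begin
      e * (x * u)         ≈⟨ *-congʳ idem ⟨
      e * e * (x * u)     ≈⟨ interchange e e x u ⟩
      e * x * (e * u)     ≈⟨ *-cong h k ⟩
      e * y * (e * v)     ≈⟨ interchange e y e v ⟩
      e * e * (y * v)     ≈⟨ *-congʳ idem ⟩
      e * (y * v)         ∎

    -- The factor e R, realised on R with the coarser equality x ~ y.
    localised : CommutativeRing 0ℓ 0ℓ
    localised = record
      { Carrier = Carrier ; _≈_ = _~_ ; _+_ = _+_ ; _*_ = _*_ ; -_ = -_ ; 0# = 0# ; 1# = 1#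
      ; isCommutativeRing = record
        { isRing = record
          { +-isAbelianGroup = record
            { isGroup = record
              { isMonoid = record
                { isSemigroup = record
                  { isMagma = record
                    { isEquivalence = record { refl = refl ; sym = sym ; trans = trans }
                    ; ∙-cong = λ {x} {y} {u} {v} h k →
                        trans (distribˡ e x u) (trans (+-cong h k) (sym (distribˡ e y v))) }
                  ; assoc = λ x y z → ≈⇒~ (+-assoc x y z) }
                ; identity = (λ x → ≈⇒~ (+-identityˡ x)) , (λ x → ≈⇒~ (+-identityʳ x)) }
              ; inverse = (λ x → ≈⇒~ (-‿inverseˡ x)) , (λ x → ≈⇒~ (-‿inverseʳ x))
              ; ⁻¹-cong = λ {x} {y} h → trans (sym (-‿distribʳ-* e x)) (trans (-‿cong h) (-‿distribʳ-* e y)) }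
            ; comm = λ x y → ≈⇒~ (+-comm x y) }
          ; *-cong = ~-*-cong
          ; *-assoc = λ x y z → ≈⇒~ (*-assoc x y z)
          ; *-identity = (λ x → ≈⇒~ (*-identityˡ x)) , (λ x → ≈⇒~ (*-identityʳ x))
          ; distrib = (λ x y z → ≈⇒~ (distribˡ x y z)) , (λ x y z → ≈⇒~ (distribʳ x y z)) }
        ; *-comm = λ x y → ≈⇒~ (*-comm x y) } }
      where open import Algebra.Properties.Ring (CommutativeRing.ring R) using (-‿distribʳ-*)

-- Polynomials over an integral domain have few roots.

module Roots (L : CommutativeRing 0ℓ 0ℓ) where

  open Counting using (cons; AllPairs-lookup)
  open import Data.Fin using (fromℕ)
  open import Data.List.Membership.Propositional.Properties using (∈-lookup)
  open import Relation.Binary.PropositionalEquality as ≡ using (_≡_; _≢_)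
  open CommutativeRing L hiding (zero)
  open import Algebra.Properties.Semiring.Exp semiring using (_^_; ^-congʳ)
  open import Algebra.Properties.Ring (CommutativeRing.ring L) using (x∙y⁻¹≈ε⇒x≈y; [y-z]x≈yx-zx;
       x≈y⇒x∙y⁻¹≈ε; -1*x≈-x)
  open import Algebra.Properties.CommutativeSemigroup *-commutativeSemigroup using (x∙yz≈y∙xz)
  open import Algebra.Properties.CommutativeSemigroup +-commutativeSemigroup using (interchange)
    renaming (x∙yz≈y∙xz to x+[y+z]≈y+[x+z])
  open import Relation.Binary.Reasoning.Setoid setoid

  ev : ∀ {d} → (Fin d → Carrier) → Carrier → Carrier
  ev {zero}  a y = 0#
  ev {suc d} a y = a zero + y * ev (a ∘ suc) y

  ev-cong : ∀ {d} {a b : Fin d → Carrier} {y z} → (∀ i → a i ≈ b i) → y ≈ z → ev a y ≈ ev b z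
  ev-cong {zero}  h k = refl
  ev-cong {suc d} h k = +-cong (h zero) (*-cong k (ev-cong (h ∘ suc) k))

  ev-0 : ∀ {d} {a : Fin d → Carrier} y → (∀ i → a i ≈ 0#) → ev a y ≈ 0#
  ev-0 {zero}  y h = refl
  ev-0 {suc d} y h = trans (+-cong (h zero) (trans (*-congˡ (ev-0 y (h ∘ suc))) (zeroʳ y))) (+-identityˡ 0#)

  ev-+ : ∀ {d} (a b : Fin d → Carrier) y → ev (λ i → a i + b i) y ≈ ev a y + ev b y
  ev-+ {zero}  a b y = sym (+-identityˡ 0#)
  ev-+ {suc d} a b y = trans (+-congˡ (trans (*-congˡ (ev-+ (a ∘ suc) (b ∘ suc) y)) (distribˡ y _ _)))
    (interchange (a zero) (b zero) _ _)

  ev-* : ∀ {d} c (a : Fin d → Carrier) y → ev (λ i → c * a i) y ≈ c * ev a y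
  ev-* {zero}  c a y = sym (zeroʳ c)
  ev-* {suc d} c a y = trans (+-congˡ (trans (*-congˡ (ev-* c (a ∘ suc) y)) (x∙yz≈y∙xz y c _)))
    (sym (distribˡ c _ _))

  private
    -- Synthetic division by y − r.
    quotient : ∀ {d} → (Fin (suc d) → Carrier) → Carrier → Fin d → Carrier
    quotient {suc d} a r = cons (ev (a ∘ suc) r) (quotient (a ∘ suc) r)

    -- ev a y − ev a r = (y − r) ev (quotient a r) y, with both sides moved.
    division : ∀ {d} (a : Fin (suc d) → Carrier) r y →
      ev a y + r * ev (quotient a r) y ≈ ev a r + y * ev (quotient a r) y
    division {zero} a r y = +-cong (+-congˡ (trans (zeroʳ y) (sym (zeroʳ r)))) (trans (zeroʳ r) (sym (zeroʳ y)))
    division {suc d} a r y = begin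
      a₀ + y * ev a′ y + r * (ev a′ r + y * G)     ≈⟨ +-congˡ (distribˡ r _ _) ⟩
      a₀ + y * ev a′ y + (r * ev a′ r + r * (y * G)) ≈⟨ +-assoc a₀ _ _ ⟩
      a₀ + (y * ev a′ y + (r * ev a′ r + r * (y * G))) ≈⟨ +-congˡ (x+[y+z]≈y+[x+z] _ _ _) ⟩
      a₀ + (r * ev a′ r + (y * ev a′ y + r * (y * G))) ≈⟨ +-assoc a₀ _ _ ⟨
      a₀ + r * ev a′ r + (y * ev a′ y + r * (y * G)) ≈⟨ +-congˡ (+-congˡ (x∙yz≈y∙xz r y G)) ⟩
      a₀ + r * ev a′ r + (y * ev a′ y + y * (r * G)) ≈⟨ +-congˡ (distribˡ y _ _) ⟨
      a₀ + r * ev a′ r + y * (ev a′ y + r * G)     ≈⟨ +-congˡ (*-congˡ (division a′ r y)) ⟩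
      a₀ + r * ev a′ r + y * (ev a′ r + y * G)     ∎
      where
      a₀ = a zero
      a′ = a ∘ suc
      G = ev (quotient a′ r) y

    tail-zero : ∀ {d} (a : Fin (suc d) → Carrier) r → (∀ i → quotient a r i ≈ 0#) → ∀ i → a (suc i) ≈ 0#
    tail-zero {suc d} a r h zero = begin
      a (suc zero)                              ≈⟨ +-identityʳ _ ⟨
      a (suc zero) + 0#                         ≈⟨ +-congˡ (trans (*-congˡ (ev-0 r (tail-zero (a ∘ suc) r (h ∘ suc)))) (zeroʳ r)) ⟨
      ev (a ∘ suc) r                            ≈⟨ h zero ⟩
      0#                                        ∎
    tail-zero {suc d} a r h (suc i) = tail-zero (a ∘ suc) r (h ∘ suc) i

  private
    single : ∀ {d} → Fin d → Fin d → Carrier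
    single {suc d} zero    = cons 1# (λ _ → 0#)
    single {suc d} (suc i) = cons 0# (single i)

    ev-single : ∀ {d} (i : Fin d) y → ev (single i) y ≈ y ^ toℕ i
    ev-single {suc d} zero    y = trans (+-congˡ (trans (*-congˡ (ev-0 {d} y (λ _ → refl))) (zeroʳ y))) (+-identityʳ 1#)
    ev-single {suc d} (suc i) y = trans (+-identityˡ _) (*-congˡ (ev-single i y))

    single-diag : ∀ {d} (i : Fin d) → single i i ≡ 1#
    single-diag zero    = ≡.refl
    single-diag (suc i) = single-diag i

  module Bound (1≉0 : ¬ (1# ≈ 0#)) (integral : ∀ {x y} → ¬ (x ≈ 0#) → x * y ≈ 0# → y ≈ 0#) where

    -- Dividing by y - r for the first point r leaves one coefficient fewer and, after cancelling
    -- the nonzero y - r, a polynomial vanishing at the remaining points.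
    root-bound : ∀ {d} (a ys : Fin d → Carrier) → (∀ {i j} → i ≢ j → ¬ (ys i ≈ ys j)) →
      (∀ i → ev a (ys i) ≈ 0#) → ∀ i → a i ≈ 0#
    root-bound {suc d} a ys distinct roots = λ { zero → a₀≈0 ; (suc i) → tail i }
      where
      r = ys zero
      tail : ∀ i → a (suc i) ≈ 0#
      tail = tail-zero a r (root-bound (quotient a r) (ys ∘ suc) (λ i≢j → distinct (i≢j ∘ Fin.suc-injective)) vanish)
        where
        vanish : ∀ i → ev (quotient a r) (ys (suc i)) ≈ 0#
        vanish i = integral (λ e → distinct {suc i} {zero} (λ ()) (x∙y⁻¹≈ε⇒x≈y _ _ e)) (begin
          (y - r) * G          ≈⟨ [y-z]x≈yx-zx G y r ⟩
          y * G - r * G        ≈⟨ x≈y⇒x∙y⁻¹≈ε (trans (sym (+-identityˡ _)) (trans (+-congʳ (sym (roots zero)))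
                                    (trans (sym (division a r y)) (trans (+-congʳ (roots (suc i))) (+-identityˡ _))))) ⟩
          0#                   ∎)
          where
          y = ys (suc i)
          G = ev (quotient a r) y
      a₀≈0 : a zero ≈ 0#
      a₀≈0 = trans (sym (+-identityʳ _)) (trans (+-congˡ (sym (trans (*-congˡ (ev-0 r tail)) (zeroʳ r)))) (roots zero))

    -- y ^ N − y has at most N roots.
    fixed-points-≤ : ∀ N → 2 ≤ N → (zs : List Carrier) → AllPairs (λ y z → ¬ (y ≈ z)) zs →
      All (λ y → y ^ N ≈ y) zs → length zs ≤ N
    fixed-points-≤ (suc zero) (s≤s ())
    fixed-points-≤ N@(suc (suc M)) _ zs distinct fixed with length zs ℕ.≤? N
    ... | yes ≤N = ≤N
    ... | no ≰N = contradiction (trans (sym top≈1) (root-bound a ys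
        (λ {i} {j} i≢j → AllPairs-lookup {S = λ y z → ¬ (y ≈ z)} (λ n e → n (sym e)) distinct _ _
          (λ e → i≢j (Fin.inject≤-injective _ _ i j e))) root (fromℕ N))) 1≉0
      where
      ys : Fin (suc N) → Carrier
      ys i = lookup zs (Fin.inject≤ i (ℕ.≰⇒> ≰N))

      linear : Fin (suc N)
      linear = suc zero

      a : Fin (suc N) → Carrier
      a i = single (fromℕ N) i + - 1# * single linear i

      root : ∀ i → ev a (ys i) ≈ 0#
      root i = begin
        ev a y                                          ≈⟨ ev-+ (single (fromℕ N)) (λ i → - 1# * single linear i) y ⟩
        ev (single (fromℕ N)) y + ev (λ i → - 1# * single linear i) y
                                                        ≈⟨ +-cong (ev-single (fromℕ N) y) (ev-* (- 1#) (single linear) y) ⟩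
        y ^ toℕ (fromℕ N) + - 1# * ev (single linear) y ≈⟨ +-cong (trans (^-congʳ y (Fin.toℕ-fromℕ N))
                                                             (All.lookup fixed (∈-lookup _)))
                                                             (trans (*-congˡ (trans (ev-single linear y) (*-identityʳ y))) (-1*x≈-x y)) ⟩
        y - y                                           ≈⟨ -‿inverseʳ y ⟩
        0#                                              ∎
        where y = ys i

      top≈1 : a (fromℕ N) ≈ 1#
      top≈1 = trans (+-cong (reflexive (single-diag (fromℕ N))) (zeroʳ (- 1#))) (+-identityʳ 1#)

-- A degree-m extension of F from an element with m distinct conjugates.

module Extension {q} (F : FiniteField q) where

  open import Data.List.Properties using (length-map; length-tabulate)
  open import Relation.Binary using (Decidable)
  open import Relation.Binary.PropositionalEquality as ≡ using (_≡_; _≢_; _≗_)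
  import Algebra.Properties.Semiring.Exp as Exp
  open Rank F using (2≤q; allVectors-unique; length-allVectors; x∙y⁻¹≈ε⇒x≈y; 𝟎; //-rightDividesˡ)
    renaming (_+_ to _+F_; _*_ to _*F_; _-_ to _-F_; +-identityˡ to +F-identityˡ)
  open FieldFacts F
  open FiniteField F using (0F; 1F; inv)
  open LinAlg F using (Vector; allVectors)

  -- A degree-m field extension of F with coordinates, and an endomorphism with fixed field F.
  record CyclicExtension (m : ℕ) : Set₁ where
    field
      field-ring : CommutativeRing 0ℓ 0ℓ
    open CommutativeRing field-ring
    field
      1≉0     : ¬ (1# ≈ 0#)
      inverse : ∀ x → x ≈ 0# ⊎ ∃ λ y → x * y ≈ 1#
      ι       : Fin q → Carrier
      ι-+     : ∀ c d → ι (c +F d) ≈ ι c + ι d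
      ι-*     : ∀ c d → ι (c *F d) ≈ ι c * ι d
      ι-1     : ι 1F ≈ 1#
      σ       : Carrier → Carrier
      σ-cong  : ∀ {x y} → x ≈ y → σ x ≈ σ y
      σ-+     : ∀ x y → σ (x + y) ≈ σ x + σ y
      σ-*     : ∀ x y → σ (x * y) ≈ σ x * σ y
      σ-ι     : ∀ c → σ (ι c) ≈ ι c
      fixed   : ∀ {x} → σ x ≈ x → ∃ λ c → x ≈ ι c
      value             : Vector m → Carrier
      value-cong        : ∀ {u v} → u ≗ v → value u ≈ value v
      value-+           : ∀ u v → value (λ i → u i +F v i) ≈ value u + value v
      value-*           : ∀ c v → value (λ i → c *F v i) ≈ ι c * value v
      value-injective   : ∀ {v} → value v ≈ 0# → v ≗ 𝟎
      value-surjective  : ∀ y → ∃ λ v → y ≈ value v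

  module FromGenerator (L : CommutativeRing 0ℓ 0ℓ) (m′ : ℕ) where

    open CommutativeRing L hiding (zero)
    open Exp semiring using (_^_; ^-congˡ; ^-congʳ; ^-assocʳ)
    open import Algebra.Properties.CommutativeSemiring.Exp commutativeSemiring using (^-distrib-*)
    open import Algebra.Properties.Ring (CommutativeRing.ring L) using (+-identityʳ-unique)
    open import Relation.Binary.Reasoning.Setoid setoid

    m : ℕ
    m = suc m′

    module Construct
      (_≟_ : Decidable _≈_) (1≉0 : ¬ (1# ≈ 0#)) (inverse : ∀ x → x ≈ 0# ⊎ ∃ λ y → x * y ≈ 1#)
      (ι : Fin q → Carrier) (ι-+ : ∀ c d → ι (c +F d) ≈ ι c + ι d)
      (ι-* : ∀ c d → ι (c *F d) ≈ ι c * ι d) (ι-1 : ι 1F ≈ 1#)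
      (frobenius : ∀ x y → (x + y) ^ q ≈ x ^ q + y ^ q) (periodic : ∀ x → x ^ (q ℕ.^ m) ≈ x)
      (ξ : Carrier) (moves : ∀ d → 0 < d → d < m → ¬ (ξ ^ (q ℕ.^ d) ≈ ξ))
      where

      integral : ∀ {x y} → ¬ (x ≈ 0#) → x * y ≈ 0# → y ≈ 0#
      integral {x} {y} x≉0 xy≈0 with inverse x
      ... | inj₁ x≈0 = contradiction x≈0 x≉0
      ... | inj₂ (z , xz≈1) = begin
        y             ≈⟨ *-identityˡ y ⟨
        1# * y        ≈⟨ *-congʳ (trans (sym xz≈1) (*-comm x z)) ⟩
        z * x * y     ≈⟨ *-assoc z x y ⟩
        z * (x * y)   ≈⟨ *-congˡ xy≈0 ⟩
        z * 0#        ≈⟨ zeroʳ z ⟩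
        0#            ∎

      open Roots L
      open Bound 1≉0 integral

      ι-0 : ι 0F ≈ 0#
      ι-0 = +-identityʳ-unique (ι 0F) (ι 0F) (trans (sym (ι-+ 0F 0F)) (reflexive (≡.cong ι (+F-identityˡ 0F))))

      ι-injective : ∀ {c} → ι c ≈ 0# → c ≡ 0F
      ι-injective {c} h with c Fin.≟ 0F
      ... | yes z = z
      ... | no nz = let d , cd≡1 = inv c nz in contradiction (begin
        1#          ≈⟨ ι-1 ⟨
        ι 1F        ≡⟨ ≡.cong ι cd≡1 ⟨
        ι (c *F d)  ≈⟨ ι-* c d ⟩
        ι c * ι d   ≈⟨ *-congʳ h ⟩
        0# * ι d    ≈⟨ zeroˡ (ι d) ⟩
        0#          ∎) 1≉0

      ι-^ : ∀ c j → ι (c ^F j) ≈ ι c ^ j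
      ι-^ c zero    = ι-1
      ι-^ c (suc j) = trans (ι-* c (c ^F j)) (*-congˡ (ι-^ c j))

      σ : Carrier → Carrier
      σ x = x ^ q

      σ-ι : ∀ c → σ (ι c) ≈ ι c
      σ-ι c = trans (sym (ι-^ c q)) (reflexive (≡.cong ι (fermat c)))

      σ^ : ℕ → Carrier → Carrier
      σ^ i x = x ^ (q ℕ.^ i)

      σ^-+ : ∀ i j x → σ^ j (σ^ i x) ≈ σ^ (i ℕ.+ j) x
      σ^-+ i j x = trans (^-assocʳ x (q ℕ.^ i) (q ℕ.^ j)) (^-congʳ x (≡.sym (ℕ.^-distribˡ-+-* q i j)))

      -- The m-th iterate of σ is the identity, so `σ^ (m ∸ i)` undoes `σ^ i`.
      σ^-injective : ∀ {i x y} → i ≤ m → σ^ i x ≈ σ^ i y → x ≈ y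
      σ^-injective {i} {x} {y} i≤m h = trans (sym (return x)) (trans (^-congˡ (q ℕ.^ (m ∸ i)) h) (return y))
        where
        return : ∀ x → σ^ (m ∸ i) (σ^ i x) ≈ x
        return x = trans (σ^-+ i (m ∸ i) x) (trans (^-congʳ x (≡.cong (q ℕ.^_) (ℕ.m+[n∸m]≡n i≤m))) (periodic x))

      conjugates-distinct : ∀ {i j} → i < j → j < m → ¬ (σ^ i ξ ≈ σ^ j ξ)
      conjugates-distinct {i} {j} i<j j<m h = moves (j ∸ i) (ℕ.m<n⇒0<n∸m i<j) (ℕ.≤-<-trans (ℕ.m∸n≤m j i) j<m)
        (σ^-injective {i} (ℕ.<⇒≤ (ℕ.<-trans i<j j<m)) (trans (σ^-+ (j ∸ i) i ξ)
          (trans (^-congʳ ξ (≡.cong (q ℕ.^_) (ℕ.m∸n+n≡m (ℕ.<⇒≤ i<j)))) (sym h))))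

      value : ∀ {d} → Vector d → Carrier
      value c = ev (ι ∘ c) ξ

      value-cong : ∀ {d} {u v : Vector d} → u ≗ v → value u ≈ value v
      value-cong h = ev-cong (λ i → reflexive (≡.cong ι (h i))) refl

      value-+ : ∀ {d} (u v : Vector d) → value (λ i → u i +F v i) ≈ value u + value v
      value-+ u v = trans (ev-cong (λ i → ι-+ (u i) (v i)) refl) (ev-+ (ι ∘ u) (ι ∘ v) ξ)

      value-* : ∀ {d} c (v : Vector d) → value (λ i → c *F v i) ≈ ι c * value v
      value-* c v = trans (ev-cong (λ i → ι-* c (v i)) refl) (ev-* (ι c) (ι ∘ v) ξ)

      ev-σ : ∀ {d} (c : Vector d) y → ev (ι ∘ c) (σ y) ≈ σ (ev (ι ∘ c) y)
      ev-σ {zero}  c y = sym (trans (^-congˡ q (sym ι-0)) (trans (σ-ι 0F) ι-0))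
      ev-σ {suc d} c y = sym (begin
        σ (ι (c zero) + y * ev (ι ∘ c ∘ suc) y)        ≈⟨ frobenius _ _ ⟩
        σ (ι (c zero)) + σ (y * ev (ι ∘ c ∘ suc) y)    ≈⟨ +-cong (σ-ι (c zero)) (^-distrib-* y _ q) ⟩
        ι (c zero) + σ y * σ (ev (ι ∘ c ∘ suc) y)      ≈⟨ +-congˡ (*-congˡ (sym (ev-σ (c ∘ suc) y))) ⟩
        ι (c zero) + σ y * ev (ι ∘ c ∘ suc) (σ y)      ∎)

      -- F-polynomials vanishing at ξ vanish at its m conjugates.
      value-injective : ∀ {v : Vector m} → value v ≈ 0# → v ≗ 𝟎
      value-injective {v} h = ι-injective ∘ root-bound (ι ∘ v) (λ i → σ^ (toℕ i) ξ) distinct (λ i → conjugate (toℕ i))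
        where
        distinct : ∀ {i j : Fin m} → i ≢ j → ¬ (σ^ (toℕ i) ξ ≈ σ^ (toℕ j) ξ)
        distinct {i} {j} i≢j e with ℕ.<-cmp (toℕ i) (toℕ j)
        ... | Relation.Binary.tri< i<j _ _ = conjugates-distinct i<j (Fin.toℕ<n j) e
        ... | Relation.Binary.tri≈ _ i≡j _ = i≢j (Fin.toℕ-injective i≡j)
        ... | Relation.Binary.tri> _ _ j<i = conjugates-distinct j<i (Fin.toℕ<n i) (sym e)
        conjugate : ∀ i → ev (ι ∘ v) (σ^ i ξ) ≈ 0#
        conjugate zero    = trans (ev-cong {a = ι ∘ v} (λ _ → refl) (*-identityʳ ξ)) h
        conjugate (suc i) = trans (ev-cong {a = ι ∘ v} (λ _ → refl) (sym (trans (^-assocʳ ξ (q ℕ.^ i) q)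
            (^-congʳ ξ (ℕ.*-comm (q ℕ.^ i) q)))))
          (trans (ev-σ v (σ^ i ξ)) (trans (^-congˡ q (trans (conjugate i) (sym ι-0))) (trans (σ-ι 0F) ι-0)))

      -- y and the values f x would be too many solutions of z ^ N ≈ z.
      only-fixed : ∀ {A : Set} N → 2 ≤ N → (xs : List A) → N ≤ length xs → (f : A → Carrier) →
        AllPairs (λ x x′ → ¬ (f x ≈ f x′)) xs → (∀ x → f x ^ N ≈ f x) → ∀ {y} → y ^ N ≈ y →
        ∃ λ x → y ≈ f x
      only-fixed N 2≤N xs N≤ f distinct fix {y} y^N with Any.any? (λ x → y ≟ f x) xs
      ... | yes a = Any.satisfied a
      ... | no none = contradiction (fixed-points-≤ N 2≤N (y ∷ map f xs)
          (All.map⁺ (All.¬Any⇒All¬ xs none) ∷ AllPairs.map⁺ distinct)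
          (y^N ∷ All.map⁺ (All.universal fix xs)))
        (ℕ.<⇒≱ (s≤s (≡.subst (N ≤_) (≡.sym (length-map f xs)) N≤)))

      value-distinct : ∀ {u v : Vector m} → (∃ λ i → u i ≢ v i) → ¬ (value u ≈ value v)
      value-distinct {u} {v} (i , ne) e = ne (x∙y⁻¹≈ε⇒x≈y _ _ (value-injective {λ i → u i -F v i} (begin
        value (λ i → u i -F v i)                       ≈⟨ +-identityʳ _ ⟨
        value (λ i → u i -F v i) + 0#                  ≈⟨ +-congˡ (-‿inverseʳ (value v)) ⟨
        value (λ i → u i -F v i) + (value v - value v) ≈⟨ +-assoc _ _ _ ⟨
        value (λ i → u i -F v i) + value v - value v   ≈⟨ +-congʳ (value-+ (λ i → u i -F v i) v) ⟨
        value (λ i → u i -F v i +F v i) - value v      ≈⟨ +-congʳ (value-cong (λ i → //-rightDividesˡ (v i) (u i))) ⟩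
        value u - value v                                  ≈⟨ +-congʳ e ⟩
        value v - value v                                  ≈⟨ -‿inverseʳ _ ⟩
        0#                                                 ∎) i))

      -- The q^m distinct values exhaust the solutions of z^(q^m) = z, and every element is such a
      -- solution.
      value-surjective : ∀ y → ∃ λ (v : Vector m) → y ≈ value v
      value-surjective y = only-fixed (q ℕ.^ m) (ℕ.≤-trans 2≤q q≤) (allVectors m)
        (ℕ.≤-reflexive (≡.sym (length-allVectors m))) value
        (AllPairs.map value-distinct (allVectors-unique m)) (λ v → periodic (value v)) (periodic y)
        where
        q≤ : q ≤ q ℕ.^ m
        q≤ = ≡.subst (_≤ q ℕ.^ m) (ℕ.*-identityʳ q) (ℕ.^-monoʳ-≤ q {{ℕ.>-nonZero (ℕ.<⇒≤ 2≤q)}} (s≤s (z≤n {m′})))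

      -- The q elements of F exhaust the solutions of z^q = z.
      fixed : ∀ {x} → σ x ≈ x → ∃ λ c → x ≈ ι c
      fixed = only-fixed q 2≤q (allFin q) (ℕ.≤-reflexive (≡.sym (length-tabulate {n = q} id))) ι
        (AllPairs.tabulate⁺ distinct) σ-ι
        where
        distinct : ∀ {c d} → c ≢ d → ¬ (ι c ≈ ι d)
        distinct {c} {d} ne e = ne (x∙y⁻¹≈ε⇒x≈y c d (ι-injective (begin
          ι (c -F d)                  ≈⟨ +-identityʳ _ ⟨
          ι (c -F d) + 0#             ≈⟨ +-congˡ (-‿inverseʳ (ι d)) ⟨
          ι (c -F d) + (ι d - ι d)    ≈⟨ +-assoc _ _ _ ⟨
          ι (c -F d) + ι d - ι d      ≈⟨ +-congʳ (ι-+ (c -F d) d) ⟨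
          ι (c -F d +F d) - ι d       ≡⟨ ≡.cong (λ z → ι z - ι d) (//-rightDividesˡ d c) ⟩
          ι c - ι d                       ≈⟨ +-congʳ e ⟩
          ι d - ι d                       ≈⟨ -‿inverseʳ _ ⟩
          0#                              ∎)))

      extension : CyclicExtension m
      extension = record
        { field-ring = L ; 1≉0 = 1≉0 ; inverse = inverse ; ι = ι ; ι-+ = ι-+ ; ι-* = ι-* ; ι-1 = ι-1
        ; σ = σ ; σ-cong = ^-congˡ q ; σ-+ = frobenius ; σ-* = λ x y → ^-distrib-* x y q ; σ-ι = σ-ι
        ; fixed = fixed ; value = value ; value-cong = value-cong ; value-+ = value-+ ; value-* = value-*
        ; value-injective = value-injective ; value-surjective = value-surjective }

-- Existence of the extension of degree m.

module Existence {q} (F : FiniteField q) where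

  open import Data.Nat.Primality using (Prime)
  open import Relation.Binary using (Decidable)
  open import Relation.Binary.PropositionalEquality as ≡ using (_≡_; _≗_)
  import Algebra.Properties.Semiring.Exp as Exp
  open Rank F using (2≤q; _≗?_; allVectors-complete) renaming (_+_ to _+F_; _*_ to _*F_)
  open FieldFacts F
  open Extension F
  open FiniteField F using (1F)
  open LinAlg F using (allVectors)

  module ConjugateProduct (R : CommutativeRing 0ℓ 0ℓ) (x : CommutativeRing.Carrier R) where

    open CommutativeRing R hiding (zero)
    open Exp semiring using (_^_)
    open import Relation.Binary.Reasoning.Setoid setoid

    -- The product of x^(q^d) - x over 0 < d ≤ j. In a nonzero factor where it is invertible, none
    -- of these differences vanishes.
    z : ℕ → Carrier
    z zero    = 1#
    z (suc j) = (x ^ (q ℕ.^ suc j) - x) * z j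

    z-killed : ∀ f j d → 0 < d → d ≤ j → f * (x ^ (q ℕ.^ d) - x) ≈ 0# → f * z j ≈ 0#
    z-killed f zero    (suc d) _   ()  h
    z-killed f (suc j) d       0<d d≤ h with d ℕ.≟ suc j
    ... | yes ≡.refl = trans (sym (*-assoc f (x ^ (q ℕ.^ suc j) - x) (z j)))
                         (trans (*-congʳ h) (zeroˡ (z j)))
    ... | no d≢ = begin
      f * (a * z j)    ≈⟨ *-congˡ (*-comm a (z j)) ⟩
      f * (z j * a)    ≈⟨ *-assoc f (z j) a ⟨
      f * z j * a      ≈⟨ *-congʳ (z-killed f j d 0<d (ℕ.s≤s⁻¹ (ℕ.≤∧≢⇒< d≤ d≢)) h) ⟩
      0# * a           ≈⟨ zeroˡ a ⟩
      0#               ∎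
      where a = x ^ (q ℕ.^ suc j) - x

  module AtomicFactor (R : CommutativeRing 0ℓ 0ℓ) (x : CommutativeRing.Carrier R) (m′ M : ℕ) where

    open CommutativeRing R hiding (zero)
    open Exp semiring using (_^_; ^-congʳ)
    open ConjugateProduct R x
    open Localisation R
    open import Algebra.Properties.Ring (CommutativeRing.ring R) using ()
      renaming (x≈y⇒x∙y⁻¹≈ε to x≈y⇒x-y≈0; x[y-z]≈xy-xz to distribˡ--)
    open import Relation.Binary.Reasoning.Setoid setoid

    private
      m : ℕ
      m = suc m′

    module Construct
      (_≟_ : Decidable _≈_) (elements : List Carrier) (complete : ∀ y → Any (y ≈_) elements)
      (ι : Fin q → Carrier) (ι-+ : ∀ c d → ι (c +F d) ≈ ι c + ι d)
      (ι-* : ∀ c d → ι (c *F d) ≈ ι c * ι d) (ι-1 : ι 1F ≈ 1#)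
      (frobenius : ∀ u v → (u + v) ^ q ≈ u ^ q + v ^ q)
      (N≡ : q ℕ.^ m ≡ suc (suc M)) (periodic : ∀ u → u ^ (q ℕ.^ m) ≈ u) (Z≉0 : ¬ (z m′ ≈ 0#))
      where

      periodic′ : ∀ v → v * v ^ suc M ≈ v
      periodic′ v = trans (^-congʳ v (≡.sym N≡)) (periodic v)

      -- `u` is the support idempotent of `Z`. Starting the refinement at `u` keeps `Z` invertible
      -- in the final factor.
      Z u : Carrier
      Z = z m′
      u = Z ^ suc M

      u-idempotent : Idempotent u
      u-idempotent = record
        { idem = power-idem _≟_ M periodic′ Z
        ; nonzero = λ h → Z≉0 (trans (sym (periodic′ Z)) (trans (*-congˡ h) (zeroʳ Z))) }

      -- Refining by every element of the ring makes `f` minimal: in its factor each element is zero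
      -- or invertible.
      refined = refine _≟_ M periodic′ elements u u-idempotent
      f = proj₁ refined
      open Idempotent (proj₁ (proj₂ refined))
      f⊑u = proj₁ (proj₂ (proj₂ refined))
      atomic = proj₂ (proj₂ (proj₂ refined))

      L : CommutativeRing 0ℓ 0ℓ
      L = localised {f} idem

      private module L = CommutativeRing L

      powers-agree : ∀ y j → Exp._^_ L.semiring y j ≡ y ^ j
      powers-agree y zero    = ≡.refl
      powers-agree y (suc j) = ≡.cong (y *_) (powers-agree y j)

      1≉0 : ¬ (1# L.≈ 0#)
      1≉0 h = nonzero (trans (sym (*-identityʳ f)) (trans h (zeroʳ f)))

      inverse : ∀ y → y L.≈ 0# ⊎ ∃ λ y′ → y * y′ L.≈ 1#
      inverse y with All.lookupAny atomic (complete y)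
      ... | inj₁ fa≈0 , y≈a = inj₁ (trans (*-congˡ y≈a) (trans fa≈0 (sym (zeroʳ f))))
      ... | inj₂ fa≈f , y≈a = inj₂ (y ^ M , trans (*-congˡ (Exp.^-congˡ semiring (suc M) y≈a))
                                     (trans fa≈f (sym (*-identityʳ f))))

      -- A coincidence of conjugates would make a factor of `Z` vanish on `f`, hence `Z` and `u` as
      -- well, against f ⊑ u and f ≠ 0.
      moves : ∀ d → 0 < d → d < m → ¬ (x ^ (q ℕ.^ d) L.≈ x)
      moves d 0<d d<m h = nonzero (begin
        f                 ≈⟨ f⊑u ⟨
        f * (Z * Z ^ M)   ≈⟨ *-assoc f Z (Z ^ M) ⟨
        f * Z * Z ^ M     ≈⟨ *-congʳ (z-killed f m′ d 0<d (ℕ.s≤s⁻¹ d<m)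
                               (trans (distribˡ-- f (x ^ (q ℕ.^ d)) x) (x≈y⇒x-y≈0 h))) ⟩
        0# * Z ^ M        ≈⟨ zeroˡ (Z ^ M) ⟩
        0#                ∎)

      extension-of-degree : CyclicExtension m
      extension-of-degree = FromGenerator.Construct.extension L m′ (λ a b → (f * a) ≟ (f * b)) 1≉0 inverse
        ι (λ c d → ≈⇒~ {f} idem (ι-+ c d)) (λ c d → ≈⇒~ {f} idem (ι-* c d)) (≈⇒~ {f} idem ι-1)
        (λ a b → ≈⇒~ {f} idem (≡.subst₂ (λ s t → s ≈ t) (≡.sym (powers-agree (a + b) q))
          (≡.cong₂ _+_ (≡.sym (powers-agree a q)) (≡.sym (powers-agree b q))) (frobenius a b)))
        (λ a → ≈⇒~ {f} idem (≡.subst (_≈ a) (≡.sym (powers-agree a (q ℕ.^ m))) (periodic a)))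
        x (λ d 0<d d<m h → moves d 0<d d<m (≡.subst (L._≈ x) (powers-agree x (q ℕ.^ d)) h))

  module _ {p e} (prime : Prime p) (q≡ : q ≡ p ℕ.^ suc e) (m′ M : ℕ)
           (N≡ : q ℕ.^ suc m′ ≡ suc (suc M)) where

    private
      -- The group has order n = M + 1 = q^m - 1, so that xⁿ = 1 turns into x^(q^m) = x.
      open CyclicAlgebra F M

      m : ℕ
      m = suc m′

      open CommutativeRing algebra hiding (zero)
      open Exp semiring using (_^_; ^-congʳ)
      open import Algebra.Properties.Semiring.Mult semiring using (_×_)
      open ConjugateProduct algebra x using (z)

      char : p × 1# ≈ 0#
      char = trans (ι-× p) (trans (ι-cong (characteristic {p} {e} q≡)) ι-0)

      frobenius^ : ∀ a (u v : Carrier) → (u + v) ^ (q ℕ.^ a) ≈ u ^ (q ℕ.^ a) + v ^ (q ℕ.^ a)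
      frobenius^ a u v = ≡.subst (λ N → (u + v) ^ N ≈ u ^ N + v ^ N)
        (≡.trans (≡.sym (ℕ.^-*-assoc p (suc e) a)) (≡.cong (ℕ._^ a) (≡.sym q≡)))
        (Frobenius.freshman^ algebra prime char (suc e ℕ.* a) u v)

      frobenius : ∀ u v → (u + v) ^ q ≈ u ^ q + v ^ q
      frobenius u v = ≡.subst (λ N → (u + v) ^ N ≈ u ^ N + v ^ N) (ℕ.*-identityʳ q) (frobenius^ 1 u v)

      x^N≈x : x ^ (q ℕ.^ m) ≈ x
      x^N≈x = trans (^-congʳ x N≡) (trans (*-congˡ {x} x^n≗1) (*-identityʳ x))

      periodic : ∀ v → v ^ (q ℕ.^ m) ≈ v
      periodic = power-identity (q ℕ.^ m) (frobenius^ m) (λ c → fermat^ c m) x^N≈x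
        (≡.subst (0 <_) (≡.sym N≡) (s≤s z≤n))

      -- z m′ has degree less than n, hence is nonzero.
      deg : ℕ → ℕ
      deg zero    = 0
      deg (suc j) = q ℕ.^ suc j ℕ.+ deg j

      -- `deg j` is the geometric sum q + ... + q^j. The spare summand q ≥ 2 is what brings the
      -- degree below q^m - 1 and not merely below q^m.
      deg-bound : ∀ j → deg j ℕ.+ q ≤ q ℕ.^ suc j
      deg-bound zero    = ℕ.≤-reflexive (≡.sym (ℕ.*-identityʳ q))
      deg-bound (suc j) = ℕ.≤-trans (ℕ.≤-reflexive (ℕ.+-assoc Q (deg j) q))
        (ℕ.≤-trans (ℕ.+-monoʳ-≤ Q (deg-bound j)) (ℕ.≤-trans (ℕ.≤-reflexive (≡.cong (Q ℕ.+_) (≡.sym (ℕ.+-identityʳ Q))))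
          (ℕ.*-monoˡ-≤ Q 2≤q)))
        where Q = q ℕ.^ suc j

      deg<n : ∀ {j} → j ≤ m′ → deg j < suc M
      deg<n {j} j≤ = ℕ.s≤s⁻¹ (≡.subst (suc (suc (deg j)) ≤_) N≡ (ℕ.≤-trans
        (ℕ.≤-trans (ℕ.≤-reflexive (ℕ.+-comm 2 (deg j))) (ℕ.+-monoʳ-≤ (deg j) 2≤q))
        (ℕ.≤-trans (deg-bound j) (ℕ.^-monoʳ-≤ q {{ℕ.>-nonZero (ℕ.<⇒≤ 2≤q)}} (s≤s j≤)))))

      z-monic : ∀ {j} → j ≤ m′ → Monic (deg j) (z j)
      z-monic {zero}  _  = record
        { top = λ { Fin.zero _ → ≡.refl } ; above = λ { (Fin.suc i) _ → ≡.refl } }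
      z-monic {suc j} j< = x^-monic (q ℕ.^ suc j) 1<Q (deg<n j<) (z-monic (ℕ.<⇒≤ j<))
        where
        1<Q : 1 < q ℕ.^ suc j
        1<Q = ℕ.≤-trans 2≤q (ℕ.≤-trans (ℕ.m≤n+m q (deg j)) (deg-bound j))

    extension-of-degree : CyclicExtension m
    extension-of-degree = AtomicFactor.Construct.extension-of-degree algebra x m′ M _≗?_ (allVectors (suc M)) allVectors-complete
      ι ι-+ ι-* ι-1 frobenius N≡ periodic
      (monic-nonzero (deg<n {m′} ℕ.≤-refl) (z-monic {m′} ℕ.≤-refl))

  cyclic-extension : IsPrimePower q → ∀ m → 0 < m → CyclicExtension m
  cyclic-extension (p , e , pr , q≡) (suc m′) _ = extension-of-degree {p} {e} pr q≡ m′ (q ℕ.^ suc m′ ℕ.∸ 2)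
    (≡.sym (ℕ.m+[n∸m]≡n (ℕ.≤-trans 2≤q
      (≡.subst (_≤ q ℕ.^ suc m′) (ℕ.*-identityʳ q)
        (ℕ.^-monoʳ-≤ q {{ℕ.>-nonZero (ℕ.<⇒≤ 2≤q)}} (s≤s (z≤n {m′})))))))

-- Linearised polynomials and Gabidulin codes.

module Gabidulin {q} (F : FiniteField q) {m} (E : Extension.CyclicExtension F m) where

  open Counting using (cons)
  open import Relation.Binary.PropositionalEquality as ≡ using (_≡_; _≗_)
  private module K = Rank F
  open K using (𝟎; unit; _⊙_; _ᵀ; _⧺_; LI; ⧺-ext; ⧺-↑ˡ; ⧺-↑ʳ; ⊙-step; ⊙-unit; kernel-basis; rank-ᵀ)
  open Weight F using (MinRank; action)
  open Lifting F using (systematic-⊙)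
  open FiniteField F using (0F; 1F; 0≢1)
  open LinAlg F using (Vector; Matrix; rank; matComb)
  open Extension.CyclicExtension E
  open CommutativeRing field-ring hiding (zero)
  open import Algebra.Properties.Semiring.Sum semiring using (sum; sum-cong-≋; *-distribˡ-sum;
       sum-replicate-zero)
  open import Algebra.Properties.Ring (CommutativeRing.ring field-ring) using (+-identityʳ-unique;
       +-inverseʳ-unique; x∙y⁻¹≈ε⇒x≈y; //-rightDividesˡ; -‿+-comm; -‿distribʳ-*)
  open import Algebra.Properties.CommutativeSemigroup *-commutativeSemigroup using (x∙yz≈y∙xz)
  open import Algebra.Properties.CommutativeSemigroup +-commutativeSemigroup using (interchange)
  open import Relation.Binary.Reasoning.Setoid setoid

  ι-0 : ι 0F ≈ 0#
  ι-0 = +-identityʳ-unique (ι 0F) (ι 0F) (trans (sym (ι-+ 0F 0F)) (reflexive (≡.cong ι (K.+-identityˡ 0F))))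

  ι-neg : ∀ c → ι (K.- c) ≈ - ι c
  ι-neg c = +-inverseʳ-unique (ι c) (ι (K.- c))
    (trans (sym (ι-+ c (K.- c))) (trans (reflexive (≡.cong ι (K.-‿inverseʳ c))) ι-0))

  σ-0 : σ 0# ≈ 0#
  σ-0 = trans (σ-cong (sym ι-0)) (trans (σ-ι 0F) ι-0)

  σ-1 : σ 1# ≈ 1#
  σ-1 = trans (σ-cong (sym ι-1)) (trans (σ-ι 1F) ι-1)

  σ-neg : ∀ x → σ (- x) ≈ - σ x
  σ-neg x = +-inverseʳ-unique (σ x) (σ (- x)) (trans (sym (σ-+ x (- x))) (trans (σ-cong (-‿inverseʳ x)) σ-0))

  σ-- : ∀ x y → σ (x - y) ≈ σ x - σ y
  σ-- x y = trans (σ-+ x (- y)) (+-congˡ (σ-neg y))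

  integral : ∀ {x y} → ¬ (y ≈ 0#) → x * y ≈ 0# → x ≈ 0#
  integral {x} {y} y≉0 xy≈0 with inverse y
  ... | inj₁ y≈0 = contradiction y≈0 y≉0
  ... | inj₂ (z , yz≈1) = begin
    x             ≈⟨ *-identityʳ x ⟨
    x * 1#        ≈⟨ *-congˡ yz≈1 ⟨
    x * (y * z)   ≈⟨ *-assoc x y z ⟨
    x * y * z     ≈⟨ *-congʳ xy≈0 ⟩
    0# * z        ≈⟨ zeroˡ z ⟩
    0#            ∎

  σ-nonzero : ∀ {x} → ¬ (x ≈ 0#) → ¬ (σ x ≈ 0#)
  σ-nonzero {x} x≉0 h with inverse x
  ... | inj₁ x≈0 = x≉0 x≈0
  ... | inj₂ (y , xy≈1) = 1≉0 (begin
    1#          ≈⟨ σ-1 ⟨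
    σ 1#        ≈⟨ σ-cong xy≈1 ⟨
    σ (x * y)   ≈⟨ σ-* x y ⟩
    σ x * σ y   ≈⟨ *-congʳ h ⟩
    0# * σ y    ≈⟨ zeroˡ (σ y) ⟩
    0#          ∎)

  -- F-linear combinations in the extension

  comb : ∀ {s} → Vector s → (Fin s → Carrier) → Carrier
  comb a ys = sum (λ i → ι (a i) * ys i)

  comb-cong : ∀ {s} (a : Vector s) {ys zs} → (∀ i → ys i ≈ zs i) → comb a ys ≈ comb a zs
  comb-cong a h = sum-cong-≋ (λ i → *-congˡ (h i))

  comb-scale : ∀ {s} (a : Vector s) v ys → comb a (λ i → v * ys i) ≈ v * comb a ys
  comb-scale a v ys = trans (sum-cong-≋ (λ i → x∙yz≈y∙xz (ι (a i)) v (ys i)))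
    (sym (*-distribˡ-sum v (λ i → ι (a i) * ys i)))

  comb-additive : (φ : Carrier → Carrier) → (φ 0# ≈ 0#) → (∀ x y → φ (x + y) ≈ φ x + φ y) →
    (∀ c y → φ (ι c * y) ≈ ι c * φ y) → ∀ {s} (a : Vector s) ys → φ (comb a ys) ≈ comb a (φ ∘ ys)
  comb-additive φ φ0 φ+ φ* {zero}  a ys = φ0
  comb-additive φ φ0 φ+ φ* {suc s} a ys = trans (φ+ _ _)
    (+-cong (φ* (a zero) (ys zero)) (comb-additive φ φ0 φ+ φ* (a ∘ suc) (ys ∘ suc)))

  σ-comb : ∀ {s} (a : Vector s) ys → σ (comb a ys) ≈ comb a (σ ∘ ys)
  σ-comb = comb-additive σ σ-0 σ-+ (λ c y → trans (σ-* (ι c) y) (*-congʳ (σ-ι c)))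

  comb-- : ∀ {s} (a : Vector s) ys zs → comb a (λ i → ys i - zs i) ≈ comb a ys - comb a zs
  comb-- {zero}  a ys zs = sym (-‿inverseʳ 0#)
  comb-- {suc s} a ys zs = begin
    ι₀ * (y₀ - z₀) + comb (a ∘ suc) (λ i → ys (suc i) - zs (suc i))
      ≈⟨ +-cong (trans (distribˡ ι₀ y₀ (- z₀)) (+-congˡ (sym (-‿distribʳ-* ι₀ z₀)))) (comb-- (a ∘ suc) (ys ∘ suc) (zs ∘ suc)) ⟩
    (ι₀ * y₀ - ι₀ * z₀) + (comb (a ∘ suc) (ys ∘ suc) - comb (a ∘ suc) (zs ∘ suc))
      ≈⟨ interchange (ι₀ * y₀) (- (ι₀ * z₀)) _ _ ⟩
    comb a ys + (- (ι₀ * z₀) - comb (a ∘ suc) (zs ∘ suc))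
      ≈⟨ +-congˡ (-‿+-comm (ι₀ * z₀) (comb (a ∘ suc) (zs ∘ suc))) ⟩
    comb a ys - comb a zs ∎
    where
    ι₀ = ι (a zero)
    y₀ = ys zero
    z₀ = zs zero

  value-0 : ∀ {v} → v ≗ 𝟎 → value v ≈ 0#
  value-0 {v} h = trans (value-cong (λ i → ≡.trans (h i) (≡.sym (K.zeroˡ (v i)))))
    (trans (value-* 0F v) (trans (*-congʳ ι-0) (zeroˡ _)))

  value-⊙ : ∀ {s} (a : Vector s) (M : Matrix s m) → value (a ⊙ M) ≈ comb a (value ∘ M)
  value-⊙ {zero}  a M = value-0 (λ _ → ≡.refl)
  value-⊙ {suc s} a M = begin
    value (a ⊙ M)                                                ≈⟨ value-cong (⊙-step a M) ⟩
    value (λ j → a zero K.* M zero j K.+ (a ∘ suc ⊙ M ∘ suc) j)  ≈⟨ value-+ (λ j → a zero K.* M zero j) (a ∘ suc ⊙ M ∘ suc) ⟩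
    value (λ j → a zero K.* M zero j) + value (a ∘ suc ⊙ M ∘ suc) ≈⟨ +-cong (value-* (a zero) (M zero)) (value-⊙ (a ∘ suc) (M ∘ suc)) ⟩
    comb a (value ∘ M)                                           ∎

  comb-⧺ : ∀ {s t} (a : Vector (s ℕ.+ t)) (u : Fin s → Carrier) (w : Fin t → Carrier) →
    comb a (u ⧺ w) ≈ comb (a ∘ (Fin._↑ˡ t)) u + comb (a ∘ (s Fin.↑ʳ_)) w
  comb-⧺ {zero}  a u w = sym (+-identityˡ _)
  comb-⧺ {suc s} a u w = trans (+-congˡ (trans (comb-cong (a ∘ suc) shift) (comb-⧺ (a ∘ suc) (u ∘ suc) w)))
    (sym (+-assoc _ _ _))
    where
    shift : ∀ i → (u ⧺ w) (suc i) ≈ ((u ∘ suc) ⧺ w) i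
    shift i with Fin.splitAt s i
    ... | inj₁ _ = refl
    ... | inj₂ _ = refl

  Indep : ∀ {s} → (Fin s → Carrier) → Set
  Indep ys = ∀ a → comb a ys ≈ 0# → a ≗ 𝟎

  -- Linearised polynomials Σ Cⱼ σʲ

  lp : ∀ {n} → (Fin n → Carrier) → Carrier → Carrier
  lp {zero}  C y = 0#
  lp {suc n} C y = C zero * y + lp (C ∘ suc) (σ y)

  lp-cong : ∀ {n} (C : Fin n → Carrier) {y z} → y ≈ z → lp C y ≈ lp C z
  lp-cong {zero}  C h = refl
  lp-cong {suc n} C h = +-cong (*-congˡ h) (lp-cong (C ∘ suc) (σ-cong h))

  lp-0 : ∀ {n} (C : Fin n → Carrier) → lp C 0# ≈ 0#
  lp-0 {zero}  C = refl
  lp-0 {suc n} C = trans (+-cong (zeroʳ _) (trans (lp-cong (C ∘ suc) σ-0) (lp-0 (C ∘ suc)))) (+-identityˡ 0#)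

  lp-+ : ∀ {n} (C : Fin n → Carrier) y z → lp C (y + z) ≈ lp C y + lp C z
  lp-+ {zero}  C y z = sym (+-identityˡ 0#)
  lp-+ {suc n} C y z = trans (+-cong (distribˡ (C zero) y z)
    (trans (lp-cong (C ∘ suc) (σ-+ y z)) (lp-+ (C ∘ suc) (σ y) (σ z)))) (interchange _ _ _ _)

  lp-ι : ∀ {n} (C : Fin n → Carrier) c y → lp C (ι c * y) ≈ ι c * lp C y
  lp-ι {zero}  C c y = sym (zeroʳ (ι c))
  lp-ι {suc n} C c y = trans (+-cong (x∙yz≈y∙xz (C zero) (ι c) y)
    (trans (lp-cong (C ∘ suc) (trans (σ-* (ι c) y) (*-congʳ (σ-ι c)))) (lp-ι (C ∘ suc) c (σ y))))
    (sym (distribˡ (ι c) _ _))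

  lp-comb : ∀ {n s} (C : Fin n → Carrier) (a : Vector s) ys → lp C (comb a ys) ≈ comb a (lp C ∘ ys)
  lp-comb C = comb-additive (lp C) (lp-0 C) (lp-+ C) (lp-ι C)

  iterate : ℕ → Carrier → Carrier
  iterate zero    y = y
  iterate (suc n) y = iterate n (σ y)

  lp-⧺ : ∀ {n₁ n₂} (C : Fin n₁ → Carrier) (D : Fin n₂ → Carrier) y →
         lp (C ⧺ D) y ≈ lp C y + lp D (iterate n₁ y)
  lp-⧺ {zero}   C D y = sym (+-identityˡ _)
  lp-⧺ {suc n₁} C D y = trans (+-congˡ (trans (lp-≗ shift) (lp-⧺ (C ∘ suc) D (σ y)))) (sym (+-assoc _ _ _))
    where
    shift : ∀ i → (C ⧺ D) (suc i) ≡ ((C ∘ suc) ⧺ D) i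
    shift i with Fin.splitAt n₁ i
    ... | inj₁ _ = ≡.refl
    ... | inj₂ _ = ≡.refl
    lp-≗ : ∀ {n} {C D : Fin n → Carrier} {y} → C ≗ D → lp C y ≈ lp D y
    lp-≗ {zero}  h = refl
    lp-≗ {suc n} h = +-cong (*-congʳ (reflexive (h zero))) (lp-≗ (h ∘ suc))

  private
    -- The coefficients of z ↦ C(y z).
    twist : ∀ {n} → (Fin n → Carrier) → Carrier → Fin n → Carrier
    twist {suc n} C y = cons (C zero * y) (twist (C ∘ suc) (σ y))

    lp-twist : ∀ {n} (C : Fin n → Carrier) y z → lp (twist C y) z ≈ lp C (y * z)
    lp-twist {zero}  C y z = refl
    lp-twist {suc n} C y z = +-cong (*-assoc (C zero) y z)
      (trans (lp-twist (C ∘ suc) (σ y) (σ z)) (lp-cong (C ∘ suc) (sym (σ-* y z))))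

    untwist : ∀ {n} (C : Fin n → Carrier) {y} → ¬ (y ≈ 0#) → (∀ j → twist C y j ≈ 0#) → ∀ j → C j ≈ 0#
    untwist {suc n} C y≉0 h zero    = integral y≉0 (h zero)
    untwist {suc n} C y≉0 h (suc j) = untwist (C ∘ suc) (σ-nonzero y≉0) (h ∘ suc) j

    total : ∀ {n} → (Fin n → Carrier) → Carrier
    total = sum

    -- g = g(1) + (tails g) ∘ (σ − 1)
    tails : ∀ {n} → (Fin (suc n) → Carrier) → Fin n → Carrier
    tails {suc n} g = cons (total (g ∘ suc)) (tails (g ∘ suc))

    lp-tails : ∀ {n} (g : Fin (suc n) → Carrier) z → lp g z ≈ total g * z + lp (tails g) (σ z - z)
    lp-tails {zero} g z = +-congʳ (*-congʳ (sym (+-identityʳ (g zero))))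
    lp-tails {suc n} g z = begin
      g₀ * z + lp g′ (σ z)
        ≈⟨ +-congˡ (lp-tails g′ (σ z)) ⟩
      g₀ * z + (t * σ z + lp (tails g′) (σ (σ z) - σ z))
        ≈⟨ +-congˡ (+-cong (*-congˡ (trans (+-comm z (σ z - z)) (//-rightDividesˡ z (σ z)))) (lp-cong (tails g′) (σ-- (σ z) z))) ⟨
      g₀ * z + (t * (z + (σ z - z)) + lp (tails g′) (σ (σ z - z)))
        ≈⟨ +-congˡ (+-congʳ (distribˡ t z (σ z - z))) ⟩
      g₀ * z + (t * z + t * (σ z - z) + lp (tails g′) (σ (σ z - z)))
        ≈⟨ +-congˡ (+-assoc _ _ _) ⟩
      g₀ * z + (t * z + (t * (σ z - z) + lp (tails g′) (σ (σ z - z))))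
        ≈⟨ +-assoc _ _ _ ⟨
      g₀ * z + t * z + (t * (σ z - z) + lp (tails g′) (σ (σ z - z)))
        ≈⟨ +-congʳ (distribʳ z g₀ t) ⟨
      total g * z + lp (tails g) (σ z - z) ∎
      where
      g₀ = g zero
      g′ = g ∘ suc
      t = total g′

    lp-1 : ∀ {n} (g : Fin n → Carrier) → lp g 1# ≈ total g
    lp-1 {zero}  g = refl
    lp-1 {suc n} g = +-cong (*-identityʳ _) (trans (lp-cong (g ∘ suc) σ-1) (lp-1 (g ∘ suc)))

    tails-zero : ∀ {n} (g : Fin (suc n) → Carrier) → total g ≈ 0# → (∀ j → tails g j ≈ 0#) → ∀ j → g j ≈ 0#
    tails-zero {zero}  g t h zero = trans (sym (+-identityʳ _)) t
    tails-zero {suc n} g t h zero = trans (sym (+-identityʳ _)) (trans (+-congˡ (sym (h zero))) t)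
    tails-zero {suc n} g t h (suc j) = tails-zero (g ∘ suc) (h zero) (h ∘ suc) j

  -- Scaling y₀ to 1, a vanishing polynomial factors through σ − 1, and (σ − 1) keeps
  -- the other zeros independent because its kernel is F.
  lp-vanish : ∀ n (C ys : Fin n → Carrier) → Indep ys → (∀ i → lp C (ys i) ≈ 0#) → ∀ j → C j ≈ 0#
  lp-vanish (suc n) C ys indep zeros with inverse (ys zero)
  ... | inj₁ y₀≈0 = contradiction (≡.sym (indep (unit zero) vanishing zero)) 0≢1
    where
    vanishing : comb (unit zero) ys ≈ 0#
    vanishing = trans (+-cong (trans (*-congˡ y₀≈0) (zeroʳ _))
      (trans (sum-cong-≋ (λ i → trans (*-congʳ ι-0) (zeroˡ (ys (suc i))))) (sum-replicate-zero n))) (+-identityˡ 0#)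
  ... | inj₂ (v , y₀v≈1) = untwist C y₀≉0 (tails-zero g total≈0 (lp-vanish n (tails g) w w-indep w-zeros))
    where
    y₀ = ys zero
    y₀≉0 : ¬ (y₀ ≈ 0#)
    y₀≉0 h = 1≉0 (trans (sym y₀v≈1) (trans (*-congʳ h) (zeroˡ v)))

    z : Fin (suc n) → Carrier
    z i = v * ys i

    unscale : ∀ y → y₀ * (v * y) ≈ y
    unscale y = trans (sym (*-assoc y₀ v y)) (trans (*-congʳ y₀v≈1) (*-identityˡ y))

    z₀≈1 : z zero ≈ 1#
    z₀≈1 = trans (*-comm v y₀) y₀v≈1

    g : Fin (suc n) → Carrier
    g = twist C y₀

    g-zeros : ∀ i → lp g (z i) ≈ 0#
    g-zeros i = trans (lp-twist C y₀ (z i)) (trans (lp-cong C (unscale (ys i))) (zeros i))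

    total≈0 : total g ≈ 0#
    total≈0 = trans (sym (lp-1 g)) (trans (lp-cong g (sym z₀≈1)) (g-zeros zero))

    w : Fin n → Carrier
    w i = σ (z (suc i)) - z (suc i)

    w-zeros : ∀ i → lp (tails g) (w i) ≈ 0#
    w-zeros i = begin
      lp (tails g) (w i)                            ≈⟨ +-identityˡ _ ⟨
      0# + lp (tails g) (w i)                       ≈⟨ +-congʳ (trans (*-congʳ total≈0) (zeroˡ (z (suc i)))) ⟨
      total g * z (suc i) + lp (tails g) (w i)      ≈⟨ lp-tails g (z (suc i)) ⟨
      lp g (z (suc i))                              ≈⟨ g-zeros (suc i) ⟩
      0#                                            ∎

    w-indep : Indep w
    w-indep a h i = indep (cons (K.- c) a) relation (suc i)
      where
      Z = comb a (z ∘ suc)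
      in-F : ∃ λ c → Z ≈ ι c
      in-F = fixed (x∙y⁻¹≈ε⇒x≈y (σ Z) Z (begin
        σ Z - Z                      ≈⟨ +-congʳ (σ-comb a (z ∘ suc)) ⟩
        comb a (σ ∘ z ∘ suc) - Z     ≈⟨ comb-- a (σ ∘ z ∘ suc) (z ∘ suc) ⟨
        comb a w                     ≈⟨ h ⟩
        0#                           ∎))
      c = proj₁ in-F
      relation : comb (cons (K.- c) a) ys ≈ 0#
      relation = begin
        comb (cons (K.- c) a) ys               ≈⟨ unscale _ ⟨
        y₀ * (v * comb (cons (K.- c) a) ys)    ≈⟨ *-congˡ (comb-scale (cons (K.- c) a) v ys) ⟨
        y₀ * (ι (K.- c) * z zero + Z)          ≈⟨ *-congˡ (+-cong (trans (*-congˡ z₀≈1) (trans (*-identityʳ _) (ι-neg c))) (proj₂ in-F)) ⟩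
        y₀ * (- ι c + ι c)                     ≈⟨ *-congˡ (-‿inverseˡ (ι c)) ⟩
        y₀ * 0#                                ≈⟨ zeroʳ y₀ ⟩
        0#                                     ∎

  -- Codes of linearised polynomials

  -- A parametrisation over F of linearised polynomials with n coefficients: `element y t` is the
  -- value at y of the t-th basis polynomial, and `coefficients c` are the extension-field
  -- coefficients of the polynomial with coordinates c.
  record Family (n N : ℕ) : Set where
    field
      element      : Carrier → Fin N → Carrier
      coefficients : Vector N → Fin n → Carrier
      evaluate     : ∀ c y → comb c (element y) ≈ lp (coefficients c) y
      faithful     : ∀ c → (∀ j → coefficients c j ≈ 0#) → c ≗ 𝟎

  all-polynomials : ∀ n → Family n (n ℕ.* m)
  all-polynomials zero = record
    { element = λ _ () ; coefficients = λ _ () ; evaluate = λ _ _ → refl ; faithful = λ _ _ () }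
  all-polynomials (suc n) = record
    { element = λ y → (λ i → y * value (unit i)) ⧺ element (σ y)
    ; coefficients = λ c → cons (value (c ∘ (Fin._↑ˡ (n ℕ.* m)))) (coefficients (c ∘ (m Fin.↑ʳ_)))
    ; evaluate = λ c y → trans (comb-⧺ c _ (element (σ y))) (+-cong
        (trans (comb-scale (c ∘ (Fin._↑ˡ (n ℕ.* m))) y (value ∘ unit)) (trans (*-comm y _) (*-congʳ (trans
          (sym (value-⊙ (c ∘ (Fin._↑ˡ (n ℕ.* m))) unit)) (value-cong (⊙-unit (c ∘ (Fin._↑ˡ (n ℕ.* m)))))))))
        (evaluate (c ∘ (m Fin.↑ʳ_)) (σ y)))
    ; faithful = λ c h → ⧺-ext {m} {n ℕ.* m} (value-injective (h zero)) (faithful (c ∘ (m Fin.↑ʳ_)) (h ∘ suc)) }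
    where open Family (all-polynomials n)

  -- Polynomials of σ-degree < n₁ + n₂, with the low and the high coefficients kept apart.
  split-polynomials : ∀ n₁ n₂ → Family (n₁ ℕ.+ n₂) (n₁ ℕ.* m ℕ.+ n₂ ℕ.* m)
  split-polynomials n₁ n₂ = record
    { element = λ y → P.element y ⧺ Q.element (iterate n₁ y)
    ; coefficients = λ c → P.coefficients (low c) ⧺ Q.coefficients (high c)
    ; evaluate = λ c y → trans (comb-⧺ c (P.element y) (Q.element (iterate n₁ y)))
        (trans (+-cong (P.evaluate (low c) y) (Q.evaluate (high c) (iterate n₁ y)))
          (sym (lp-⧺ (P.coefficients (low c)) (Q.coefficients (high c)) y)))
    ; faithful = λ c h → ⧺-ext {n₁ ℕ.* m} {n₂ ℕ.* m}
        (P.faithful (low c) (λ j → trans (reflexive (≡.sym (⧺-↑ˡ (P.coefficients (low c)) _ j))) (h (j Fin.↑ˡ n₂))))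
        (Q.faithful (high c) (λ j → trans (reflexive (≡.sym (⧺-↑ʳ (P.coefficients (low c)) _ j))) (h (n₁ Fin.↑ʳ j)))) }
    where
    module P = Family (all-polynomials n₁)
    module Q = Family (all-polynomials n₂)
    low : Vector (n₁ ℕ.* m ℕ.+ n₂ ℕ.* m) → Vector (n₁ ℕ.* m)
    low c = c ∘ (Fin._↑ˡ (n₂ ℕ.* m))
    high : Vector (n₁ ℕ.* m ℕ.+ n₂ ℕ.* m) → Vector (n₂ ℕ.* m)
    high c = c ∘ (n₁ ℕ.* m Fin.↑ʳ_)

  inclusion-LI : ∀ {a b} (a≤b : a ≤ b) → LI {a} {b} (λ l → unit (Fin.inject≤ l a≤b))
  inclusion-LI {a} {b} a≤b v h l = ≡.trans (≡.sym (systematic-⊙ (λ j → Fin.inject≤ j a≤b) inclusion unit-inject v l))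
                                           (h (Fin.inject≤ l a≤b))
    where
    inclusion : Matrix a b
    inclusion l = unit (Fin.inject≤ l a≤b)
    unit-inject : ∀ i j → inclusion i (Fin.inject≤ j a≤b) ≡ unit i j
    unit-inject i j with i Fin.≟ j
    ... | yes ≡.refl = K.unit-diag (Fin.inject≤ i a≤b)
    ... | no i≢j     = K.unit-off (λ e → i≢j (Fin.inject≤-injective a≤b a≤b i j e))

  module _ {k} (k≤m : k ≤ m) where

    private
      embed : Matrix k m
      embed l = unit (Fin.inject≤ l k≤m)

      -- The evaluation points: k elements independent over F, available because k ≤ m.
      point : Fin k → Carrier
      point l = value (embed l)

      embed-LI : LI embed
      embed-LI = inclusion-LI k≤m

    module _ {n N} (fam : Family n N) where

      open Family fam

      -- Column l of a word holds the coordinates of the polynomial's value at the l-th point.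
      code : Fin N → Matrix m k
      code t i l = proj₁ (value-surjective (element (point l) t)) i

      private
        column : ∀ c l → value (λ i → matComb c code i l) ≈ lp (coefficients c) (point l)
        column c l = trans (value-⊙ c (λ t i → code t i l)) (trans
          (comb-cong c (λ t → sym (proj₂ (value-surjective (element (point l) t)))))
          (evaluate c (point l)))

        -- Linearised polynomials are F-linear, so multiplying a word by v evaluates its polynomial
        -- at the combination of the points with coefficients v.
        value-action : ∀ c v → value (action code c v) ≈ lp (coefficients c) (value (v ⊙ embed))
        value-action c v = begin
          value (action code c v)                         ≈⟨ value-⊙ v ((matComb c code) ᵀ) ⟩
          comb v (λ l → value (λ i → matComb c code i l)) ≈⟨ comb-cong v (column c) ⟩
          comb v (lp (coefficients c) ∘ point)            ≈⟨ lp-comb (coefficients c) v point ⟨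
          lp (coefficients c) (comb v point)              ≈⟨ lp-cong (coefficients c) (value-⊙ v embed) ⟨
          lp (coefficients c) (value (v ⊙ embed))         ∎

      -- A word of rank below d = k + 1 - n has a kernel of dimension at least n. This gives n
      -- independent zeros of a linearised polynomial with n coefficients, which must then be zero.
      code-minRank : ∀ {d} → n ℕ.+ d ≡ suc k → MinRank d code
      code-minRank {d} n+d c low = faithful c (lp-vanish n (coefficients c) ys indep zeros)
        where
        X = matComb c code
        kernel = kernel-basis (X ᵀ)
        s = proj₁ kernel
        basis = proj₁ (proj₂ kernel)
        s+r≡k = proj₁ (proj₂ (proj₂ kernel))
        li = proj₁ (proj₂ (proj₂ (proj₂ kernel)))
        kills = proj₁ (proj₂ (proj₂ (proj₂ (proj₂ kernel))))

        n≤s : n ≤ s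
        n≤s = ℕ.+-cancelʳ-≤ d n s (ℕ.≤-trans (ℕ.≤-reflexive n+d) (ℕ.≤-trans
          (ℕ.≤-reflexive (≡.trans (≡.cong suc (≡.trans (≡.sym s+r≡k) (≡.cong (s ℕ.+_) (rank-ᵀ X))))
            (≡.sym (ℕ.+-suc s (rank X)))))
          (ℕ.+-monoʳ-≤ s low)))

        rows : Matrix n k
        rows i = basis (Fin.inject≤ i n≤s)

        ys : Fin n → Carrier
        ys i = value (rows i ⊙ embed)

        zeros : ∀ i → lp (coefficients c) (ys i) ≈ 0#
        zeros i = trans (sym (value-action c (rows i))) (value-0 (kills (Fin.inject≤ i n≤s)))

        rows-LI : LI rows
        rows-LI a h = inclusion-LI n≤s a (li (a ⊙ (λ i → unit (Fin.inject≤ i n≤s))) (λ j →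
          ≡.trans (K.⊙-⊗ a (λ i → unit (Fin.inject≤ i n≤s)) basis j)
            (≡.trans (K.⊙-congʳ a (λ i → K.unit-⊙ (Fin.inject≤ i n≤s) basis) j) (h j))))

        indep : Indep ys
        indep a h = rows-LI a (embed-LI (a ⊙ rows) (λ j → ≡.trans (K.⊙-⊗ a rows embed j)
          (value-injective (trans (value-⊙ a (rows K.⊗ embed)) h) j)))

-- The supplementary sets Z in both cases, and the bound.

module LowerBound {q} (F : FiniteField q) where

  open Counting
  open import Data.Bool as Bool using (true; T; if_then_else_)
  open import Data.Nat using (_^_)
  open import Data.List.Properties using (length-map; filter-some; filter-none)
  open import Data.Nat.ListAction using () renaming (sum to sumᴺ)
  open import Data.Product using (_×_)
  open import Relation.Nullary.Decidable using (⌊_⌋)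
  open import Relation.Binary.PropositionalEquality

  open FiniteField F
  open LinAlg F
  open Rank F
  open Weight F
  open Lifting F
  open Extension F using (CyclicExtension)
  open Existence F using (cyclic-extension)

  rank-zero : ∀ {a b} {M : Matrix a b} → (∀ i → M i ≗ 𝟎) → rank M ≡ 0
  rank-zero {M = M} h = ℕ.n≤0⇒n≡0 (rank-≤ M (λ _ ()) λ {c} {d} _ j → trans (vanish c j) (sym (vanish d j)))
    where
    vanish : ∀ c → c ⊙ M ≗ 𝟎
    vanish c j = trans (⊙-sum c M j) (sum-0 {f = λ i → c i * M i j} (λ i → trans (cong (c i *_) (h i j)) (zeroʳ (c i))))

  isZeroM⁻ : ∀ {a b} (M : Matrix a b) → isZeroM M ≡ true → ∀ i → M i ≗ 𝟎
  isZeroM⁻ M e with Fin.all? (λ i → Fin.all? (λ j → M i j Fin.≟ 0F))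
  ... | yes h = h

  isZeroM⁺ : ∀ {a b} (M : Matrix a b) → (∀ i → M i ≗ 𝟎) → isZeroM M ≡ true
  isZeroM⁺ M h with Fin.all? (λ i → Fin.all? (λ j → M i j Fin.≟ 0F))
  ... | yes _ = refl
  ... | no ¬h = contradiction h ¬h

  matComb-zero : ∀ {N a b} (G : Fin N → Matrix a b) {c} → c ≗ 𝟎 → ∀ i → matComb c G i ≗ 𝟎
  matComb-zero G h i = ⊙-zeroˡ (λ t → G t i) h

  minRank-mrd : ∀ {a b δ N} → N ≡ mrdDim a b δ → 0 < δ → (G : Fin N → Matrix a b) → MinRank δ G → MRD a b δ
  minRank-mrd {δ = δ} refl 0<δ G mr = record
    { basis = G
    ; independent = λ c e → isZeroV⁺ (mr c (subst (_< δ) (sym (rank-zero (isZeroM⁻ (matComb c G) e))) 0<δ))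
    ; minRank = λ c e → ℕ.≮⇒≥ λ low →
        contradiction (trans (sym (isZeroM⁺ (matComb c G) (matComb-zero G (mr c low)))) e) λ () }

  transpose : ∀ {N a b} → (Fin N → Matrix a b) → Fin N → Matrix b a
  transpose G t = (G t) ᵀ

  transpose-minRank : ∀ {N a b δ} {G : Fin N → Matrix a b} → MinRank δ G → MinRank δ (transpose G)
  transpose-minRank {δ = δ} {G} mr c low = mr c (subst (_< δ) (rank-ᵀ (matComb c G)) low)

  -- The rank counts refer to (n - k) × k matrices, whereas lifting takes k × (n - k) matrices.
  transposed-mrd : ∀ {a b δ} → 0 < δ → MRD a b δ → MRD b a δ
  transposed-mrd {a} {b} {δ} 0<δ D = minRank-mrd
    (cong₂ (λ x y → x ℕ.* (suc y ∸ δ)) (ℕ.⊔-comm a b) (ℕ.⊓-comm a b))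
    0<δ (transpose (MRD.basis D)) (transpose-minRank {G = MRD.basis D} (mrd-minRank D))

  rankCount-as-count : ∀ {a b δ} (D : MRD a b δ) i →
    MRD.rankCount D i ≡ count (λ c → rank (matComb c (MRD.basis D)) ℕ.≟ i) (allVectors (mrdDim a b δ))
  rankCount-as-count {a} {b} {δ} D i =
    count-map (λ M → rank M ℕ.≟ i) (λ c → matComb c (MRD.basis D)) (allVectors (mrdDim a b δ))

  ⊙-⧺ : ∀ s {t b} (c : Vector (s ℕ.+ t)) (M : Matrix (s ℕ.+ t) b) j →
        (c ⊙ M) j ≡ (c ∘ (Fin._↑ˡ t) ⊙ M ∘ (Fin._↑ˡ t)) j + (c ∘ (s Fin.↑ʳ_) ⊙ M ∘ (s Fin.↑ʳ_)) j
  ⊙-⧺ zero        c M j = sym (+-identityˡ ((c ⊙ M) j))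
  ⊙-⧺ (suc s) {t} c M j = begin
    (c ⊙ M) j                                        ≡⟨ ⊙-step c M j ⟩
    c zero * M zero j + (c ∘ suc ⊙ M ∘ suc) j        ≡⟨ cong (c zero * M zero j +_) (⊙-⧺ s {t} (c ∘ suc) (M ∘ suc) j) ⟩
    c zero * M zero j + (low + high)                 ≡⟨ +-assoc (c zero * M zero j) low high ⟨
    c zero * M zero j + low + high                   ≡⟨ cong (_+ high) (⊙-step (c ∘ (Fin._↑ˡ t)) (M ∘ (Fin._↑ˡ t)) j) ⟨
    (c ∘ (Fin._↑ˡ t) ⊙ M ∘ (Fin._↑ˡ t)) j + high     ∎
    where
    open ≡-Reasoning
    low high : Fin q
    low = (c ∘ suc ∘ (Fin._↑ˡ t) ⊙ M ∘ suc ∘ (Fin._↑ˡ t)) j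
    high = (c ∘ suc ∘ (s Fin.↑ʳ_) ⊙ M ∘ suc ∘ (s Fin.↑ʳ_)) j

  module _ {n k δ : ℕ} (2k≤n : 2 ℕ.* k ≤ n) (δ<k : δ < k) (0<δ : 0 < δ) where

    private
      m : ℕ
      m = n ∸ k

      k≤m : k ≤ m
      k≤m = ℕ.m+n≤o⇒m≤o∸n k (subst (λ x → k ℕ.+ x ≤ n) (ℕ.+-identityʳ k) 2k≤n)

      δ≤k : δ ≤ k
      δ≤k = ℕ.<⇒≤ δ<k

      main-term : ℕ
      main-term = q ^ (m ℕ.* (k ∸ δ ℕ.+ 1))

      0<m : 0 < m
      0<m = ℕ.≤-trans (ℕ.≤-trans 0<δ δ≤k) k≤m

      mrdDim≡ : ∀ d → mrdDim m k d ≡ m ℕ.* (suc k ∸ d)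
      mrdDim≡ d = cong₂ (λ x y → x ℕ.* (suc y ∸ d)) (ℕ.m≥n⇒m⊔n≡m k≤m) (ℕ.m≥n⇒m⊓n≡n k≤m)

      low-rank : ∀ {r} → r ≤ k ∸ δ → r ℕ.+ δ ≤ k
      low-rank r≤ = ℕ.≤-trans (ℕ.+-monoˡ-≤ δ r≤) (ℕ.≤-reflexive (ℕ.m∸n+n≡m δ≤k))

    -- A set of matrices Z whose spaces (Z | I) may join the lifted code. Only a lower bound `s` on
    -- its size is recorded, so the terms of the maximum can be treated one at a time.
    record Supplement (s : ℕ) : Set where
      field
        members   : List (Matrix k m)
        separated : AllPairs (λ Z Z′ → δ ≤ rank (Z ⊖ Z′)) members
        low       : All (λ Z → rank Z ℕ.+ δ ≤ k) members
        enough    : s ≤ length members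

    supplemented : (D : MRD m k δ) → ∀ {s} → Supplement s → AbarGe n δ k (main-term ℕ.+ s)
    supplemented D {s} S = proj₁ built , D′ , proj₁ (proj₂ built) , (begin
      main-term ℕ.+ s                         ≤⟨ ℕ.+-monoʳ-≤ main-term enough ⟩
      main-term ℕ.+ length members            ≡⟨ cong (λ e → q ^ e ℕ.+ length members) exponent ⟨
      q ^ mrdDim k m δ ℕ.+ length members     ≡⟨ proj₂ (proj₂ built) ⟨
      CDC.size (proj₁ built)                  ∎)
      where
      open ℕ.≤-Reasoning
      open Supplement S
      D′ = transposed-mrd 0<δ D
      built = augmented-code 2k≤n D′ members separated low
      exponent : mrdDim k m δ ≡ m ℕ.* (k ∸ δ ℕ.+ 1)
      exponent = trans (cong₂ (λ x y → x ℕ.* (suc y ∸ δ)) (ℕ.m≤n⇒m⊔n≡n k≤m) (ℕ.m≤n⇒m⊓n≡m k≤m))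
        (cong (m ℕ.*_) (trans (ℕ.+-∸-assoc 1 δ≤k) (ℕ.+-comm 1 (k ∸ δ))))

    weaken : ∀ {s s′} → s ≤ s′ → Supplement s′ → Supplement s
    weaken s≤ S = record
      { members = members ; separated = separated ; low = low ; enough = ℕ.≤-trans s≤ enough }
      where open Supplement S

    selected-words : ∀ {N} (X : Vector N → Matrix m k) {P : Vector N → Set} (P? : ∀ c → Dec (P c)) →
      (∀ {c} → P c → rank (X c) ≤ k ∸ δ) → (∀ {c c′} → (∃ λ i → c i ≢ c′ i) → δ ≤ rank (X c ⊖ X c′)) →
      Supplement (count P? (allVectors N))
    selected-words {N} X P? P-low apart = record
      { members = map (λ c → (X c) ᵀ) (filter P? (allVectors N))
      ; separated = AllPairs.map⁺ (AllPairs.filter⁺ P? (AllPairs.map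
          (λ {c} {c′} ne → subst (δ ≤_) (sym (rank-ᵀ (X c ⊖ X c′))) (apart ne)) (allVectors-unique N)))
      ; low = All.map⁺ (All.map (λ {c} p → low-rank (subst (_≤ k ∸ δ) (sym (rank-ᵀ (X c))) (P-low p)))
          (All.all-filter P? (allVectors N)))
      ; enough = ℕ.≤-reflexive (sym (length-map _ (filter P? (allVectors N)))) }

    -- The zero word has rank 0 < δ and so is not among the words of rank δ, ..., k - δ; it
    -- contributes the summand 1.
    large-k : (D : MRD m k δ) → Supplement (sumRange δ (k ∸ δ) (MRD.rankCount D) ℕ.+ 1)
    large-k D = weaken bound (selected-words X small? id (minRank-separates {G = MRD.basis D} (mrd-minRank D)))
      where
      N = mrdDim m k δ
      X : Vector N → Matrix m k
      X c = matComb c (MRD.basis D)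
      r : Vector N → ℕ
      r c = rank (X c)
      small? : ∀ c → Dec (r c ≤ k ∸ δ)
      small? c = r c ℕ.≤? k ∸ δ
      middle? : ∀ c → Dec (δ ≤ r c × r c ≤ k ∸ δ)
      middle? c = (δ ℕ.≤? r c) ×-dec (r c ℕ.≤? k ∸ δ)
      zero? : ∀ c → Dec (r c ≡ 0)
      zero? c = r c ℕ.≟ 0

      bound : sumRange δ (k ∸ δ) (MRD.rankCount D) ℕ.+ 1 ≤ count small? (allVectors N)
      bound = ℕ.≤-trans (ℕ.+-mono-≤
        (ℕ.≤-trans (ℕ.≤-reflexive (sumRange-cong δ (k ∸ δ) (λ i _ → rankCount-as-count D i)))
          (count-range r middle? δ (k ∸ δ) _,_ (allVectors N)))
        (filter-some zero? (Any.map (λ {c} e → rank-zero (matComb-zero (MRD.basis D) (λ i → sym (e i))))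
          (allVectors-complete 𝟎))))
        (count-disjoint middle? zero? small? proj₂ (λ e → subst (_≤ k ∸ δ) (sym e) z≤n)
          (λ (δ≤ , _) e → ℕ.<⇒≱ 0<δ (subst (δ ≤_) e δ≤)) (allVectors N))

    module _ (primePower : IsPrimePower q) (k<2δ : k < 2 ℕ.* δ) {α : ℕ} (0<α : 0 < α) (α<δ : α < δ) where

      private
        open Gabidulin F (cyclic-extension primePower m 0<m) using (code; code-minRank; all-polynomials;
             split-polynomials)

        -- n₁ = k + 1 - δ coefficients give minimum rank δ, and n₁ + n₂ = k + 1 - α give minimum
        -- rank α. The q^N₂ choices of the n₂ high coefficients are the cosets.
        n₁ n₂ N₁ N₂ : ℕ
        n₁ = suc k ∸ δ
        n₂ = δ ∸ α
        N₁ = n₁ ℕ.* m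
        N₂ = n₂ ℕ.* m

        n₁+δ : n₁ ℕ.+ δ ≡ suc k
        n₁+δ = ℕ.m∸n+n≡m (ℕ.m≤n⇒m≤1+n δ≤k)

        n₁+n₂+α : n₁ ℕ.+ n₂ ℕ.+ α ≡ suc k
        n₁+n₂+α = trans (ℕ.+-assoc n₁ n₂ α) (trans (cong (n₁ ℕ.+_) (ℕ.m∸n+n≡m (ℕ.<⇒≤ α<δ))) n₁+δ)

        G : Fin (N₁ ℕ.+ N₂) → Matrix m k
        G = code k≤m (split-polynomials n₁ n₂)

        G₁ : Fin N₁ → Matrix m k
        G₁ = code k≤m (all-polynomials n₁)

        G-minRank : MinRank α G
        G-minRank = code-minRank k≤m (split-polynomials n₁ n₂) n₁+n₂+α

        G₁-minRank : MinRank δ G₁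
        G₁-minRank = code-minRank k≤m (all-polynomials n₁) n₁+δ

        -- The low part of the split family consists of the same polynomials at the same points, so
        -- the small code is literally the first N₁ basis words of the large one.
        G-low : ∀ t i l → G (t Fin.↑ˡ N₂) i l ≡ G₁ t i l
        G-low t i l = cong (λ y → proj₁ (CyclicExtension.value-surjective (cyclic-extension primePower m 0<m) y) i)
          (⧺-↑ˡ _ _ t)

        X : Vector (N₁ ℕ.+ N₂) → Matrix m k
        X c = matComb c G

        X-cong : ∀ {c d} → c ≗ d → rank (X c) ≡ rank (X d)
        X-cong h = rank-cong (λ i → ⊙-congˡ (λ t → G t i) h)

        X-⧺ : ∀ f g i l → X (f ⧺ g) i l ≡ matComb f G₁ i l + (g ⊙ (λ t → G (N₁ Fin.↑ʳ t) i)) l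
        X-⧺ f g i l = trans (⊙-⧺ N₁ {N₂} (f ⧺ g) (λ t → G t i) l) (cong₂ _+_
          (⊙-cong (⧺-↑ˡ f g) (λ t j → G-low t i j) l)
          (⊙-congˡ (λ t → G (N₁ Fin.↑ʳ t) i) (⧺-↑ʳ f g) l))

        -- Words with the same high coefficients differ by a word of the subcode G₁.
        coset-apart : ∀ g {f f′} → (∃ λ i → f i ≢ f′ i) → δ ≤ rank (X (f ⧺ g) ⊖ X (f′ ⧺ g))
        coset-apart g {f} {f′} ne = subst (δ ≤_) (rank-cong (λ i l → sym (trans
            (cong₂ _-_ (X-⧺ f g i l) (X-⧺ f′ g i l)) (shift _ _ _))))
          (minRank-separates {G = G₁} G₁-minRank ne)
          where
          shift : ∀ a b c → (a + c) - (b + c) ≡ a - b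
          shift a b c = trans (cong (a + c +_) (trans (sym (-‿+-comm b c)) (+-comm (- b) (- c))))
            (trans (sym (+-assoc (a + c) (- c) (- b))) (cong (_- b) (trans (+-assoc a c (- c))
              (trans (cong (a +_) (-‿inverseʳ c)) (+-identityʳ a)))))

        Low : Vector (N₁ ℕ.+ N₂) → Set
        Low c = 1 ≤ rank (X c) × rank (X c) ≤ k ∸ δ

        Low? : ∀ c → Dec (Low c)
        Low? c = (1 ℕ.≤? rank (X c)) ×-dec (rank (X c) ℕ.≤? k ∸ δ)

        Low-cong : ∀ {c d} → c ≗ d → Low c → Low d
        Low-cong h (a , b) = subst (1 ≤_) (X-cong h) a , subst (_≤ k ∸ δ) (X-cong h) b

        share : Vector N₂ → ℕ
        share g = count (λ f → Low? (f ⧺ g)) (allVectors N₁)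

        k∸δ<δ : k ∸ δ < δ
        k∸δ<δ = ℕ.+-cancelʳ-< δ (k ∸ δ) δ (subst₂ _<_ (sym (ℕ.m∸n+n≡m δ≤k))
          (cong (δ ℕ.+_) (ℕ.+-identityʳ δ)) k<2δ)

        -- The coset of 0 is the code of minimum rank δ, and k < 2δ gives k - δ < δ. That coset is
        -- the hole left out by the - 1 in the denominator.
        zero-share : Any (λ g → share g ≡ 0) (allVectors N₂)
        zero-share = Any.map (λ {g} e → cong length (filter-none (λ f → Low? (f ⧺ g))
            (All.universal (λ f → excluded f (λ i → sym (e i))) (allVectors N₁))))
          (allVectors-complete 𝟎)
          where
          excluded : ∀ f {g} → g ≗ 𝟎 → ¬ Low (f ⧺ g)
          excluded f {g} g≗0 (1≤ , ≤s) = ℕ.<⇒≱ 1≤ (ℕ.≤-reflexive (trans same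
              (rank-zero (matComb-zero G₁ (G₁-minRank f (subst (_< δ) same (ℕ.≤-<-trans ≤s k∸δ<δ)))))))
            where
            same : rank (X (f ⧺ g)) ≡ rank (matComb f G₁)
            same = rank-cong (λ i l → trans (X-⧺ f g i l) (trans (cong (matComb f G₁ i l +_)
              (⊙-zeroˡ (λ t → G (N₁ Fin.↑ʳ t) i) g≗0 l)) (+-identityʳ _)))

        shares-cover : count Low? (allVectors (N₁ ℕ.+ N₂)) ≤ sumᴺ (map share (allVectors N₂))
        shares-cover = subst (count Low? (allVectors (N₁ ℕ.+ N₂)) ≤_)
          (trans (length-concatMap coset (allVectors N₂))
            (sum-map-cong (λ g → length-map (_⧺ g) (filter (λ f → Low? (f ⧺ g)) (allVectors N₁))) (allVectors N₂)))
          (length-≤ _≗_ (AllPairs.map (λ (i , ne) y h h′ → ne (trans (h i) (sym (h′ i))))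
              (AllPairs.filter⁺ Low? (allVectors-unique (N₁ ℕ.+ N₂))))
            (All.map hit (All.all-filter Low? (allVectors (N₁ ℕ.+ N₂)))))
          where
          coset : Vector N₂ → List (Vector (N₁ ℕ.+ N₂))
          coset g = map (_⧺ g) (filter (λ f → Low? (f ⧺ g)) (allVectors N₁))
          hit : ∀ {c} → Low c → Any (c ≗_) (concatMap coset (allVectors N₂))
          hit {c} low = Any.concat⁺ (Any.map⁺ (Any.map (λ {g} eg → Any.map⁺ (Any-filter⁺ (λ f → Low? (f ⧺ g))
              (Any.map (λ {f} ef → let e = agree ef eg in e , Low-cong e low) (allVectors-complete (c ∘ (Fin._↑ˡ N₂))))))
            (allVectors-complete (c ∘ (N₁ Fin.↑ʳ_)))))
            where
            agree : ∀ {f g} → c ∘ (Fin._↑ˡ N₂) ≗ f → c ∘ (N₁ Fin.↑ʳ_) ≗ g → c ≗ f ⧺ g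
            agree {f} {g} ef eg = ⧺-ext (λ i → trans (ef i) (sym (⧺-↑ˡ f g i))) (λ i → trans (eg i) (sym (⧺-↑ʳ f g i)))

        -- The two codes have lengths that equal m (n₁ + n₂) by arithmetic but not by computation;
        -- generalising over the lengths lets both be identified with it.
        same-distribution : ∀ {N N′} → N ≡ m ℕ.* (n₁ ℕ.+ n₂) → N′ ≡ m ℕ.* (n₁ ℕ.+ n₂) →
          (H : Fin N → Matrix m k) (H′ : Fin N′ → Matrix m k) → MinRank α H → MinRank α H′ → ∀ {i} → i ≤ k →
          count (λ c → rank (matComb c H) ℕ.≟ i) (allVectors N) ≡
          count (λ c → rank (matComb c H′) ℕ.≟ i) (allVectors N′)
        same-distribution refl refl H H′ = rank-distribution n₁+n₂+α 0<α H H′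

      small-k : (D : MRD m k α) →
        Supplement (ceilDiv (sumRange 1 (k ∸ δ) (MRD.rankCount D)) (q ^ (m ℕ.* (δ ∸ α)) ∸ 1))
      small-k D = weaken (subst (λ Q → ceilDiv S (Q ∸ 1) ≤ share g) cosets (proj₂ hole))
        (selected-words (λ f → X (f ⧺ g)) (λ f → Low? (f ⧺ g)) proj₂ (coset-apart g))
        where
        S = sumRange 1 (k ∸ δ) (MRD.rankCount D)

        S≤ : S ≤ sumᴺ (map share (allVectors N₂))
        S≤ = ℕ.≤-trans (ℕ.≤-reflexive (sumRange-cong 1 (k ∸ δ) (λ i i≤ → trans (rankCount-as-count D i)
            (same-distribution
              (trans (mrdDim≡ α) (cong (m ℕ.*_) (trans (cong (_∸ α) (sym n₁+n₂+α)) (ℕ.m+n∸n≡m (n₁ ℕ.+ n₂) α))))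
              (trans (sym (ℕ.*-distribʳ-+ m n₁ n₂)) (ℕ.*-comm (n₁ ℕ.+ n₂) m))
              (MRD.basis D) G (mrd-minRank D) G-minRank (ℕ.≤-trans i≤ (ℕ.m∸n≤m k δ))))))
          (ℕ.≤-trans (count-range (λ c → rank (X c)) Low? 1 (k ∸ δ) _,_ (allVectors (N₁ ℕ.+ N₂))) shares-cover)

        hole = pigeonhole share (allVectors N₂) S S≤ zero-share
        g = proj₁ hole

        cosets : length (allVectors N₂) ≡ q ^ (m ℕ.* (δ ∸ α))
        cosets = trans (length-allVectors N₂) (cong (q ^_) (ℕ.*-comm n₂ m))

    -- Generalising over the decision `d` makes the conditional in the bound reduce, and the second
    -- supplement is requested only when k < 2δ.
    by-cases : (D : MRD m k δ) (d : Dec (2 ℕ.* δ ≤ k)) {s t : ℕ} →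
      Supplement s → (¬ (2 ℕ.* δ ≤ k) → Supplement t) → AbarGe n δ k (main-term ℕ.+ (if ⌊ d ⌋ then s else t))
    by-cases D (yes _) S T = supplemented D S
    by-cases D (no ¬p) S T = supplemented D (T ¬p)

  lower-bound : IsPrimePower q → (n k δ : ℕ) → 2 ℕ.* k ≤ n → 2 ℕ.* δ < 2 ℕ.* k → 0 < 2 ℕ.* δ →
    (Dδ : MRD (n ∸ k) k δ) → (Dlow : (a : Fin (δ ∸ 1)) → MRD (n ∸ k) k (suc (toℕ a))) →
    AbarGe n δ k (bound2p7 n k δ Dδ Dlow)
  lower-bound primePower n k δ 2k≤n 2δ<2k 0<2δ Dδ Dlow =
    by-cases 2k≤n δ<k 0<δ Dδ (2 ℕ.* δ ℕ.≤? k) (large-k 2k≤n δ<k 0<δ Dδ) λ k<2δ →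
      maxList-elim (Supplement 2k≤n δ<k 0<δ) none (All.map⁺ (All.universal
        (λ a → small-k 2k≤n δ<k 0<δ primePower (ℕ.≰⇒> k<2δ) (s≤s z≤n) (below a) (Dlow a)) (allFin (δ ∸ 1))))
    where
    δ<k : δ < k
    δ<k = ℕ.*-cancelˡ-< 2 δ k 2δ<2k
    0<δ : 0 < δ
    0<δ = ℕ.*-cancelˡ-< 2 0 δ 0<2δ
    below : ∀ (a : Fin (δ ∸ 1)) → suc (toℕ a) < δ
    below a = subst (suc (toℕ a) <_) (ℕ.m+[n∸m]≡n 0<δ) (s≤s (Fin.toℕ<n a))
    -- `maxList` folds from 0, so its induction starts with the empty supplement.
    none : Supplement 2k≤n δ<k 0<δ 0
    none = record { members = [] ; separated = [] ; low = [] ; enough = z≤n }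

open import Data.Nat using (_*_)

theorem2p7 : (q : ℕ) → IsPrimePower q → (F : FiniteField q) →
    (n k δ : ℕ) → 2 * k ≤ n → 2 * δ < 2 * k → 0 < 2 * δ →
    (Dδ : LinAlg.MRD F (n ∸ k) k δ) →
    (Dlow : (a : Fin (δ ∸ 1)) → LinAlg.MRD F (n ∸ k) k (suc (toℕ a))) →
    LinAlg.AbarGe F n δ k (LinAlg.bound2p7 F n k δ Dδ Dlow)
theorem2p7 q primePower F = LowerBound.lower-bound F primePower
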